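{- Let $f=a_0+a_1 z+\cdots+a_mz^m\in \mathbb{Z}[z]$ be primitive (the greatest common divisor of its coefficients is $1$). Suppose there exist positive real numbers $\alpha<\beta$ and an index $j\in\{0,1,\ldots,m\}$ such that \[ |a_j| \alpha^j>\sum_{i=0,\, i\neq j}^m |a_i|\beta^i. \] Further, suppose there exist natural numbers $n$, $d$, $k$, $\ell\leq m$, and a prime $p$ with $p\nmid d$ such that $\beta-d\geq n\geq \alpha+d$, $f(n)=\pm p^k d$, $\gcd(k,\ell)=1$, $p^k$ divides $\frac{f^{(i)}(n)}{i!}$ for each $i=0, 1, \ldots,\ell-1$, and, in case $k>1$, also $p\nmid \frac{f^{(\ell)}(n)}{\ell!}$. Then $f$ is irreducible in $\mathbb{Z}[z]$.
   Context: $f^{(i)}$ denotes the $i$-th derivative of $f$ with respect to $z$. Natural numbers are positive integers. -}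

module Defs where

open import Algebra.Bundles.Raw using (RawSemiring)
import Algebra.Definitions.RawSemiring as RawSemiringDefinitions
open import Data.Integer.Base as ℤ using (ℤ; +_; 0ℤ; 1ℤ)
import Data.Integer.GCD as ℤ
open import Data.List.Base using (List; []; _∷_; map; foldr)
open import Data.Nat.Base as ℕ using (ℕ; zero; suc; _!)
import Data.Nat.Properties as ℕ
open import Data.Product.Base using (∃; _×_; _,_)
open import Data.Rational.Base as ℚ using (ℚ; 0ℚ; 1ℚ; ½; ∣_∣; Positive)
import Data.Rational.Properties as ℚ
open import Level using (0ℓ)
open import Relation.Binary.PropositionalEquality using (_≡_; sym; trans; cong; subst; module ≡-Reasoning)
open import Relation.Nullary.Decidable.Core using (dec⇒maybe)
open import Tactic.RingSolver using (solve-∀)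
open import Tactic.RingSolver.Core.AlmostCommutativeRing using (fromCommutativeRing)

------------------------------------------------------------------------
-- Polynomials over ℤ

-- Coefficients are listed from the constant term upwards.  Trailing
-- zeros are allowed, so equality of polynomials is _≈ₚ_, not _≡_.
ℤ[z] : Set
ℤ[z] = List ℤ

coeff : ℤ[z] → ℕ → ℤ
coeff []      _       = 0ℤ
coeff (a ∷ f) zero    = a
coeff (a ∷ f) (suc i) = coeff f i

infix  4 _≈ₚ_
infixl 6 _+ₚ_
infixl 7 _*ₚ_

_≈ₚ_ : ℤ[z] → ℤ[z] → Set
f ≈ₚ g = ∀ i → coeff f i ≡ coeff g i

_+ₚ_ : ℤ[z] → ℤ[z] → ℤ[z]
[]      +ₚ g       = g
(a ∷ f) +ₚ []      = a ∷ f
(a ∷ f) +ₚ (b ∷ g) = a ℤ.+ b ∷ f +ₚ g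

_*ₚ_ : ℤ[z] → ℤ[z] → ℤ[z]
[]      *ₚ g = []
(a ∷ f) *ₚ g = map (a ℤ.*_) g +ₚ (0ℤ ∷ f *ₚ g)

ℤ[z]-rawSemiring : RawSemiring 0ℓ 0ℓ
ℤ[z]-rawSemiring = record
  { Carrier = ℤ[z]
  ; _≈_     = _≈ₚ_
  ; _+_     = _+ₚ_
  ; _*_     = _*ₚ_
  ; 0#      = []
  ; 1#      = 1ℤ ∷ []
  }

open RawSemiringDefinitions ℤ[z]-rawSemiring public using (Irreducible)

Primitive : ℤ[z] → Set
Primitive f = foldr ℤ.gcd 0ℤ f ≡ 1ℤ

eval : ℤ[z] → ℤ → ℤ
eval []      x = 0ℤ
eval (a ∷ f) x = a ℤ.+ x ℤ.* eval f x

scaleFrom : ℕ → ℤ[z] → ℤ[z]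
scaleFrom i []      = []
scaleFrom i (a ∷ f) = + i ℤ.* a ∷ scaleFrom (suc i) f

derivative : ℤ[z] → ℤ[z]
derivative []      = []
derivative (a ∷ f) = scaleFrom 1 f

infix 9 _⁽_⁾

_⁽_⁾ : ℤ[z] → ℕ → ℤ[z]
f ⁽ zero  ⁾ = f
f ⁽ suc i ⁾ = derivative (f ⁽ i ⁾)

-- f⁽ⁱ⁾(x) / i!.  Every coefficient of f⁽ⁱ⁾ is divisible by i!, so the
-- integer division is exact.
taylorCoeff : ℤ[z] → ℕ → ℤ → ℤ
taylorCoeff f i x = (eval (f ⁽ i ⁾) x ℤ./ℕ (i !)) {{i ℕ.!≢0}}

------------------------------------------------------------------------
-- Real numbers, as Cauchy sequences of rationals

IsCauchy : (ℕ → ℚ) → Set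
IsCauchy x = ∀ ε → 0ℚ ℚ.< ε →
  ∃ λ N → ∀ m n → N ℕ.≤ m → N ℕ.≤ n → ∣ x m ℚ.- x n ∣ ℚ.< ε

record ℝ : Set where
  constructor mkℝ
  field
    seq      : ℕ → ℚ
    isCauchy : IsCauchy seq

open ℝ public

infix  4 _≈ᵣ_ _<ᵣ_ _≤ᵣ_
infixl 6 _+ᵣ_ _-ᵣ_
infixl 7 _*ᵣ_
infix  8 -ᵣ_

_≈ᵣ_ : ℝ → ℝ → Set
x ≈ᵣ y = ∀ ε → 0ℚ ℚ.< ε → ∃ λ N → ∀ n → N ℕ.≤ n → ∣ seq x n ℚ.- seq y n ∣ ℚ.< ε

_<ᵣ_ : ℝ → ℝ → Set
x <ᵣ y = ∃ λ ε → 0ℚ ℚ.< ε × ∃ λ N → ∀ n → N ℕ.≤ n → seq x n ℚ.+ ε ℚ.< seq y n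

_≤ᵣ_ : ℝ → ℝ → Set
x ≤ᵣ y = ∀ ε → 0ℚ ℚ.< ε → ∃ λ N → ∀ n → N ℕ.≤ n → seq x n ℚ.< seq y n ℚ.+ ε

private

  ℚ-ring = fromCommutativeRing ℚ.+-*-commutativeRing (λ q → dec⇒maybe (0ℚ ℚ.≟ q))

  halves : ∀ ε → ½ ℚ.* ε ℚ.+ ½ ℚ.* ε ≡ ε
  halves ε = trans (sym (ℚ.*-distribʳ-+ ε ½ ½)) (ℚ.*-identityˡ ε)

  half-pos : ∀ ε → 0ℚ ℚ.< ε → 0ℚ ℚ.< ½ ℚ.* ε
  half-pos ε 0<ε = ℚ.positive⁻¹ _ {{ℚ.pos*pos⇒pos ½ ε {{ℚ.positive 0<ε}}}}

  0≤∣_∣ : ∀ p → 0ℚ ℚ.≤ ∣ p ∣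
  0≤∣ p ∣ = ℚ.nonNegative⁻¹ ∣ p ∣ {{ℚ.∣-∣-nonNeg p}}

  const-cauchy : ∀ q → IsCauchy (λ _ → q)
  const-cauchy q ε 0<ε = 0 , λ _ _ _ _ →
    subst (λ r → ∣ r ∣ ℚ.< ε) (sym (ℚ.+-inverseʳ q)) 0<ε

  +-cauchy : ∀ {x y} → IsCauchy x → IsCauchy y → IsCauchy (λ n → x n ℚ.+ y n)
  +-cauchy {x} {y} cx cy ε 0<ε
    with cx (½ ℚ.* ε) (half-pos ε 0<ε) | cy (½ ℚ.* ε) (half-pos ε 0<ε)
  ... | M , hx | N , hy = M ℕ.⊔ N , λ m n M⊔N≤m M⊔N≤n → begin-strict
      ∣ (x m ℚ.+ y m) ℚ.- (x n ℚ.+ y n) ∣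
        ≡⟨ cong ∣_∣ (rearrange (x m) (y m) (x n) (y n)) ⟩
      ∣ (x m ℚ.- x n) ℚ.+ (y m ℚ.- y n) ∣
        ≤⟨ ℚ.∣p+q∣≤∣p∣+∣q∣ (x m ℚ.- x n) (y m ℚ.- y n) ⟩
      ∣ x m ℚ.- x n ∣ ℚ.+ ∣ y m ℚ.- y n ∣
        <⟨ ℚ.+-mono-< (hx m n (ℕ.m⊔n≤o⇒m≤o M N M⊔N≤m) (ℕ.m⊔n≤o⇒m≤o M N M⊔N≤n))
                      (hy m n (ℕ.m⊔n≤o⇒n≤o M N M⊔N≤m) (ℕ.m⊔n≤o⇒n≤o M N M⊔N≤n)) ⟩
      ½ ℚ.* ε ℚ.+ ½ ℚ.* ε
        ≡⟨ halves ε ⟩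
      ε ∎
    where
    open ℚ.≤-Reasoning
    rearrange : ∀ a b c d → (a ℚ.+ b) ℚ.- (c ℚ.+ d) ≡ (a ℚ.- c) ℚ.+ (b ℚ.- d)
    rearrange = solve-∀ ℚ-ring

  neg-cauchy : ∀ {x} → IsCauchy x → IsCauchy (λ n → ℚ.- x n)
  neg-cauchy {x} cx ε 0<ε with cx ε 0<ε
  ... | N , hx = N , λ m n N≤m N≤n →
    subst (ℚ._< ε) (flip-abs (x m) (x n)) (hx m n N≤m N≤n)
    where
    flip-neg : ∀ a b → (ℚ.- a) ℚ.- (ℚ.- b) ≡ ℚ.- (a ℚ.- b)
    flip-neg = solve-∀ ℚ-ring
    flip-abs : ∀ a b → ∣ a ℚ.- b ∣ ≡ ∣ (ℚ.- a) ℚ.- (ℚ.- b) ∣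
    flip-abs a b = begin
      ∣ a ℚ.- b ∣                  ≡⟨ ℚ.∣-p∣≡∣p∣ (a ℚ.- b) ⟨
      ∣ ℚ.- (a ℚ.- b) ∣            ≡⟨ cong ∣_∣ (flip-neg a b) ⟨
      ∣ (ℚ.- a) ℚ.- (ℚ.- b) ∣      ∎
      where open ≡-Reasoning

  eventually-bounded : ∀ {x} → IsCauchy x →
    ∃ λ B → 0ℚ ℚ.< B × ∃ λ N → ∀ n → N ℕ.≤ n → ∣ x n ∣ ℚ.≤ B
  eventually-bounded {x} cx with cx 1ℚ (ℚ.positive⁻¹ 1ℚ)
  ... | N , hx = 1ℚ ℚ.+ ∣ x N ∣
               , ℚ.+-mono-<-≤ (ℚ.positive⁻¹ 1ℚ) 0≤∣ x N ∣
               , N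
               , λ n N≤n → begin
      ∣ x n ∣                          ≡⟨ cong ∣_∣ (split (x n) (x N)) ⟩
      ∣ (x n ℚ.- x N) ℚ.+ x N ∣        ≤⟨ ℚ.∣p+q∣≤∣p∣+∣q∣ (x n ℚ.- x N) (x N) ⟩
      ∣ x n ℚ.- x N ∣ ℚ.+ ∣ x N ∣      ≤⟨ ℚ.+-monoˡ-≤ ∣ x N ∣ (ℚ.<⇒≤ (hx n N N≤n ℕ.≤-refl)) ⟩
      1ℚ ℚ.+ ∣ x N ∣                   ∎
    where
    open ℚ.≤-Reasoning
    split : ∀ a b → a ≡ (a ℚ.- b) ℚ.+ b
    split = solve-∀ ℚ-ring

  ∣*∣-< : ∀ {p q B δ} → 0ℚ ℚ.< B → ∣ p ∣ ℚ.≤ B → ∣ q ∣ ℚ.< δ → ∣ p ℚ.* q ∣ ℚ.< B ℚ.* δ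
  ∣*∣-< {p} {q} {B} {δ} 0<B p≤B q<δ = begin-strict
    ∣ p ℚ.* q ∣          ≡⟨ ℚ.∣p*q∣≡∣p∣*∣q∣ p q ⟩
    ∣ p ∣ ℚ.* ∣ q ∣      ≤⟨ ℚ.*-monoʳ-≤-nonNeg ∣ q ∣ {{ℚ.∣-∣-nonNeg q}} p≤B ⟩
    B ℚ.* ∣ q ∣          <⟨ ℚ.*-monoʳ-<-pos B {{ℚ.positive 0<B}} q<δ ⟩
    B ℚ.* δ              ∎
    where open ℚ.≤-Reasoning

  divide : ∀ B ε → 0ℚ ℚ.< B → 0ℚ ℚ.< ε → ∃ λ δ → 0ℚ ℚ.< δ × B ℚ.* δ ≡ ε
  divide B ε 0<B 0<ε = B⁻¹ ℚ.* ε , ℚ.positive⁻¹ _ {{pos}} , (begin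
    B ℚ.* (B⁻¹ ℚ.* ε)      ≡⟨ ℚ.*-assoc B B⁻¹ ε ⟨
    (B ℚ.* B⁻¹) ℚ.* ε      ≡⟨ cong (ℚ._* ε) (ℚ.*-inverseʳ B {{B≢0}}) ⟩
    1ℚ ℚ.* ε               ≡⟨ ℚ.*-identityˡ ε ⟩
    ε                      ∎)
    where
    open ≡-Reasoning
    B>0 : Positive B
    B>0 = ℚ.positive 0<B
    B≢0 : ℚ.NonZero B
    B≢0 = ℚ.pos⇒nonZero B {{B>0}}
    B⁻¹ : ℚ
    B⁻¹ = ℚ.1/_ B {{B≢0}}
    pos : Positive (B⁻¹ ℚ.* ε)
    pos = ℚ.pos*pos⇒pos B⁻¹ {{ℚ.1/pos⇒pos B {{B>0}}}} ε {{ℚ.positive 0<ε}}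

  product-close : ∀ a b c d {B C δ} → 0ℚ ℚ.< B → 0ℚ ℚ.< C →
    ∣ a ∣ ℚ.≤ B → ∣ d ∣ ℚ.≤ C → ∣ a ℚ.- c ∣ ℚ.< δ → ∣ b ℚ.- d ∣ ℚ.< δ →
    ∣ a ℚ.* b ℚ.- c ℚ.* d ∣ ℚ.< (B ℚ.+ C) ℚ.* δ
  product-close a b c d {B} {C} {δ} 0<B 0<C a≤B d≤C ac<δ bd<δ = begin-strict
    ∣ a ℚ.* b ℚ.- c ℚ.* d ∣
      ≡⟨ cong ∣_∣ (rearrange a b c d) ⟩
    ∣ a ℚ.* (b ℚ.- d) ℚ.+ d ℚ.* (a ℚ.- c) ∣
      ≤⟨ ℚ.∣p+q∣≤∣p∣+∣q∣ (a ℚ.* (b ℚ.- d)) (d ℚ.* (a ℚ.- c)) ⟩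
    ∣ a ℚ.* (b ℚ.- d) ∣ ℚ.+ ∣ d ℚ.* (a ℚ.- c) ∣
      <⟨ ℚ.+-mono-< (∣*∣-< {a} {b ℚ.- d} 0<B a≤B bd<δ) (∣*∣-< {d} {a ℚ.- c} 0<C d≤C ac<δ) ⟩
    B ℚ.* δ ℚ.+ C ℚ.* δ
      ≡⟨ ℚ.*-distribʳ-+ δ B C ⟨
    (B ℚ.+ C) ℚ.* δ ∎
    where
    open ℚ.≤-Reasoning
    rearrange : ∀ a b c d → a ℚ.* b ℚ.- c ℚ.* d ≡ a ℚ.* (b ℚ.- d) ℚ.+ d ℚ.* (a ℚ.- c)
    rearrange = solve-∀ ℚ-ring

  *-cauchy : ∀ {x y} → IsCauchy x → IsCauchy y → IsCauchy (λ n → x n ℚ.* y n)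
  *-cauchy {x} {y} cx cy ε 0<ε =
    let B , 0<B , K , bx = eventually-bounded {x} cx
        C , 0<C , L , by = eventually-bounded {y} cy
        δ , 0<δ , total  = divide (B ℚ.+ C) ε (ℚ.+-mono-< 0<B 0<C) 0<ε
    in bounded B C δ K L 0<B 0<C total bx by (cx δ 0<δ) (cy δ 0<δ)
    where
    bounded : ∀ B C δ K L → 0ℚ ℚ.< B → 0ℚ ℚ.< C → (B ℚ.+ C) ℚ.* δ ≡ ε →
      (∀ n → K ℕ.≤ n → ∣ x n ∣ ℚ.≤ B) → (∀ n → L ℕ.≤ n → ∣ y n ∣ ℚ.≤ C) →
      (∃ λ M → ∀ m n → M ℕ.≤ m → M ℕ.≤ n → ∣ x m ℚ.- x n ∣ ℚ.< δ) →
      (∃ λ N → ∀ m n → N ℕ.≤ m → N ℕ.≤ n → ∣ y m ℚ.- y n ∣ ℚ.< δ) →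
      ∃ λ P → ∀ m n → P ℕ.≤ m → P ℕ.≤ n → ∣ x m ℚ.* y m ℚ.- x n ℚ.* y n ∣ ℚ.< ε
    bounded B C δ K L 0<B 0<C total bx by (M , hx) (N , hy) =
      (K ℕ.⊔ L) ℕ.⊔ (M ℕ.⊔ N) , λ m n P≤m P≤n →
        subst (∣ x m ℚ.* y m ℚ.- x n ℚ.* y n ∣ ℚ.<_) total
          (product-close (x m) (y m) (x n) (y n) 0<B 0<C
            (bx m (K≤ P≤m)) (by n (L≤ P≤n))
            (hx m n (M≤ P≤m) (M≤ P≤n)) (hy m n (N≤ P≤m) (N≤ P≤n)))
      where
      K≤ : ∀ {i} → (K ℕ.⊔ L) ℕ.⊔ (M ℕ.⊔ N) ℕ.≤ i → K ℕ.≤ i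
      K≤ h = ℕ.m⊔n≤o⇒m≤o K L (ℕ.m⊔n≤o⇒m≤o (K ℕ.⊔ L) (M ℕ.⊔ N) h)
      L≤ : ∀ {i} → (K ℕ.⊔ L) ℕ.⊔ (M ℕ.⊔ N) ℕ.≤ i → L ℕ.≤ i
      L≤ h = ℕ.m⊔n≤o⇒n≤o K L (ℕ.m⊔n≤o⇒m≤o (K ℕ.⊔ L) (M ℕ.⊔ N) h)
      M≤ : ∀ {i} → (K ℕ.⊔ L) ℕ.⊔ (M ℕ.⊔ N) ℕ.≤ i → M ℕ.≤ i
      M≤ h = ℕ.m⊔n≤o⇒m≤o M N (ℕ.m⊔n≤o⇒n≤o (K ℕ.⊔ L) (M ℕ.⊔ N) h)
      N≤ : ∀ {i} → (K ℕ.⊔ L) ℕ.⊔ (M ℕ.⊔ N) ℕ.≤ i → N ℕ.≤ i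
      N≤ h = ℕ.m⊔n≤o⇒n≤o M N (ℕ.m⊔n≤o⇒n≤o (K ℕ.⊔ L) (M ℕ.⊔ N) h)

fromℚ : ℚ → ℝ
fromℚ q = mkℝ (λ _ → q) (const-cauchy q)

fromℕ : ℕ → ℝ
fromℕ n = fromℚ (+ n ℚ./ 1)

_+ᵣ_ : ℝ → ℝ → ℝ
x +ᵣ y = mkℝ (λ n → seq x n ℚ.+ seq y n) (+-cauchy {seq x} {seq y} (isCauchy x) (isCauchy y))

-ᵣ_ : ℝ → ℝ
-ᵣ x = mkℝ (λ n → ℚ.- seq x n) (neg-cauchy {seq x} (isCauchy x))

_-ᵣ_ : ℝ → ℝ → ℝ
x -ᵣ y = x +ᵣ (-ᵣ y)

_*ᵣ_ : ℝ → ℝ → ℝ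
x *ᵣ y = mkℝ (λ n → seq x n ℚ.* seq y n) (*-cauchy {seq x} {seq y} (isCauchy x) (isCauchy y))

ℝ-rawSemiring : RawSemiring 0ℓ 0ℓ
ℝ-rawSemiring = record
  { Carrier = ℝ
  ; _≈_     = _≈ᵣ_
  ; _+_     = _+ᵣ_
  ; _*_     = _*ᵣ_
  ; 0#      = fromℕ 0
  ; 1#      = fromℕ 1
  }

open RawSemiringDefinitions ℝ-rawSemiring public using () renaming (sum to sumᵣ; _^_ to _^ᵣ_)

{-# OPTIONS --safe #-}
module Submission where

-- No complex roots are used.  Put A = n − d and B = n + d; the hypotheses on α and β give
-- |a_j| A^j > Σ_{i≠j} |a_i| B^i, an inequality between natural numbers.  In the algebra of absolutely
-- convergent power series on the closed unit disc, n + d z has norm B and its inverse has norm 1 / A,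
-- so the dominant term makes f(n + d z) a unit, and with it every factor G(z) = g(n + d z).
-- Now reversing the coefficients of G preserves the ℓ² norm of every product G Q.  Taking for Q an
-- approximate inverse of G shows that the leading coefficient of G is at most its constant term in
-- absolute value, and strictly smaller for nonconstant G since being a unit is an open condition.
-- Hence |g(n)| > d for every nonconstant factor g.
-- On the other hand, the Newton polygon at p of f(n + z) starts with the segment from (0, k) to
-- (ℓ, 0), which has no interior lattice point since gcd(k, ℓ) = 1.  So in a factorisation f = g h the
-- prime p cannot divide both g(n) and h(n); if it does not divide g(n), then g(n) divides d,
-- so g is constant, and a unit because f is primitive.

open import Defs
open import Algebra.Bundles using (CommutativeRing; Semiring)
import Algebra.Definitions.RawMagma as RawMagmaDefinitions
import Algebra.Definitions.RawSemiring as RawSemiringDefinitions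
import Algebra.Properties.CommutativeSemiring.Exp as Exp
open import Data.Empty using (⊥; ⊥-elim)
open import Data.Fin.Base as Fin using (Fin; toℕ)
open import Data.Integer.Base using (ℤ; +_; -_; ∣_∣; 0ℤ; 1ℤ; +0)
import Data.Integer.Base as ℤ
import Data.Integer.Divisibility as ℤ
import Data.Integer.Divisibility.Signed as Signed
import Data.Integer.DivMod as ℤ using (a≡a%ℕn+[a/ℕn]*n; n%ℕd<d)
import Data.Integer.GCD as ℤ using (gcd; gcd-greatest)
import Data.Integer.Properties as ℤ
import Data.Integer.Tactic.RingSolver as ℤ-Solver
open import Data.List.Base using ([]; _∷_; map; length; drop; foldr)
open import Data.Maybe.Base as Maybe using (Maybe; just; nothing)
import Data.Nat.Base as ℕ
open import Data.Nat.Base using (ℕ; zero; suc; _+_; _*_; _^_; _≤_; _<_; _!)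
open import Data.Nat.Coprimality as Coprimality using (coprime-divisor; gcd≡1⇒coprime)
open import Data.Nat.Divisibility using (_∣_; _∤_; divides; _∣?_; _∣0; 1∣_; ∣1⇒≡1; ∣-trans; ∣⇒≤; m∣m*n; ∣m⇒∣m*n; ∣n⇒∣m*n; ∣m+n∣m⇒∣n; *-monoʳ-∣; *-monoˡ-∣; *-pres-∣; *-cancelˡ-∣; *-cancelʳ-∣)
open import Data.Nat.GCD using (gcd)
open import Data.Nat.Primality using (Prime; euclidsLemma; prime⇒nonZero; prime⇒nonTrivial)
import Data.Nat.Properties as ℕ
import Data.Nat.Tactic.RingSolver as ℕ-Solver
open import Data.Product.Base using (_,_; ∃; ∃₂; _×_; proj₁; proj₂)
open import Data.Rational.Base as ℚ using (ℚ; 0ℚ; 1ℚ)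
import Data.Rational.Properties as ℚ
import Data.Rational.Unnormalised.Base as ℚᵘ
import Data.Rational.Unnormalised.Properties as ℚᵘ
open import Data.Sum.Base using (_⊎_; inj₁; inj₂; [_,_]′)
open import Data.Vec.Functional using (Vector; toList; removeAt)
open import Level using (0ℓ)
open import Relation.Binary.Definitions using (Tri; tri<; tri≈; tri>)
open import Relation.Binary.PropositionalEquality using (_≡_; refl; sym; trans; cong; cong₂; subst; subst₂; module ≡-Reasoning)
open import Relation.Nullary.Decidable.Core using (yes; no; dec⇒maybe)
open import Relation.Nullary.Negation.Core using (¬_; contradiction)
open import Tactic.RingSolver using (solve-∀)
open import Tactic.RingSolver.Core.AlmostCommutativeRing using (AlmostCommutativeRing; fromCommutativeRing)

-- The commutative ring ℤ[z]

-- In terms of roots, dominance excludes every zero of f with modulus between A and B, and the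
-- closed disc of radius d about n lies in that annulus. So |g(n)|, the product of |lead g| and all
-- |n - root|, exceeds d^r for a factor g of degree r > 0. The substitution n + d z carries that
-- disc to the unit disc and multiplies the leading coefficient by d^r, so comparing the constant
-- term of G with its leading coefficient recovers the same bound without roots. Inverses do not
-- exist over the integers, so each near-identity is kept in the form `const c +ₚ -ₚ E`, and only
-- the ratio of `⟦ E ⟧` to |c| matters. Taking powers makes this ratio as small as needed; the
-- strictness of an inequality between integers, a margin of at least 1, then pays for what remains
-- of the error. The reals enter only once: the slack ε in the strict dominance inequality absorbs
-- the tolerances in α ≤ A and B ≤ β, after which everything is integral.

infix 4 _≋_

-- _≈ₚ_ unfolds to a function type, from which Agda cannot infer the two polynomials.
record _≋_ (f g : ℤ[z]) : Set where
  constructor pointwise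
  field at : f ≈ₚ g

open _≋_

coeff-+ : ∀ f g i → coeff (f +ₚ g) i ≡ coeff f i ℤ.+ coeff g i
coeff-+ []      g       i       = sym (ℤ.+-identityˡ (coeff g i))
coeff-+ (a ∷ f) []      i       = sym (ℤ.+-identityʳ (coeff (a ∷ f) i))
coeff-+ (a ∷ f) (b ∷ g) zero    = refl
coeff-+ (a ∷ f) (b ∷ g) (suc i) = coeff-+ f g i

coeff-map : ∀ (φ : ℤ → ℤ) → φ 0ℤ ≡ 0ℤ → ∀ f i → coeff (map φ f) i ≡ φ (coeff f i)
coeff-map φ φ0 []      i       = sym φ0
coeff-map φ φ0 (a ∷ f) zero    = refl
coeff-map φ φ0 (a ∷ f) (suc i) = coeff-map φ φ0 f i

infixr 7 _·_
infix  8 -ₚ_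

_·_ : ℤ → ℤ[z] → ℤ[z]
c · f = map (c ℤ.*_) f

-ₚ_ : ℤ[z] → ℤ[z]
-ₚ f = map -_ f

coeff-· : ∀ c f i → coeff (c · f) i ≡ c ℤ.* coeff f i
coeff-· c = coeff-map (c ℤ.*_) (ℤ.*-zeroʳ c)

coeff-neg : ∀ f i → coeff (-ₚ f) i ≡ - coeff f i
coeff-neg = coeff-map -_ refl

-- Cauchy product of coefficient sequences. Working with sequences frees the ring laws and the
-- Newton polygon argument from list lengths and trailing zeros.
convolution : (ℕ → ℤ) → (ℕ → ℤ) → ℕ → ℤ
convolution u v zero    = u 0 ℤ.* v 0
convolution u v (suc i) = u 0 ℤ.* v (suc i) ℤ.+ convolution (λ k → u (suc k)) v i

convolution-zeroˡ : ∀ v i → convolution (λ _ → 0ℤ) v i ≡ 0ℤ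
convolution-zeroˡ v zero    = ℤ.*-zeroˡ (v 0)
convolution-zeroˡ v (suc i) = cong₂ ℤ._+_ (ℤ.*-zeroˡ (v (suc i))) (convolution-zeroˡ v i)

convolution-cong : ∀ {u u′ v v′} → (∀ i → u i ≡ u′ i) → (∀ i → v i ≡ v′ i) →
  ∀ i → convolution u v i ≡ convolution u′ v′ i
convolution-cong eu ev zero    = cong₂ ℤ._*_ (eu 0) (ev 0)
convolution-cong eu ev (suc i) = cong₂ ℤ._+_ (cong₂ ℤ._*_ (eu 0) (ev (suc i)))
                                  (convolution-cong (λ k → eu (suc k)) ev i)

coeff-* : ∀ f g i → coeff (f *ₚ g) i ≡ convolution (coeff f) (coeff g) i
coeff-* []      g i       = sym (convolution-zeroˡ (coeff g) i)
coeff-* (a ∷ f) g zero    = begin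
  coeff (a · g +ₚ (0ℤ ∷ f *ₚ g)) 0   ≡⟨ coeff-+ (a · g) (0ℤ ∷ f *ₚ g) 0 ⟩
  coeff (a · g) 0 ℤ.+ 0ℤ             ≡⟨ ℤ.+-identityʳ (coeff (a · g) 0) ⟩
  coeff (a · g) 0                    ≡⟨ coeff-· a g 0 ⟩
  a ℤ.* coeff g 0                    ∎
  where open ≡-Reasoning
coeff-* (a ∷ f) g (suc i) = begin
  coeff (a · g +ₚ (0ℤ ∷ f *ₚ g)) (suc i)
    ≡⟨ coeff-+ (a · g) (0ℤ ∷ f *ₚ g) (suc i) ⟩
  coeff (a · g) (suc i) ℤ.+ coeff (f *ₚ g) i
    ≡⟨ cong₂ ℤ._+_ (coeff-· a g (suc i)) (coeff-* f g i) ⟩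
  a ℤ.* coeff g (suc i) ℤ.+ convolution (coeff f) (coeff g) i ∎
  where open ≡-Reasoning

≋-refl : ∀ {f} → f ≋ f
≋-refl .at i = refl

≋-sym : ∀ {f g} → f ≋ g → g ≋ f
≋-sym e .at i = sym (at e i)

≋-trans : ∀ {f g h} → f ≋ g → g ≋ h → f ≋ h
≋-trans e e′ .at i = trans (at e i) (at e′ i)

+ₚ-cong : ∀ {f f′ g g′} → f ≋ f′ → g ≋ g′ → f +ₚ g ≋ f′ +ₚ g′
+ₚ-cong {f} {f′} {g} {g′} e e′ .at i =
  trans (coeff-+ f g i) (trans (cong₂ ℤ._+_ (at e i) (at e′ i)) (sym (coeff-+ f′ g′ i)))

*ₚ-cong : ∀ {f f′ g g′} → f ≋ f′ → g ≋ g′ → f *ₚ g ≋ f′ *ₚ g′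
*ₚ-cong {f} {f′} {g} {g′} e e′ .at i =
  trans (coeff-* f g i) (trans (convolution-cong (at e) (at e′) i) (sym (coeff-* f′ g′ i)))

-ₚ-cong : ∀ {f g} → f ≋ g → -ₚ f ≋ -ₚ g
-ₚ-cong {f} {g} e .at i = trans (coeff-neg f i) (trans (cong -_ (at e i)) (sym (coeff-neg g i)))

·-cong : ∀ c {f g} → f ≋ g → c · f ≋ c · g
·-cong c {f} {g} e .at i = trans (coeff-· c f i) (trans (cong (c ℤ.*_) (at e i)) (sym (coeff-· c g i)))

∷-cong : ∀ {a b f g} → a ≡ b → f ≋ g → a ∷ f ≋ b ∷ g
∷-cong a≡b e .at zero    = a≡b
∷-cong a≡b e .at (suc i) = at e i

∷-injectiveʳ : ∀ {a b f g} → a ∷ f ≋ b ∷ g → f ≋ g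
∷-injectiveʳ e .at i = at e (suc i)

≋[]-tail : ∀ {a f} → [] ≋ a ∷ f → [] ≋ f
≋[]-tail e .at i = at e (suc i)

+ₚ-congˡ : ∀ h {f g} → f ≋ g → h +ₚ f ≋ h +ₚ g
+ₚ-congˡ h e = +ₚ-cong (≋-refl {h}) e

+ₚ-congʳ : ∀ h {f g} → f ≋ g → f +ₚ h ≋ g +ₚ h
+ₚ-congʳ h e = +ₚ-cong e (≋-refl {h})

*ₚ-congˡ : ∀ h {f g} → f ≋ g → h *ₚ f ≋ h *ₚ g
*ₚ-congˡ h e = *ₚ-cong (≋-refl {h}) e

*ₚ-congʳ : ∀ h {f g} → f ≋ g → f *ₚ h ≋ g *ₚ h
*ₚ-congʳ h e = *ₚ-cong e (≋-refl {h})

+ₚ-assoc : ∀ f g h → (f +ₚ g) +ₚ h ≋ f +ₚ (g +ₚ h)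
+ₚ-assoc f g h .at i
  rewrite coeff-+ (f +ₚ g) h i | coeff-+ f g i | coeff-+ f (g +ₚ h) i | coeff-+ g h i
  = ℤ.+-assoc (coeff f i) (coeff g i) (coeff h i)

+ₚ-comm : ∀ f g → f +ₚ g ≋ g +ₚ f
+ₚ-comm f g .at i rewrite coeff-+ f g i | coeff-+ g f i = ℤ.+-comm (coeff f i) (coeff g i)

+ₚ-identityʳ : ∀ f → f +ₚ [] ≋ f
+ₚ-identityʳ f .at i = trans (coeff-+ f [] i) (ℤ.+-identityʳ (coeff f i))

-ₚ-inverseˡ : ∀ f → -ₚ f +ₚ f ≋ []
-ₚ-inverseˡ f .at i
  rewrite coeff-+ (-ₚ f) f i | coeff-neg f i = ℤ.+-inverseˡ (coeff f i)

-ₚ-inverseʳ : ∀ f → f +ₚ -ₚ f ≋ []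
-ₚ-inverseʳ f = ≋-trans (+ₚ-comm f (-ₚ f)) (-ₚ-inverseˡ f)

0∷-+ : ∀ f g → 0ℤ ∷ (f +ₚ g) ≋ (0ℤ ∷ f) +ₚ (0ℤ ∷ g)
0∷-+ f g .at i = refl

0∷[] : 0ℤ ∷ [] ≋ []
0∷[] .at zero    = refl
0∷[] .at (suc i) = refl

·-distribˡ-+ : ∀ c f g → c · (f +ₚ g) ≋ c · f +ₚ c · g
·-distribˡ-+ c f g .at i
  rewrite coeff-· c (f +ₚ g) i | coeff-+ f g i | coeff-+ (c · f) (c · g) i | coeff-· c f i | coeff-· c g i
  = ℤ.*-distribˡ-+ c (coeff f i) (coeff g i)

·-distribʳ-+ : ∀ c d f → (c ℤ.+ d) · f ≋ c · f +ₚ d · f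
·-distribʳ-+ c d f .at i
  rewrite coeff-· (c ℤ.+ d) f i | coeff-+ (c · f) (d · f) i | coeff-· c f i | coeff-· d f i
  = ℤ.*-distribʳ-+ (coeff f i) c d

·-assoc : ∀ c d f → (c ℤ.* d) · f ≋ c · d · f
·-assoc c d f .at i
  rewrite coeff-· (c ℤ.* d) f i | coeff-· c (d · f) i | coeff-· d f i
  = ℤ.*-assoc c d (coeff f i)

·-zero : ∀ f → 0ℤ · f ≋ []
·-zero f .at i = trans (coeff-· 0ℤ f i) (ℤ.*-zeroˡ (coeff f i))

·-identity : ∀ f → 1ℤ · f ≋ f
·-identity f .at i = trans (coeff-· 1ℤ f i) (ℤ.*-identityˡ (coeff f i))

·-0∷ : ∀ c f → c · (0ℤ ∷ f) ≋ 0ℤ ∷ c · f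
·-0∷ c f = ∷-cong (ℤ.*-zeroʳ c) ≋-refl

+ₚ-interchange : ∀ f g h k → (f +ₚ g) +ₚ (h +ₚ k) ≋ (f +ₚ h) +ₚ (g +ₚ k)
+ₚ-interchange f g h k .at i
  rewrite coeff-+ (f +ₚ g) (h +ₚ k) i | coeff-+ f g i | coeff-+ h k i
        | coeff-+ (f +ₚ h) (g +ₚ k) i | coeff-+ f h i | coeff-+ g k i
  = interchange (coeff f i) (coeff g i) (coeff h i) (coeff k i)
  where
  interchange : ∀ a b c d → (a ℤ.+ b) ℤ.+ (c ℤ.+ d) ≡ (a ℤ.+ c) ℤ.+ (b ℤ.+ d)
  interchange = ℤ-Solver.solve-∀

*ₚ-distribʳ-+ : ∀ h f g → (f +ₚ g) *ₚ h ≋ f *ₚ h +ₚ g *ₚ h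
*ₚ-distribʳ-+ h []      g       = ≋-refl
*ₚ-distribʳ-+ h (a ∷ f) []      = ≋-sym (+ₚ-identityʳ ((a ∷ f) *ₚ h))
*ₚ-distribʳ-+ h (a ∷ f) (b ∷ g) =
  ≋-trans (+ₚ-cong (·-distribʳ-+ a b h) (∷-cong refl (*ₚ-distribʳ-+ h f g)))
          (+ₚ-interchange (a · h) (b · h) (0ℤ ∷ f *ₚ h) (0ℤ ∷ g *ₚ h))

*ₚ-·ˡ : ∀ c f g → (c · f) *ₚ g ≋ c · (f *ₚ g)
*ₚ-·ˡ c []      g = ≋-refl
*ₚ-·ˡ c (a ∷ f) g =
  ≋-trans (+ₚ-cong (·-assoc c a g)
                   (≋-trans (∷-cong refl (*ₚ-·ˡ c f g)) (≋-sym (·-0∷ c (f *ₚ g)))))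
          (≋-sym (·-distribˡ-+ c (a · g) (0ℤ ∷ f *ₚ g)))

*ₚ-0∷ˡ : ∀ f g → (0ℤ ∷ f) *ₚ g ≋ 0ℤ ∷ f *ₚ g
*ₚ-0∷ˡ f g = +ₚ-cong (·-zero g) ≋-refl

*ₚ-assoc : ∀ f g h → (f *ₚ g) *ₚ h ≋ f *ₚ (g *ₚ h)
*ₚ-assoc []      g h = ≋-refl
*ₚ-assoc (a ∷ f) g h =
  ≋-trans (*ₚ-distribʳ-+ h (a · g) (0ℤ ∷ f *ₚ g))
          (+ₚ-cong (*ₚ-·ˡ a g h)
                   (≋-trans (*ₚ-0∷ˡ (f *ₚ g) h) (∷-cong refl (*ₚ-assoc f g h))))

*ₚ-zeroʳ : ∀ f → f *ₚ [] ≋ []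
*ₚ-zeroʳ []      = ≋-refl
*ₚ-zeroʳ (a ∷ f) = ≋-trans (∷-cong refl (*ₚ-zeroʳ f)) 0∷[]

*ₚ-∷ʳ : ∀ f b g → f *ₚ (b ∷ g) ≋ b · f +ₚ (0ℤ ∷ f *ₚ g)
*ₚ-∷ʳ []      b g = ≋-sym 0∷[]
*ₚ-∷ʳ (a ∷ f) b g =
  ∷-cong (cong (ℤ._+ 0ℤ) (ℤ.*-comm a b))
    (≋-trans (+ₚ-cong ≋-refl (*ₚ-∷ʳ f b g))
    (≋-trans (≋-sym (+ₚ-assoc (a · g) (b · f) (0ℤ ∷ f *ₚ g)))
    (≋-trans (+ₚ-cong (+ₚ-comm (a · g) (b · f)) ≋-refl)
             (+ₚ-assoc (b · f) (a · g) (0ℤ ∷ f *ₚ g)))))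

*ₚ-0∷ʳ : ∀ f g → f *ₚ (0ℤ ∷ g) ≋ 0ℤ ∷ f *ₚ g
*ₚ-0∷ʳ f g = ≋-trans (*ₚ-∷ʳ f 0ℤ g) (+ₚ-cong (·-zero f) ≋-refl)

*ₚ-comm : ∀ f g → f *ₚ g ≋ g *ₚ f
*ₚ-comm []      g = ≋-sym (*ₚ-zeroʳ g)
*ₚ-comm (a ∷ f) g =
  ≋-trans (+ₚ-cong ≋-refl (∷-cong refl (*ₚ-comm f g))) (≋-sym (*ₚ-∷ʳ g a f))

[_]*ₚ : ∀ c f → (c ∷ []) *ₚ f ≋ c · f
[ c ]*ₚ f = ≋-trans (+ₚ-cong ≋-refl 0∷[]) (+ₚ-identityʳ (c · f))

*ₚ-identityˡ : ∀ f → (1ℤ ∷ []) *ₚ f ≋ f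
*ₚ-identityˡ f = ≋-trans ([ 1ℤ ]*ₚ f) (·-identity f)

*ₚ-identityʳ : ∀ f → f *ₚ (1ℤ ∷ []) ≋ f
*ₚ-identityʳ f = ≋-trans (*ₚ-comm f (1ℤ ∷ [])) (*ₚ-identityˡ f)

*ₚ-distribˡ-+ : ∀ h f g → h *ₚ (f +ₚ g) ≋ h *ₚ f +ₚ h *ₚ g
*ₚ-distribˡ-+ h f g =
  ≋-trans (*ₚ-comm h (f +ₚ g))
    (≋-trans (*ₚ-distribʳ-+ h f g) (+ₚ-cong (*ₚ-comm f h) (*ₚ-comm g h)))

ℤ[z]-commutativeRing : CommutativeRing 0ℓ 0ℓ
ℤ[z]-commutativeRing = record
  { Carrier = ℤ[z]
  ; _≈_     = _≋_
  ; _+_     = _+ₚ_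
  ; _*_     = _*ₚ_
  ; -_      = -ₚ_
  ; 0#      = []
  ; 1#      = 1ℤ ∷ []
  ; isCommutativeRing = record
    { isRing = record
      { +-isAbelianGroup = record
        { isGroup = record
          { isMonoid = record
            { isSemigroup = record
              { isMagma = record
                { isEquivalence = record { refl = ≋-refl ; sym = ≋-sym ; trans = ≋-trans }
                ; ∙-cong = +ₚ-cong
                }
              ; assoc = +ₚ-assoc
              }
            ; identity = (λ f → ≋-refl) , +ₚ-identityʳ
            }
          ; inverse = -ₚ-inverseˡ , -ₚ-inverseʳ
          ; ⁻¹-cong = -ₚ-cong
          }
        ; comm = +ₚ-comm
        }
      ; *-cong = *ₚ-cong
      ; *-assoc = *ₚ-assoc
      ; *-identity = *ₚ-identityˡ , *ₚ-identityʳ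
      ; distrib = *ₚ-distribˡ-+ , *ₚ-distribʳ-+
      }
    ; *-comm = *ₚ-comm
    }
  }

module ≋-Reasoning where
  open import Relation.Binary.Reasoning.Setoid (CommutativeRing.setoid ℤ[z]-commutativeRing) public

isZero : ∀ f → Maybe ([] ≋ f)
isZero []         = just ≋-refl
isZero (+0 ∷ f)   = Maybe.map (λ e → ≋-trans (≋-sym 0∷[]) (∷-cong refl e)) (isZero f)
isZero (_  ∷ f)   = nothing

ℤ[z]-almostCommutativeRing : AlmostCommutativeRing 0ℓ 0ℓ
ℤ[z]-almostCommutativeRing = fromCommutativeRing ℤ[z]-commutativeRing isZero

infixr 8 _^ₚ_

_^ₚ_ : ℤ[z] → ℕ → ℤ[z]
_^ₚ_ = RawSemiringDefinitions._^_ (Semiring.rawSemiring (CommutativeRing.semiring ℤ[z]-commutativeRing))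

-- Substitution into polynomials

const : ℤ → ℤ[z]
const c = c ∷ []

const-* : ∀ c d → const c *ₚ const d ≋ const (c ℤ.* d)
const-* c d = [ c ]*ₚ (const d)

-- Horner's scheme. Two substitutions occur: n + d z for the size estimates and n + z for the Taylor
-- coefficients.
comp : ℤ[z] → ℤ[z] → ℤ[z]
comp []      q = []
comp (a ∷ f) q = const a +ₚ q *ₚ comp f q

comp-[] : ∀ q {f} → [] ≋ f → comp f q ≋ []
comp-[] q {[]}    e = ≋-refl
comp-[] q {a ∷ f} e =
  ≋-trans (+ₚ-cong (≋-trans (∷-cong (sym (at e 0)) ≋-refl) 0∷[])
                   (≋-trans (*ₚ-congˡ q (comp-[] q (≋[]-tail e)))
                            (*ₚ-zeroʳ q)))
          ≋-refl

comp-cong : ∀ q {f g} → f ≋ g → comp f q ≋ comp g q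
comp-cong q {[]}    {g}     e = ≋-sym (comp-[] q e)
comp-cong q {a ∷ f} {[]}    e = comp-[] q (≋-sym e)
comp-cong q {a ∷ f} {b ∷ g} e =
  +ₚ-cong (∷-cong (at e 0) ≋-refl)
          (*ₚ-congˡ q (comp-cong q (∷-injectiveʳ e)))

comp-+ : ∀ q f g → comp (f +ₚ g) q ≋ comp f q +ₚ comp g q
comp-+ q []      g       = ≋-refl
comp-+ q (a ∷ f) []      = ≋-sym (+ₚ-identityʳ (comp (a ∷ f) q))
comp-+ q (a ∷ f) (b ∷ g) =
  ≋-trans (+ₚ-congˡ (const a +ₚ const b)
                   (≋-trans (*ₚ-congˡ q (comp-+ q f g)) (*ₚ-distribˡ-+ q (comp f q) (comp g q))))
          (+ₚ-interchange (const a) (const b) (q *ₚ comp f q) (q *ₚ comp g q))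

*ₚ-·ʳ : ∀ c f g → f *ₚ (c · g) ≋ c · (f *ₚ g)
*ₚ-·ʳ c f g =
  ≋-trans (*ₚ-comm f (c · g)) (≋-trans (*ₚ-·ˡ c g f) (·-cong c (*ₚ-comm g f)))

comp-· : ∀ q c f → comp (c · f) q ≋ c · comp f q
comp-· q c []      = ≋-refl
comp-· q c (a ∷ f) =
  ≋-trans (+ₚ-congˡ (const (c ℤ.* a)) (≋-trans (*ₚ-congˡ q (comp-· q c f)) (*ₚ-·ʳ c q (comp f q))))
          (≋-sym (·-distribˡ-+ c (const a) (q *ₚ comp f q)))

comp-0∷ : ∀ q f → comp (0ℤ ∷ f) q ≋ q *ₚ comp f q
comp-0∷ q f = +ₚ-congʳ (q *ₚ comp f q) 0∷[]

-- Through this, a factorisation of f survives both substitutions.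
comp-* : ∀ q f g → comp (f *ₚ g) q ≋ comp f q *ₚ comp g q
comp-* q []      g = ≋-refl
comp-* q (a ∷ f) g = begin
  comp (a · g +ₚ (0ℤ ∷ f *ₚ g)) q
    ≈⟨ comp-+ q (a · g) (0ℤ ∷ f *ₚ g) ⟩
  comp (a · g) q +ₚ comp (0ℤ ∷ f *ₚ g) q
    ≈⟨ +ₚ-cong (comp-· q a g)
         (≋-trans (comp-0∷ q (f *ₚ g)) (*ₚ-congˡ q (comp-* q f g))) ⟩
  a · comp g q +ₚ q *ₚ (comp f q *ₚ comp g q)
    ≈⟨ +ₚ-cong ([ a ]*ₚ (comp g q)) (*ₚ-assoc q (comp f q) (comp g q)) ⟨
  const a *ₚ comp g q +ₚ (q *ₚ comp f q) *ₚ comp g q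
    ≈⟨ *ₚ-distribʳ-+ (comp g q) (const a) (q *ₚ comp f q) ⟨
  comp (a ∷ f) q *ₚ comp g q ∎
  where open ≋-Reasoning

-- The slope d is arbitrary, so the value at n is the constant term under either substitution.
coeff₀-comp : ∀ n d f → coeff (comp f (n ∷ d ∷ [])) 0 ≡ eval f n
coeff₀-comp n d []      = refl
coeff₀-comp n d (a ∷ f) = begin
  coeff (const a +ₚ q *ₚ comp f q) 0            ≡⟨ coeff-+ (const a) (q *ₚ comp f q) 0 ⟩
  a ℤ.+ coeff (q *ₚ comp f q) 0                 ≡⟨ cong (λ t → a ℤ.+ t) (coeff-* q (comp f q) 0) ⟩
  a ℤ.+ n ℤ.* coeff (comp f q) 0                ≡⟨ cong (λ t → a ℤ.+ n ℤ.* t) (coeff₀-comp n d f) ⟩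
  a ℤ.+ n ℤ.* eval f n                          ∎
  where
  open ≡-Reasoning
  q : ℤ[z]
  q = n ∷ d ∷ []

-- The ℓ¹ norm

⟦_⟧ : ℤ[z] → ℕ
⟦ [] ⟧    = 0
⟦ a ∷ f ⟧ = ∣ a ∣ + ⟦ f ⟧

norm-[] : ∀ {f} → [] ≋ f → ⟦ f ⟧ ≡ 0
norm-[] {[]}    e = refl
norm-[] {a ∷ f} e = cong₂ _+_ (cong ∣_∣ (sym (at e 0))) (norm-[] (≋[]-tail e))

norm-cong : ∀ {f g} → f ≋ g → ⟦ f ⟧ ≡ ⟦ g ⟧
norm-cong {[]}    {g}     e = sym (norm-[] e)
norm-cong {a ∷ f} {[]}    e = norm-[] (≋-sym e)
norm-cong {a ∷ f} {b ∷ g} e =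
  cong₂ _+_ (cong ∣_∣ (at e 0)) (norm-cong (∷-injectiveʳ e))

norm-+ : ∀ f g → ⟦ f +ₚ g ⟧ ≤ ⟦ f ⟧ + ⟦ g ⟧
norm-+ []      g       = ℕ.≤-refl
norm-+ (a ∷ f) []      = ℕ.m≤m+n ⟦ a ∷ f ⟧ 0
norm-+ (a ∷ f) (b ∷ g) = begin
  ∣ a ℤ.+ b ∣ + ⟦ f +ₚ g ⟧               ≤⟨ ℕ.+-mono-≤ (ℤ.∣i+j∣≤∣i∣+∣j∣ a b) (norm-+ f g) ⟩
  (∣ a ∣ + ∣ b ∣) + (⟦ f ⟧ + ⟦ g ⟧)      ≡⟨ interchange ∣ a ∣ ∣ b ∣ ⟦ f ⟧ ⟦ g ⟧ ⟩
  (∣ a ∣ + ⟦ f ⟧) + (∣ b ∣ + ⟦ g ⟧)      ∎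
  where
  open ℕ.≤-Reasoning
  interchange : ∀ a b c d → (a + b) + (c + d) ≡ (a + c) + (b + d)
  interchange = ℕ-Solver.solve-∀

norm-· : ∀ c f → ⟦ c · f ⟧ ≡ ∣ c ∣ * ⟦ f ⟧
norm-· c []      = sym (ℕ.*-zeroʳ ∣ c ∣)
norm-· c (a ∷ f) = trans (cong₂ _+_ (ℤ.abs-* c a) (norm-· c f)) (sym (ℕ.*-distribˡ-+ ∣ c ∣ ∣ a ∣ ⟦ f ⟧))

norm-neg : ∀ f → ⟦ -ₚ f ⟧ ≡ ⟦ f ⟧
norm-neg []      = refl
norm-neg (a ∷ f) = cong₂ _+_ (ℤ.∣-i∣≡∣i∣ a) (norm-neg f)

norm-* : ∀ f g → ⟦ f *ₚ g ⟧ ≤ ⟦ f ⟧ * ⟦ g ⟧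
norm-* []      g = ℕ.≤-refl
norm-* (a ∷ f) g = begin
  ⟦ a · g +ₚ (0ℤ ∷ f *ₚ g) ⟧          ≤⟨ norm-+ (a · g) (0ℤ ∷ f *ₚ g) ⟩
  ⟦ a · g ⟧ + ⟦ f *ₚ g ⟧              ≤⟨ ℕ.+-mono-≤ (ℕ.≤-reflexive (norm-· a g)) (norm-* f g) ⟩
  ∣ a ∣ * ⟦ g ⟧ + ⟦ f ⟧ * ⟦ g ⟧       ≡⟨ ℕ.*-distribʳ-+ ⟦ g ⟧ ∣ a ∣ ⟦ f ⟧ ⟨
  (∣ a ∣ + ⟦ f ⟧) * ⟦ g ⟧             ∎
  where open ℕ.≤-Reasoning

norm-^ : ∀ f s → ⟦ f ^ₚ s ⟧ ≤ ⟦ f ⟧ ^ s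
norm-^ f zero    = ℕ.≤-refl
norm-^ f (suc s) = ℕ.≤-trans (norm-* f (f ^ₚ s)) (ℕ.*-monoʳ-≤ ⟦ f ⟧ (norm-^ f s))

∣coeff∣≤norm : ∀ f i → ∣ coeff f i ∣ ≤ ⟦ f ⟧
∣coeff∣≤norm []      i       = ℕ.≤-refl
∣coeff∣≤norm (a ∷ f) zero    = ℕ.m≤m+n ∣ a ∣ ⟦ f ⟧
∣coeff∣≤norm (a ∷ f) (suc i) = ℕ.m≤n⇒m≤o+n ∣ a ∣ (∣coeff∣≤norm f i)

-- Polynomials invertible on the closed unit disc

-- F is a unit of the Banach algebra of absolutely convergent power series on the
-- closed unit disc exactly when some multiple of it is this close to a constant.
record UnitOnDisc (F : ℤ[z]) : Set where
  field
    cofactor error : ℤ[z]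
    constant       : ℤ
    multiple : F *ₚ cofactor ≋ const constant +ₚ -ₚ error
    small    : ⟦ error ⟧ < ∣ constant ∣

-- A divisor of a unit is a unit: the complementary factor moves into the cofactor.
factor-unitOnDisc : ∀ {F G H} → F ≋ G *ₚ H → UnitOnDisc F → UnitOnDisc G
factor-unitOnDisc {F} {G} {H} F≋GH u = record
  { cofactor = H *ₚ cofactor
  ; error    = error
  ; constant = constant
  ; multiple = ≋-trans (≋-sym (*ₚ-assoc G H cofactor)) (≋-trans (*ₚ-congʳ cofactor (≋-sym F≋GH)) multiple)
  ; small    = small
  }
  where open UnitOnDisc u

-- Bernoulli's inequality 1 + s/x ≤ (1 + 1/x)^s, with denominators cleared.
bernoulli : ∀ x s → x ^ s * (x + s) ≤ x * suc x ^ s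
bernoulli x zero    = ℕ.≤-reflexive (base x)
  where
  base : ∀ x → 1 * (x + 0) ≡ x * 1
  base = ℕ-Solver.solve-∀
bernoulli x (suc s) = begin
  x ^ suc s * (x + suc s)                  ≡⟨ step x s (x ^ s) ⟩
  x * (x ^ s * (x + s)) + x * x ^ s        ≤⟨ ℕ.+-mono-≤ (ℕ.*-monoʳ-≤ x (bernoulli x s))
                                                (ℕ.*-monoʳ-≤ x (ℕ.^-monoˡ-≤ s (ℕ.n≤1+n x))) ⟩
  x * (x * suc x ^ s) + x * suc x ^ s      ≡⟨ collect x (suc x ^ s) ⟩
  x * suc x ^ suc s                        ∎
  where
  open ℕ.≤-Reasoning
  step : ∀ x s y → x * y * (x + suc s) ≡ x * (y * (x + s)) + x * y
  step = ℕ-Solver.solve-∀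
  collect : ∀ x y → x * (x * y) + x * y ≡ x * (suc x * y)
  collect = ℕ-Solver.solve-∀

geometric-gap : ∀ C {x y} → x < y → ∃ λ s → C * x ^ s < y ^ s
geometric-gap C {zero}  {y} 0<y = 1 , subst (_< y ^ 1) (sym (ℕ.*-zeroʳ C)) (ℕ.m^n>0 y {{ℕ.>-nonZero 0<y}} 1)
geometric-gap C {x@(suc _)} {y} x<y = s , (begin-strict
  C * x ^ s            <⟨ ℕ.m<n+m (C * x ^ s) (ℕ.m^n>0 x s) ⟩
  suc C * x ^ s        ≤⟨ ℕ.*-cancelˡ-≤ x (ℕ.≤-trans (ℕ.≤-reflexive (regroup x C (x ^ s))) (bernoulli x s)) ⟩
  suc x ^ s            ≤⟨ ℕ.^-monoˡ-≤ s x<y ⟩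
  y ^ s                ∎)
  where
  open ℕ.≤-Reasoning
  s : ℕ
  -- For this exponent Bernoulli's factor 1 + s/x is exactly C + 1.
  s = C * x
  regroup : ∀ x C y → x * (suc C * y) ≡ y * (x + C * x)
  regroup = ℕ-Solver.solve-∀

-- From F P = c − E, the telescoping identity makes c^s − E^s a multiple of F.
unitOnDisc-power : ∀ {F} (u : UnitOnDisc F) → let open UnitOnDisc u in ∀ s →
  ∃ λ P → ∃ λ c → ∃ λ E → F *ₚ P ≋ const c +ₚ -ₚ E × ∣ c ∣ ≡ ∣ constant ∣ ^ s × ⟦ E ⟧ ≤ ⟦ error ⟧ ^ s
unitOnDisc-power {F} u zero    =
  [] , 1ℤ , const 1ℤ , ≋-trans (*ₚ-zeroʳ F) (≋-sym (-ₚ-inverseʳ (const 1ℤ))) , refl , ℕ.≤-refl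
unitOnDisc-power {F} u (suc s) with unitOnDisc-power u s
... | P , c , E , F*P , ∣c∣ , E≤ =
  const constant *ₚ P +ₚ E *ₚ cofactor , constant ℤ.* c , error *ₚ E ,
  (begin
    F *ₚ (const constant *ₚ P +ₚ E *ₚ cofactor)
      ≈⟨ expand F (const constant) P E cofactor ⟩
    const constant *ₚ (F *ₚ P) +ₚ E *ₚ (F *ₚ cofactor)
      ≈⟨ +ₚ-cong (*ₚ-congˡ (const constant) F*P) (*ₚ-congˡ E multiple) ⟩
    const constant *ₚ (const c +ₚ -ₚ E) +ₚ E *ₚ (const constant +ₚ -ₚ error)
      ≈⟨ telescope (const constant) (const c) E error ⟩
    const constant *ₚ const c +ₚ -ₚ (error *ₚ E)
      ≈⟨ +ₚ-congʳ (-ₚ (error *ₚ E)) (const-* constant c) ⟩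
    const (constant ℤ.* c) +ₚ -ₚ (error *ₚ E) ∎) ,
  trans (ℤ.abs-* constant c) (cong (∣ constant ∣ *_) ∣c∣) ,
  ℕ.≤-trans (norm-* error E) (ℕ.*-monoʳ-≤ ⟦ error ⟧ E≤)
  where
  open UnitOnDisc u
  open ≋-Reasoning
  expand : ∀ F A P E Q → F *ₚ (A *ₚ P +ₚ E *ₚ Q) ≋ A *ₚ (F *ₚ P) +ₚ E *ₚ (F *ₚ Q)
  expand = solve-∀ ℤ[z]-almostCommutativeRing
  telescope : ∀ A C E R → A *ₚ (C +ₚ -ₚ E) +ₚ E *ₚ (A +ₚ -ₚ R) ≋ A *ₚ C +ₚ -ₚ (R *ₚ E)
  telescope = solve-∀ ℤ[z]-almostCommutativeRing

-- The s-th powers of error and constant have a ratio that decays geometrically, so it drops below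
-- any prescribed 1/C.
almost-constant-multiple : ∀ {F} → UnitOnDisc F → ∀ C →
  ∃ λ P → ∃ λ c → ∃ λ E → F *ₚ P ≋ const c +ₚ -ₚ E × C * ⟦ E ⟧ < ∣ c ∣
almost-constant-multiple u C =
  let s , Cx<y = geometric-gap C (UnitOnDisc.small u)
      P , c , E , F*P , ∣c∣ , E≤ = unitOnDisc-power u s
  in P , c , E , F*P ,
     ℕ.≤-<-trans (ℕ.*-monoʳ-≤ C E≤) (subst (C * ⟦ UnitOnDisc.error u ⟧ ^ s <_) (sym ∣c∣) Cx<y)

-- The ℓ² norm and the reversed polynomial

inner : ℤ[z] → ℤ[z] → ℤ
inner []      g       = 0ℤ
inner (a ∷ f) []      = 0ℤ
inner (a ∷ f) (b ∷ g) = a ℤ.* b ℤ.+ inner f g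

inner-comm : ∀ f g → inner f g ≡ inner g f
inner-comm []      []      = refl
inner-comm []      (b ∷ g) = refl
inner-comm (a ∷ f) []      = refl
inner-comm (a ∷ f) (b ∷ g) = cong₂ ℤ._+_ (ℤ.*-comm a b) (inner-comm f g)

inner-[] : ∀ {f} h → [] ≋ f → inner f h ≡ 0ℤ
inner-[] {[]}    h       e = refl
inner-[] {a ∷ f} []      e = refl
inner-[] {a ∷ f} (b ∷ h) e rewrite sym (at e 0) | inner-[] h (≋[]-tail e) = refl

inner-congˡ : ∀ {f g} h → f ≋ g → inner f h ≡ inner g h
inner-congˡ {[]}    {g}     h       e = sym (inner-[] h e)
inner-congˡ {a ∷ f} {[]}    h       e = inner-[] h (≋-sym e)
inner-congˡ {a ∷ f} {b ∷ g} []      e = refl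
inner-congˡ {a ∷ f} {b ∷ g} (c ∷ h) e =
  cong₂ ℤ._+_ (cong (ℤ._* c) (at e 0)) (inner-congˡ h (∷-injectiveʳ e))

inner-congʳ : ∀ h {f g} → f ≋ g → inner h f ≡ inner h g
inner-congʳ h {f} {g} e = trans (inner-comm h f) (trans (inner-congˡ h e) (inner-comm g h))

inner-+ˡ : ∀ f g h → inner (f +ₚ g) h ≡ inner f h ℤ.+ inner g h
inner-+ˡ []      g       h       = sym (ℤ.+-identityˡ (inner g h))
inner-+ˡ (a ∷ f) []      h       = sym (ℤ.+-identityʳ (inner (a ∷ f) h))
inner-+ˡ (a ∷ f) (b ∷ g) []      = refl
inner-+ˡ (a ∷ f) (b ∷ g) (c ∷ h) rewrite inner-+ˡ f g h = collect a b c (inner f h) (inner g h)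
  where
  collect : ∀ a b c s t → (a ℤ.+ b) ℤ.* c ℤ.+ (s ℤ.+ t) ≡ (a ℤ.* c ℤ.+ s) ℤ.+ (b ℤ.* c ℤ.+ t)
  collect = ℤ-Solver.solve-∀

inner-+ʳ : ∀ h f g → inner h (f +ₚ g) ≡ inner h f ℤ.+ inner h g
inner-+ʳ h f g =
  trans (inner-comm h (f +ₚ g)) (trans (inner-+ˡ f g h) (cong₂ ℤ._+_ (inner-comm f h) (inner-comm g h)))

inner-·ˡ : ∀ c f h → inner (c · f) h ≡ c ℤ.* inner f h
inner-·ˡ c []      h       = sym (ℤ.*-zeroʳ c)
inner-·ˡ c (a ∷ f) []      = sym (ℤ.*-zeroʳ c)
inner-·ˡ c (a ∷ f) (b ∷ h) rewrite inner-·ˡ c f h = collect a b c (inner f h)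
  where
  collect : ∀ a b c s → (c ℤ.* a) ℤ.* b ℤ.+ c ℤ.* s ≡ c ℤ.* (a ℤ.* b ℤ.+ s)
  collect = ℤ-Solver.solve-∀

inner-· : ∀ c f h → inner (c · f) h ≡ inner f (c · h)
inner-· c f h = begin
  inner (c · f) h      ≡⟨ inner-·ˡ c f h ⟩
  c ℤ.* inner f h      ≡⟨ cong (c ℤ.*_) (inner-comm f h) ⟩
  c ℤ.* inner h f      ≡⟨ inner-·ˡ c h f ⟨
  inner (c · h) f      ≡⟨ inner-comm (c · h) f ⟩
  inner f (c · h)      ∎
  where open ≡-Reasoning

shiftBy : ℕ → ℤ[z] → ℤ[z]
shiftBy zero    f = f
shiftBy (suc k) f = 0ℤ ∷ shiftBy k f

shiftBy-0∷ : ∀ k f → shiftBy k (0ℤ ∷ f) ≡ 0ℤ ∷ shiftBy k f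
shiftBy-0∷ zero    f = refl
shiftBy-0∷ (suc k) f = cong (0ℤ ∷_) (shiftBy-0∷ k f)

shiftBy-cong : ∀ k {f g} → f ≋ g → shiftBy k f ≋ shiftBy k g
shiftBy-cong zero    e = e
shiftBy-cong (suc k) e = ∷-cong refl (shiftBy-cong k e)

shiftBy-* : ∀ k f g → shiftBy k f *ₚ g ≋ shiftBy k (f *ₚ g)
shiftBy-* zero    f g = ≋-refl
shiftBy-* (suc k) f g = ≋-trans (*ₚ-0∷ˡ (shiftBy k f) g) (∷-cong refl (shiftBy-* k f g))

coeff-shiftBy : ∀ k c → coeff (shiftBy k (const c)) k ≡ c
coeff-shiftBy zero    c = refl
coeff-shiftBy (suc k) c = coeff-shiftBy k c

coeff-shiftBy-> : ∀ k c {i} → k < i → coeff (shiftBy k (const c)) i ≡ 0ℤ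
coeff-shiftBy-> zero    c (ℕ.s≤s k<i) = refl
coeff-shiftBy-> (suc k) c (ℕ.s≤s k<i) = coeff-shiftBy-> k c k<i

norm-shiftBy : ∀ k c → ⟦ shiftBy k (const c) ⟧ ≡ ∣ c ∣
norm-shiftBy zero    c = ℕ.+-identityʳ ∣ c ∣
norm-shiftBy (suc k) c = norm-shiftBy k c

inner-shiftBy : ∀ k f g → inner (shiftBy k f) (shiftBy k g) ≡ inner f g
inner-shiftBy zero    f g = refl
inner-shiftBy (suc k) f g = trans (ℤ.+-identityˡ (inner (shiftBy k f) (shiftBy k g))) (inner-shiftBy k f g)

-- z^(length g - 1) g(1/z). Trailing zeros count, so `rev` does not respect `_≋_`; lists of a
-- definite length are needed before it is applied.
rev : ℤ[z] → ℤ[z]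
rev []      = []
rev (a ∷ g) = rev g +ₚ shiftBy (length g) (const a)

rev-∷-* : ∀ a g Q → rev (a ∷ g) *ₚ Q ≋ rev g *ₚ Q +ₚ shiftBy (length g) (a · Q)
rev-∷-* a g Q = ≋-trans (*ₚ-distribʳ-+ Q (rev g) (shiftBy (length g) (const a)))
  (+ₚ-congˡ (rev g *ₚ Q)
    (≋-trans (shiftBy-* (length g) (const a) Q) (shiftBy-cong (length g) ([ a ]*ₚ Q))))

-- On the unit circle g(1/z) = conj g(z), so multiplication by g and by its reversal are adjoint up to a shift.
rev-adjoint : ∀ g Q R → inner Q (0ℤ ∷ g *ₚ R) ≡ inner (rev g *ₚ Q) (shiftBy (length g) R)
rev-adjoint []      Q R = trans (inner-comm Q (0ℤ ∷ [])) (inner-[] Q (≋-sym 0∷[]))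
rev-adjoint (b ∷ g) Q R = begin
  inner Q (0ℤ ∷ (b · R +ₚ (0ℤ ∷ g *ₚ R)))
    ≡⟨ inner-congʳ Q (0∷-+ (b · R) (0ℤ ∷ g *ₚ R)) ⟩
  inner Q ((0ℤ ∷ b · R) +ₚ (0ℤ ∷ 0ℤ ∷ g *ₚ R))
    ≡⟨ inner-+ʳ Q (0ℤ ∷ b · R) (0ℤ ∷ 0ℤ ∷ g *ₚ R) ⟩
  inner Q (0ℤ ∷ b · R) ℤ.+ inner Q (0ℤ ∷ 0ℤ ∷ g *ₚ R)
    ≡⟨ cong₂ ℤ._+_ first second ⟩
  inner (shiftBy k (b · Q)) (shiftBy (suc k) R) ℤ.+ inner (rev g *ₚ Q) (shiftBy (suc k) R)
    ≡⟨ ℤ.+-comm (inner (shiftBy k (b · Q)) (shiftBy (suc k) R)) (inner (rev g *ₚ Q) (shiftBy (suc k) R)) ⟩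
  inner (rev g *ₚ Q) (shiftBy (suc k) R) ℤ.+ inner (shiftBy k (b · Q)) (shiftBy (suc k) R)
    ≡⟨ inner-+ˡ (rev g *ₚ Q) (shiftBy k (b · Q)) (shiftBy (suc k) R) ⟨
  inner (rev g *ₚ Q +ₚ shiftBy k (b · Q)) (shiftBy (suc k) R)
    ≡⟨ inner-congˡ (shiftBy (suc k) R) (rev-∷-* b g Q) ⟨
  inner (rev (b ∷ g) *ₚ Q) (shiftBy (suc k) R) ∎
  where
  open ≡-Reasoning
  k : ℕ
  k = length g
  first : inner Q (0ℤ ∷ b · R) ≡ inner (shiftBy k (b · Q)) (shiftBy (suc k) R)
  first = begin
    inner Q (0ℤ ∷ b · R)                                ≡⟨ inner-congʳ Q (·-0∷ b R) ⟨
    inner Q (b · (0ℤ ∷ R))                              ≡⟨ inner-· b Q (0ℤ ∷ R) ⟨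
    inner (b · Q) (0ℤ ∷ R)                              ≡⟨ inner-shiftBy k (b · Q) (0ℤ ∷ R) ⟨
    inner (shiftBy k (b · Q)) (shiftBy k (0ℤ ∷ R))      ≡⟨ cong (inner (shiftBy k (b · Q))) (shiftBy-0∷ k R) ⟩
    inner (shiftBy k (b · Q)) (shiftBy (suc k) R)       ∎
  second : inner Q (0ℤ ∷ 0ℤ ∷ g *ₚ R) ≡ inner (rev g *ₚ Q) (shiftBy (suc k) R)
  second = begin
    inner Q (0ℤ ∷ 0ℤ ∷ g *ₚ R)                      ≡⟨ inner-congʳ Q (∷-cong refl (*ₚ-0∷ʳ g R)) ⟨
    inner Q (0ℤ ∷ g *ₚ (0ℤ ∷ R))                    ≡⟨ rev-adjoint g Q (0ℤ ∷ R) ⟩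
    inner (rev g *ₚ Q) (shiftBy k (0ℤ ∷ R))         ≡⟨ cong (inner (rev g *ₚ Q)) (shiftBy-0∷ k R) ⟩
    inner (rev g *ₚ Q) (shiftBy (suc k) R)          ∎

inner-square : ∀ f g → inner (f +ₚ g) (f +ₚ g) ≡ inner f f ℤ.+ (inner f g ℤ.+ inner f g) ℤ.+ inner g g
inner-square f g
  rewrite inner-+ˡ f g (f +ₚ g) | inner-+ʳ f f g | inner-+ʳ g f g | inner-comm g f
  = collect (inner f f) (inner f g) (inner g g)
  where
  collect : ∀ a b c → (a ℤ.+ b) ℤ.+ (b ℤ.+ c) ≡ a ℤ.+ (b ℤ.+ b) ℤ.+ c
  collect = ℤ-Solver.solve-∀

-- With G = a + z g, the reversal is rev g + a z^k. Expanding both squares, shifts preserve the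
-- inner product, the squares of g Q and rev g Q agree by induction, and the cross terms agree by
-- `rev-adjoint`.
rev-isometry : ∀ G Q → inner (G *ₚ Q) (G *ₚ Q) ≡ inner (rev G *ₚ Q) (rev G *ₚ Q)
rev-isometry []      Q = refl
rev-isometry (a ∷ g) Q = begin
  inner (a · Q +ₚ (0ℤ ∷ g *ₚ Q)) (a · Q +ₚ (0ℤ ∷ g *ₚ Q))
    ≡⟨ inner-square (a · Q) (0ℤ ∷ g *ₚ Q) ⟩
  inner (a · Q) (a · Q) ℤ.+ (cross ℤ.+ cross) ℤ.+ inner (0ℤ ∷ g *ₚ Q) (0ℤ ∷ g *ₚ Q)
    ≡⟨ cong₂ (λ s t → s ℤ.+ (cross ℤ.+ cross) ℤ.+ t) (sym (inner-shiftBy k (a · Q) (a · Q)))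
         (trans (ℤ.+-identityˡ (inner (g *ₚ Q) (g *ₚ Q))) (rev-isometry g Q)) ⟩
  inner S S ℤ.+ (cross ℤ.+ cross) ℤ.+ inner T T
    ≡⟨ cong (λ s → inner S S ℤ.+ (s ℤ.+ s) ℤ.+ inner T T) cross≡ ⟩
  inner S S ℤ.+ (inner T S ℤ.+ inner T S) ℤ.+ inner T T
    ≡⟨ swap (inner S S) (inner T S) (inner T T) ⟩
  inner T T ℤ.+ (inner T S ℤ.+ inner T S) ℤ.+ inner S S
    ≡⟨ inner-square T S ⟨
  inner (T +ₚ S) (T +ₚ S)
    ≡⟨ inner-congˡ (T +ₚ S) (rev-∷-* a g Q) ⟨
  inner (rev (a ∷ g) *ₚ Q) (T +ₚ S)
    ≡⟨ inner-congʳ (rev (a ∷ g) *ₚ Q) (rev-∷-* a g Q) ⟨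
  inner (rev (a ∷ g) *ₚ Q) (rev (a ∷ g) *ₚ Q) ∎
  where
  open ≡-Reasoning
  k : ℕ
  k = length g
  S T : ℤ[z]
  S = shiftBy k (a · Q)
  T = rev g *ₚ Q
  cross : ℤ
  cross = inner (a · Q) (0ℤ ∷ g *ₚ Q)
  cross≡ : cross ≡ inner T S
  cross≡ = begin
    inner (a · Q) (0ℤ ∷ g *ₚ Q)      ≡⟨ inner-· a Q (0ℤ ∷ g *ₚ Q) ⟩
    inner Q (a · (0ℤ ∷ g *ₚ Q))      ≡⟨ inner-congʳ Q (·-0∷ a (g *ₚ Q)) ⟩
    inner Q (0ℤ ∷ a · (g *ₚ Q))      ≡⟨ inner-congʳ Q (∷-cong refl (*ₚ-·ʳ a g Q)) ⟨
    inner Q (0ℤ ∷ g *ₚ (a · Q))      ≡⟨ rev-adjoint g Q (a · Q) ⟩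
    inner T S                        ∎
  swap : ∀ a b c → a ℤ.+ (b ℤ.+ b) ℤ.+ c ≡ c ℤ.+ (b ℤ.+ b) ℤ.+ a
  swap = ℤ-Solver.solve-∀

-- The leading coefficient against the constant term

energy : ℤ[z] → ℕ
energy []      = 0
energy (a ∷ f) = ∣ a ∣ * ∣ a ∣ + energy f

square-abs : ∀ a → a ℤ.* a ≡ + (∣ a ∣ * ∣ a ∣)
square-abs (+ n)      = sym (ℤ.pos-* n n)
square-abs ℤ.-[1+ n ] = refl

inner≡energy : ∀ f → inner f f ≡ + energy f
inner≡energy []      = refl
inner≡energy (a ∷ f) = trans (cong₂ ℤ._+_ (square-abs a) (inner≡energy f)) (sym (ℤ.pos-+ (∣ a ∣ * ∣ a ∣) (energy f)))

coeff₀²≤energy : ∀ f → ∣ coeff f 0 ∣ * ∣ coeff f 0 ∣ ≤ energy f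
coeff₀²≤energy []      = ℕ.≤-refl
coeff₀²≤energy (a ∷ f) = ℕ.m≤m+n (∣ a ∣ * ∣ a ∣) (energy f)

energy≤norm² : ∀ f → energy f ≤ ⟦ f ⟧ * ⟦ f ⟧
energy≤norm² []      = ℕ.≤-refl
energy≤norm² (a ∷ f) = begin
  ∣ a ∣ * ∣ a ∣ + energy f                                  ≤⟨ ℕ.+-monoʳ-≤ (∣ a ∣ * ∣ a ∣) (energy≤norm² f) ⟩
  ∣ a ∣ * ∣ a ∣ + ⟦ f ⟧ * ⟦ f ⟧                             ≤⟨ ℕ.m≤m+n _ (2 * (∣ a ∣ * ⟦ f ⟧)) ⟩
  ∣ a ∣ * ∣ a ∣ + ⟦ f ⟧ * ⟦ f ⟧ + 2 * (∣ a ∣ * ⟦ f ⟧)       ≡⟨ square ∣ a ∣ ⟦ f ⟧ ⟩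
  (∣ a ∣ + ⟦ f ⟧) * (∣ a ∣ + ⟦ f ⟧)                         ∎
  where
  open ℕ.≤-Reasoning
  square : ∀ a b → a * a + b * b + 2 * (a * b) ≡ (a + b) * (a + b)
  square = ℕ-Solver.solve-∀

square-cancel-≤ : ∀ {m n} → m * m ≤ n * n → m ≤ n
square-cancel-≤ m²≤n² = ℕ.≮⇒≥ (λ n<m → ℕ.<⇒≱ (ℕ.*-mono-< n<m n<m) m²≤n²)

-- A list of exactly r + 1 entries, so that `rev` brings coefficient r to position 0.
upTo : ℕ → ℤ[z] → ℤ[z]
upTo zero    f = const (coeff f 0)
upTo (suc r) f = coeff f 0 ∷ upTo r (drop 1 f)

DegreeAtMost : ℕ → ℤ[z] → Set
DegreeAtMost r f = ∀ {i} → r < i → coeff f i ≡ 0ℤ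

coeff-drop : ∀ f i → coeff (drop 1 f) i ≡ coeff f (suc i)
coeff-drop []      i = refl
coeff-drop (a ∷ f) i = refl

upTo-≋ : ∀ r f → DegreeAtMost r f → f ≋ upTo r f
upTo-≋ zero    f deg .at zero    = refl
upTo-≋ zero    f deg .at (suc i) = deg (ℕ.s≤s ℕ.z≤n)
upTo-≋ (suc r) f deg .at zero    = refl
upTo-≋ (suc r) f deg .at (suc i) = trans (sym (coeff-drop f i))
  (at (upTo-≋ r (drop 1 f) (λ {j} r<j → trans (coeff-drop f j) (deg (ℕ.s≤s r<j)))) i)

coeff₀-rev-upTo : ∀ r f → coeff (rev (upTo r f)) 0 ≡ coeff f r
coeff₀-rev-upTo zero    f = refl
coeff₀-rev-upTo (suc r) f = begin
  coeff (rev (upTo r (drop 1 f)) +ₚ shiftBy (length (upTo r (drop 1 f))) (const (coeff f 0))) 0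
    ≡⟨ coeff-+ (rev (upTo r (drop 1 f))) (shiftBy (length (upTo r (drop 1 f))) (const (coeff f 0))) 0 ⟩
  coeff (rev (upTo r (drop 1 f))) 0 ℤ.+ coeff (shiftBy (length (upTo r (drop 1 f))) (const (coeff f 0))) 0
    ≡⟨ cong₂ ℤ._+_ (coeff₀-rev-upTo r (drop 1 f)) (vanish r) ⟩
  coeff (drop 1 f) r ℤ.+ 0ℤ
    ≡⟨ ℤ.+-identityʳ (coeff (drop 1 f) r) ⟩
  coeff (drop 1 f) r
    ≡⟨ coeff-drop f r ⟩
  coeff f (suc r) ∎
  where
  open ≡-Reasoning
  vanish : ∀ r → coeff (shiftBy (length (upTo r (drop 1 f))) (const (coeff f 0))) 0 ≡ 0ℤ
  vanish zero    = refl
  vanish (suc r) = refl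

-- The left side is the constant term of the reversed G times Q. It is at most the ℓ² norm of that
-- product, which equals the ℓ² norm of G Q, and the ℓ² norm is at most the ℓ¹ norm.
reversed-product-bound : ∀ r G Q → DegreeAtMost r G → ∣ coeff G r ∣ * ∣ coeff Q 0 ∣ ≤ ⟦ G *ₚ Q ⟧
reversed-product-bound r G Q deg = square-cancel-≤ (begin
  (∣ coeff G r ∣ * ∣ coeff Q 0 ∣) * (∣ coeff G r ∣ * ∣ coeff Q 0 ∣)
    ≡⟨ cong (λ t → t * t) lead ⟨
  ∣ coeff (rev G′ *ₚ Q) 0 ∣ * ∣ coeff (rev G′ *ₚ Q) 0 ∣
    ≤⟨ coeff₀²≤energy (rev G′ *ₚ Q) ⟩
  energy (rev G′ *ₚ Q)
    ≡⟨ ℤ.+-injective (trans (sym (inner≡energy (rev G′ *ₚ Q)))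
         (trans (sym (rev-isometry G′ Q)) (inner≡energy (G′ *ₚ Q)))) ⟩
  energy (G′ *ₚ Q)
    ≤⟨ energy≤norm² (G′ *ₚ Q) ⟩
  ⟦ G′ *ₚ Q ⟧ * ⟦ G′ *ₚ Q ⟧
    ≡⟨ cong (λ t → t * t) (norm-cong (*ₚ-congʳ Q (upTo-≋ r G deg))) ⟨
  ⟦ G *ₚ Q ⟧ * ⟦ G *ₚ Q ⟧ ∎)
  where
  open ℕ.≤-Reasoning
  G′ : ℤ[z]
  G′ = upTo r G
  lead : ∣ coeff (rev G′ *ₚ Q) 0 ∣ ≡ ∣ coeff G r ∣ * ∣ coeff Q 0 ∣
  lead = trans (cong ∣_∣ (coeff-* (rev G′) Q 0))
    (trans (cong (λ t → ∣ t ℤ.* coeff Q 0 ∣) (coeff₀-rev-upTo r G)) (ℤ.abs-* (coeff G r) (coeff Q 0)))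

-- For G Q = c - E, the constant term gives |c| ≤ g₀ q₀ + e and the reversal gives gᵣ q₀ ≤ |c| + e.
-- Eliminating q₀ leaves gᵣ |c| ≤ g₀ |c| + (g₀ + gᵣ) e.
leading≤constant : ∀ {G} r → UnitOnDisc G → DegreeAtMost r G → ∣ coeff G r ∣ ≤ ∣ coeff G 0 ∣
leading≤constant {G} r u deg
  -- The sum is the factor with which e enters, so the error stays below |c|. This gives gᵣ < g₀ +
  -- 1, and integrality does the rest.
  with almost-constant-multiple u (∣ coeff G 0 ∣ + ∣ coeff G r ∣)
... | Q , c , E , GQ , C*E<c = ℕ.s≤s⁻¹ (ℕ.*-cancelʳ-< ∣ c ∣ gᵣ (suc g₀) (begin-strict
    gᵣ * ∣ c ∣                                       ≤⟨ ℕ.*-monoʳ-≤ gᵣ c≤ ⟩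
    gᵣ * (g₀ * q₀ + e)                               ≡⟨ regroup gᵣ g₀ q₀ e ⟩
    g₀ * (gᵣ * q₀) + gᵣ * e                          ≤⟨ ℕ.+-monoˡ-≤ (gᵣ * e) (ℕ.*-monoʳ-≤ g₀ gᵣq₀≤) ⟩
    g₀ * (∣ c ∣ + e) + gᵣ * e                        ≡⟨ collect gᵣ g₀ ∣ c ∣ e ⟩
    g₀ * ∣ c ∣ + (g₀ + gᵣ) * e                       <⟨ ℕ.+-monoʳ-< (g₀ * ∣ c ∣) C*E<c ⟩
    g₀ * ∣ c ∣ + ∣ c ∣                               ≡⟨ ℕ.+-comm (g₀ * ∣ c ∣) ∣ c ∣ ⟩
    suc g₀ * ∣ c ∣                                   ∎))
  where
  open ℕ.≤-Reasoning
  gᵣ g₀ q₀ e : ℕ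
  gᵣ = ∣ coeff G r ∣
  g₀ = ∣ coeff G 0 ∣
  q₀ = ∣ coeff Q 0 ∣
  e  = ⟦ E ⟧
  gᵣq₀≤ : gᵣ * q₀ ≤ ∣ c ∣ + e
  gᵣq₀≤ = begin
    gᵣ * q₀                        ≤⟨ reversed-product-bound r G Q deg ⟩
    ⟦ G *ₚ Q ⟧                     ≡⟨ norm-cong GQ ⟩
    ⟦ const c +ₚ -ₚ E ⟧            ≤⟨ norm-+ (const c) (-ₚ E) ⟩
    ⟦ const c ⟧ + ⟦ -ₚ E ⟧         ≡⟨ cong₂ _+_ (ℕ.+-identityʳ ∣ c ∣) (norm-neg E) ⟩
    ∣ c ∣ + e                      ∎
  c≡ : c ≡ coeff G 0 ℤ.* coeff Q 0 ℤ.+ coeff E 0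
  c≡ = trans (cancel c (coeff E 0)) (cong (ℤ._+ coeff E 0) (trans (sym
    (trans (coeff-+ (const c) (-ₚ E) 0) (cong (λ t → c ℤ.+ t) (coeff-neg E 0))))
    (trans (sym (at GQ 0)) (coeff-* G Q 0))))
    where
    cancel : ∀ c e → c ≡ (c ℤ.+ - e) ℤ.+ e
    cancel = ℤ-Solver.solve-∀
  c≤ : ∣ c ∣ ≤ g₀ * q₀ + e
  c≤ = begin
    ∣ c ∣                                              ≡⟨ cong ∣_∣ c≡ ⟩
    ∣ coeff G 0 ℤ.* coeff Q 0 ℤ.+ coeff E 0 ∣          ≤⟨ ℤ.∣i+j∣≤∣i∣+∣j∣ (coeff G 0 ℤ.* coeff Q 0) (coeff E 0) ⟩
    ∣ coeff G 0 ℤ.* coeff Q 0 ∣ + ∣ coeff E 0 ∣        ≤⟨ ℕ.+-mono-≤ (ℕ.≤-reflexive (ℤ.abs-* (coeff G 0) (coeff Q 0))) (∣coeff∣≤norm E 0) ⟩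
    g₀ * q₀ + e                                        ∎
  regroup : ∀ a b q e → a * (b * q + e) ≡ b * (a * q) + a * e
  regroup = ℕ-Solver.solve-∀
  collect : ∀ a b c e → b * (c + e) + a * e ≡ b * c + (b + a) * e
  collect = ℕ-Solver.solve-∀

-- σ is the sign of x, taken as 1 at x = 0, so that the perturbation enlarges the leading
-- coefficient and never shrinks it.
outward-unit : ∀ x → ∃ λ σ → ∣ σ ∣ ≡ 1 × (∀ N → ∣ + N ℤ.* x ℤ.+ σ ∣ ≡ suc (N * ∣ x ∣))
outward-unit (+ m)      = 1ℤ , refl , λ N →
  trans (cong (λ t → ∣ t ℤ.+ 1ℤ ∣) (sym (ℤ.pos-* N m))) (ℕ.+-comm (N * m) 1)
outward-unit ℤ.-[1+ m ] = ℤ.-1ℤ , refl , λ N → begin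
  ∣ + N ℤ.* ℤ.-[1+ m ] ℤ.+ ℤ.-1ℤ ∣        ≡⟨ cong (λ t → ∣ t ℤ.+ ℤ.-1ℤ ∣) (ℤ.neg-distribʳ-* (+ N) (+ suc m)) ⟨
  ∣ - (+ N ℤ.* + suc m) ℤ.+ - 1ℤ ∣        ≡⟨ cong ∣_∣ (ℤ.neg-distrib-+ (+ N ℤ.* + suc m) 1ℤ) ⟨
  ∣ - (+ N ℤ.* + suc m ℤ.+ 1ℤ) ∣          ≡⟨ ℤ.∣-i∣≡∣i∣ (+ N ℤ.* + suc m ℤ.+ 1ℤ) ⟩
  ∣ + N ℤ.* + suc m ℤ.+ 1ℤ ∣              ≡⟨ cong (λ t → ∣ t ℤ.+ 1ℤ ∣) (ℤ.pos-* N (suc m)) ⟨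
  N * suc m + 1                           ≡⟨ ℕ.+-comm (N * suc m) 1 ⟩
  suc (N * suc m)                         ∎
  where open ≡-Reasoning

-- Being a unit is an open condition: N G ± z^r is still one for large N, and leading≤constant
-- for that polynomial is the strict inequality for G.
leading<constant : ∀ {G} r → UnitOnDisc G → DegreeAtMost (suc r) G → ∣ coeff G (suc r) ∣ < ∣ coeff G 0 ∣
leading<constant {G} r u deg with outward-unit (coeff G (suc r))
... | σ , ∣σ∣ , outward = ℕ.*-cancelˡ-< N _ _ (begin-strict
    N * ∣ coeff G (suc r) ∣                <⟨ ℕ.≤-refl ⟩
    suc (N * ∣ coeff G (suc r) ∣)          ≡⟨ outward N ⟨
    ∣ + N ℤ.* coeff G (suc r) ℤ.+ σ ∣      ≡⟨ cong ∣_∣ (trans (coeff-G̃ (suc r)) (cong (λ t → + N ℤ.* coeff G (suc r) ℤ.+ t) (coeff-shiftBy (suc r) σ))) ⟨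
    ∣ coeff G̃ (suc r) ∣                    ≤⟨ leading≤constant (suc r) unit deg-G̃ ⟩
    ∣ coeff G̃ 0 ∣                          ≡⟨ cong ∣_∣ (trans (coeff-G̃ 0) (ℤ.+-identityʳ (+ N ℤ.* coeff G 0))) ⟩
    ∣ + N ℤ.* coeff G 0 ∣                  ≡⟨ ℤ.abs-* (+ N) (coeff G 0) ⟩
    N * ∣ coeff G 0 ∣                      ∎)
  where
  open UnitOnDisc u
  N : ℕ
  -- Scaling by N widens the gap between error and constant to at least N, while the perturbation
  -- adds at most `⟦ cofactor ⟧` to the error.
  N = suc ⟦ cofactor ⟧
  S G̃ SQ : ℤ[z]
  S  = shiftBy (suc r) (const σ)
  G̃  = + N · G +ₚ S
  SQ = S *ₚ cofactor
  coeff-G̃ : ∀ i → coeff G̃ i ≡ + N ℤ.* coeff G i ℤ.+ coeff S i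
  coeff-G̃ i = trans (coeff-+ (+ N · G) S i) (cong (ℤ._+ coeff S i) (coeff-· (+ N) G i))
  deg-G̃ : DegreeAtMost (suc r) G̃
  deg-G̃ {i} r<i = trans (coeff-G̃ i) (cong₂ ℤ._+_
    (trans (cong (+ N ℤ.*_) (deg r<i)) (ℤ.*-zeroʳ (+ N))) (coeff-shiftBy-> (suc r) σ r<i))
  rearrange : + N · (const constant +ₚ -ₚ error) +ₚ SQ
    ≋ const (+ N ℤ.* constant) +ₚ -ₚ (+ N · error +ₚ -ₚ SQ)
  rearrange .at i
    rewrite coeff-+ (+ N · (const constant +ₚ -ₚ error)) SQ i
          | coeff-· (+ N) (const constant +ₚ -ₚ error) i
          | coeff-+ (const constant) (-ₚ error) i
          | coeff-neg error i
          | coeff-+ (+ N · const constant) (-ₚ (+ N · error +ₚ -ₚ SQ)) i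
          | coeff-· (+ N) (const constant) i
          | coeff-neg (+ N · error +ₚ -ₚ SQ) i
          | coeff-+ (+ N · error) (-ₚ SQ) i
          | coeff-· (+ N) error i
          | coeff-neg SQ i
    = identity (+ N) (coeff (const constant) i) (coeff error i) (coeff SQ i)
    where
    identity : ∀ n c e t → n ℤ.* (c ℤ.+ - e) ℤ.+ t ≡ n ℤ.* c ℤ.+ - (n ℤ.* e ℤ.+ - t)
    identity = ℤ-Solver.solve-∀
  open ℕ.≤-Reasoning
  unit : UnitOnDisc G̃
  unit = record
    { cofactor = cofactor
    ; error    = + N · error +ₚ -ₚ SQ
    ; constant = + N ℤ.* constant
    ; multiple = ≋-trans (*ₚ-distribʳ-+ cofactor (+ N · G) S)
        (≋-trans (+ₚ-congʳ SQ (≋-trans (*ₚ-·ˡ (+ N) G cofactor) (·-cong (+ N) multiple))) rearrange)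
    ; small    = begin-strict
        ⟦ + N · error +ₚ -ₚ SQ ⟧             ≤⟨ norm-+ (+ N · error) (-ₚ SQ) ⟩
        ⟦ + N · error ⟧ + ⟦ -ₚ SQ ⟧          ≡⟨ cong₂ _+_ (norm-· (+ N) error) (norm-neg SQ) ⟩
        N * ⟦ error ⟧ + ⟦ SQ ⟧               ≤⟨ ℕ.+-monoʳ-≤ (N * ⟦ error ⟧) (norm-* S cofactor) ⟩
        N * ⟦ error ⟧ + ⟦ S ⟧ * ⟦ cofactor ⟧ ≡⟨ cong (λ t → N * ⟦ error ⟧ + t * ⟦ cofactor ⟧) (trans (norm-shiftBy (suc r) σ) ∣σ∣) ⟩
        N * ⟦ error ⟧ + 1 * ⟦ cofactor ⟧     ≡⟨ cong (λ t → N * ⟦ error ⟧ + t) (ℕ.*-identityˡ ⟦ cofactor ⟧) ⟩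
        N * ⟦ error ⟧ + ⟦ cofactor ⟧         <⟨ ℕ.+-monoʳ-< (N * ⟦ error ⟧) (ℕ.n<1+n ⟦ cofactor ⟧) ⟩
        N * ⟦ error ⟧ + N                    ≡⟨ ℕ.+-comm (N * ⟦ error ⟧) N ⟩
        N + N * ⟦ error ⟧                    ≡⟨ ℕ.*-suc N ⟦ error ⟧ ⟨
        N * suc ⟦ error ⟧                    ≤⟨ ℕ.*-monoʳ-≤ N small ⟩
        N * ∣ constant ∣                     ≡⟨ ℤ.abs-* (+ N) constant ⟨
        ∣ + N ℤ.* constant ∣                 ∎
    }

-- A dominant coefficient makes f(n + d z) a unit on the disc

majorant : ℕ → ℤ[z] → ℕ
majorant B []      = 0
majorant B (a ∷ f) = ∣ a ∣ + B * majorant B f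

-- Overwriting in place of deleting keeps every other coefficient at its own power.
zeroAt : ℕ → ℤ[z] → ℤ[z]
zeroAt j       []      = []
zeroAt zero    (a ∷ f) = 0ℤ ∷ f
zeroAt (suc j) (a ∷ f) = a ∷ zeroAt j f

comp-split : ∀ q f j → comp f q ≋ const (coeff f j) *ₚ q ^ₚ j +ₚ comp (zeroAt j f) q
comp-split q []      j       = ≋-sym (≋-trans (+ₚ-identityʳ (const 0ℤ *ₚ q ^ₚ j)) (*ₚ-congʳ (q ^ₚ j) 0∷[]))
comp-split q (a ∷ f) zero    = begin
  const a +ₚ q *ₚ comp f q
    ≈⟨ +ₚ-cong (*ₚ-identityʳ (const a)) (comp-0∷ q f) ⟨
  const a *ₚ const 1ℤ +ₚ comp (0ℤ ∷ f) q ∎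
  where open ≋-Reasoning
comp-split q (a ∷ f) (suc j) = begin
  const a +ₚ q *ₚ comp f q
    ≈⟨ +ₚ-congˡ (const a) (*ₚ-congˡ q (comp-split q f j)) ⟩
  const a +ₚ q *ₚ (const (coeff f j) *ₚ q ^ₚ j +ₚ comp (zeroAt j f) q)
    ≈⟨ rearrange (const a) q (const (coeff f j)) (q ^ₚ j) (comp (zeroAt j f) q) ⟩
  const (coeff f j) *ₚ (q *ₚ q ^ₚ j) +ₚ (const a +ₚ q *ₚ comp (zeroAt j f) q) ∎
  where
  open ≋-Reasoning
  rearrange : ∀ A q C p R → A +ₚ q *ₚ (C *ₚ p +ₚ R) ≋ C *ₚ (q *ₚ p) +ₚ (A +ₚ q *ₚ R)
  rearrange = solve-∀ ℤ[z]-almostCommutativeRing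

norm-comp : ∀ q f → ⟦ comp f q ⟧ ≤ majorant ⟦ q ⟧ f
norm-comp q []      = ℕ.≤-refl
norm-comp q (a ∷ f) = begin
  ⟦ const a +ₚ q *ₚ comp f q ⟧          ≤⟨ norm-+ (const a) (q *ₚ comp f q) ⟩
  ⟦ const a ⟧ + ⟦ q *ₚ comp f q ⟧       ≤⟨ ℕ.+-mono-≤ (ℕ.≤-reflexive (ℕ.+-identityʳ ∣ a ∣)) (norm-* q (comp f q)) ⟩
  ∣ a ∣ + ⟦ q ⟧ * ⟦ comp f q ⟧          ≤⟨ ℕ.+-monoʳ-≤ ∣ a ∣ (ℕ.*-monoʳ-≤ ⟦ q ⟧ (norm-comp q f)) ⟩
  ∣ a ∣ + ⟦ q ⟧ * majorant ⟦ q ⟧ f      ∎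
  where open ℕ.≤-Reasoning

^ₚ-distrib-* : ∀ f g j → (f *ₚ g) ^ₚ j ≋ f ^ₚ j *ₚ g ^ₚ j
^ₚ-distrib-* = Exp.^-distrib-* (CommutativeRing.commutativeSemiring ℤ[z]-commutativeRing)

^-distrib-* : ∀ x y j → (x * y) ^ j ≡ x ^ j * y ^ j
^-distrib-* x y zero    = refl
^-distrib-* x y (suc j) = trans (cong (x * y *_) (^-distrib-* x y j)) (interchange x y (x ^ j) (y ^ j))
  where
  interchange : ∀ x y u v → (x * y) * (u * v) ≡ (x * u) * (y * v)
  interchange = ℕ-Solver.solve-∀

linear : ℕ → ℕ → ℤ[z]
linear n d = + n ∷ + d ∷ []

-- n^s times the truncated geometric series of 1 / (n + d z).
approxInverse : ℕ → ℕ → ℕ → ℤ[z]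
approxInverse n d zero    = []
approxInverse n d (suc s) = const (+ (n ^ s)) +ₚ (0ℤ ∷ - + d ∷ []) *ₚ approxInverse n d s

linear-approxInverse : ∀ n d s →
  linear n d *ₚ approxInverse n d s ≋ const (+ (n ^ s)) +ₚ -ₚ ((0ℤ ∷ - + d ∷ []) ^ₚ s)
linear-approxInverse n d zero    =
  ≋-trans (*ₚ-zeroʳ (linear n d)) (≋-sym (-ₚ-inverseʳ (const 1ℤ)))
linear-approxInverse n d (suc s) = begin
  z *ₚ (K +ₚ w *ₚ y)
    ≈⟨ expand z K w y ⟩
  z *ₚ K +ₚ w *ₚ (z *ₚ y)
    ≈⟨ +ₚ-cong (*ₚ-congʳ K z≋) (*ₚ-congˡ w (linear-approxInverse n d s)) ⟩
  (const (+ n) +ₚ -ₚ w) *ₚ K +ₚ w *ₚ (K +ₚ -ₚ (w ^ₚ s))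
    ≈⟨ telescope (const (+ n)) w K (w ^ₚ s) ⟩
  const (+ n) *ₚ K +ₚ -ₚ (w *ₚ w ^ₚ s)
    ≈⟨ +ₚ-congʳ (-ₚ (w *ₚ w ^ₚ s)) (≋-trans (const-* (+ n) (+ (n ^ s))) (∷-cong (sym (ℤ.pos-* n (n ^ s))) ≋-refl)) ⟩
  const (+ (n ^ suc s)) +ₚ -ₚ (w ^ₚ suc s) ∎
  where
  open ≋-Reasoning
  z w K y : ℤ[z]
  z = linear n d
  w = 0ℤ ∷ - + d ∷ []
  K = const (+ (n ^ s))
  y = approxInverse n d s
  z≋ : z ≋ const (+ n) +ₚ -ₚ w
  z≋ = ∷-cong (sym (ℤ.+-identityʳ (+ n))) (∷-cong (sym (ℤ.neg-involutive (+ d))) ≋-refl)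
  expand : ∀ z K w y → z *ₚ (K +ₚ w *ₚ y) ≋ z *ₚ K +ₚ w *ₚ (z *ₚ y)
  expand = solve-∀ ℤ[z]-almostCommutativeRing
  telescope : ∀ N w K p → (N +ₚ -ₚ w) *ₚ K +ₚ w *ₚ (K +ₚ -ₚ p) ≋ N *ₚ K +ₚ -ₚ (w *ₚ p)
  telescope = solve-∀ ℤ[z]-almostCommutativeRing

norm-[0,-d] : ∀ d → ⟦ 0ℤ ∷ - + d ∷ [] ⟧ ≡ d
norm-[0,-d] d = trans (ℕ.+-identityʳ ∣ - + d ∣) (ℤ.∣-i∣≡∣i∣ (+ d))

-- The geometric sum of the n^(s-1-i) d^i is (n^s - d^s) / (n - d), hence at most n^s / A. Writing n
-- as A + d avoids truncated subtraction.
norm-approxInverse : ∀ A d s → A * ⟦ approxInverse (A + d) d s ⟧ ≤ (A + d) ^ s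
norm-approxInverse A d zero    = ℕ.≤-trans (ℕ.≤-reflexive (ℕ.*-zeroʳ A)) ℕ.z≤n
norm-approxInverse A d (suc s) = begin
  A * ⟦ const (+ (n ^ s)) +ₚ w *ₚ y ⟧           ≤⟨ ℕ.*-monoʳ-≤ A (norm-+ (const (+ (n ^ s))) (w *ₚ y)) ⟩
  A * (⟦ const (+ (n ^ s)) ⟧ + ⟦ w *ₚ y ⟧)      ≤⟨ ℕ.*-monoʳ-≤ A (ℕ.+-mono-≤ (ℕ.≤-reflexive (ℕ.+-identityʳ (n ^ s)))
                                                     (ℕ.≤-trans (norm-* w y) (ℕ.≤-reflexive (cong (_* ⟦ y ⟧) (norm-[0,-d] d))))) ⟩
  A * (n ^ s + d * ⟦ y ⟧)                       ≡⟨ regroup A (n ^ s) d ⟦ y ⟧ ⟩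
  A * n ^ s + d * (A * ⟦ y ⟧)                   ≤⟨ ℕ.+-monoʳ-≤ (A * n ^ s) (ℕ.*-monoʳ-≤ d (norm-approxInverse A d s)) ⟩
  A * n ^ s + d * n ^ s                         ≡⟨ ℕ.*-distribʳ-+ (n ^ s) A d ⟨
  n ^ suc s                                     ∎
  where
  open ℕ.≤-Reasoning
  n : ℕ
  n = A + d
  w y : ℤ[z]
  w = 0ℤ ∷ - + d ∷ []
  y = approxInverse n d s
  regroup : ∀ A x d y → A * (x + d * y) ≡ A * x + d * (A * y)
  regroup = ℕ-Solver.solve-∀

power-of-near-constant : ∀ C t e {U} → U ≋ const (+ t) +ₚ -ₚ e → suc C * ⟦ e ⟧ ≤ t → ∀ j →
  ∃ λ D → U ^ₚ j ≋ const (+ (t ^ j)) +ₚ -ₚ D × suc C * ⟦ D ⟧ + t ^ j ≤ 2 ^ j * t ^ j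
-- The summand `t ^ j` on the left makes the bound inductive. As U has norm at most 2 t, x =
-- `suc C * ⟦ D ⟧` grows at most to 2 t x + t^(j+1), and adding t^(j+1) turns this into 2 t (x +
-- t^j).
power-of-near-constant C t e {U} U≋ e-small zero    =
  [] , ≋-sym (+ₚ-identityʳ (const 1ℤ)) , ℕ.≤-reflexive (cong (_+ 1) (ℕ.*-zeroʳ (suc C)))
power-of-near-constant C t e {U} U≋ e-small (suc j) with power-of-near-constant C t e U≋ e-small j
... | D , Uʲ≋ , D-small = D′ , (R.begin
    U *ₚ U ^ₚ j
      R.≈⟨ *ₚ-cong U≋ Uʲ≋ ⟩
    (const (+ t) +ₚ -ₚ e) *ₚ (Tʲ +ₚ -ₚ D)
      R.≈⟨ telescope (const (+ t)) e Tʲ D ⟩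
    const (+ t) *ₚ Tʲ +ₚ -ₚ ((const (+ t) +ₚ -ₚ e) *ₚ D +ₚ e *ₚ Tʲ)
      R.≈⟨ +ₚ-cong (≋-trans (const-* (+ t) (+ (t ^ j))) (∷-cong (sym (ℤ.pos-* t (t ^ j))) ≋-refl))
             (-ₚ-cong (+ₚ-congʳ (e *ₚ Tʲ) (*ₚ-congʳ D (≋-sym U≋)))) ⟩
    const (+ (t ^ suc j)) +ₚ -ₚ D′ R.∎) ,
  (begin
    suc C * ⟦ D′ ⟧ + t * t ^ j
      ≤⟨ ℕ.+-monoˡ-≤ (t * t ^ j) (ℕ.*-monoʳ-≤ (suc C) D′≤) ⟩
    suc C * ((t + t) * ⟦ D ⟧ + ⟦ e ⟧ * t ^ j) + t * t ^ j
      ≡⟨ regroup (suc C) t ⟦ D ⟧ ⟦ e ⟧ (t ^ j) ⟩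
    2 * t * (suc C * ⟦ D ⟧) + (suc C * ⟦ e ⟧) * t ^ j + t * t ^ j
      ≤⟨ ℕ.+-monoˡ-≤ (t * t ^ j) (ℕ.+-monoʳ-≤ (2 * t * (suc C * ⟦ D ⟧)) (ℕ.*-monoˡ-≤ (t ^ j) e-small)) ⟩
    2 * t * (suc C * ⟦ D ⟧) + t * t ^ j + t * t ^ j
      ≡⟨ collect t (suc C * ⟦ D ⟧) (t ^ j) ⟩
    2 * t * (suc C * ⟦ D ⟧ + t ^ j)
      ≤⟨ ℕ.*-monoʳ-≤ (2 * t) D-small ⟩
    2 * t * (2 ^ j * t ^ j)
      ≡⟨ interchange t (2 ^ j) (t ^ j) ⟩
    2 ^ suc j * t ^ suc j ∎)
  where
  open ℕ.≤-Reasoning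
  module R = ≋-Reasoning
  Tʲ D′ : ℤ[z]
  Tʲ = const (+ (t ^ j))
  D′ = U *ₚ D +ₚ e *ₚ Tʲ
  U≤ : ⟦ U ⟧ ≤ t + t
  U≤ = begin
    ⟦ U ⟧                              ≡⟨ norm-cong U≋ ⟩
    ⟦ const (+ t) +ₚ -ₚ e ⟧            ≤⟨ norm-+ (const (+ t)) (-ₚ e) ⟩
    ⟦ const (+ t) ⟧ + ⟦ -ₚ e ⟧         ≡⟨ cong₂ _+_ (ℕ.+-identityʳ t) (norm-neg e) ⟩
    t + ⟦ e ⟧                          ≤⟨ ℕ.+-monoʳ-≤ t (ℕ.≤-trans (ℕ.m≤m+n ⟦ e ⟧ (C * ⟦ e ⟧)) e-small) ⟩
    t + t                              ∎
  D′≤ : ⟦ D′ ⟧ ≤ (t + t) * ⟦ D ⟧ + ⟦ e ⟧ * t ^ j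
  D′≤ = begin
    ⟦ U *ₚ D +ₚ e *ₚ Tʲ ⟧              ≤⟨ norm-+ (U *ₚ D) (e *ₚ Tʲ) ⟩
    ⟦ U *ₚ D ⟧ + ⟦ e *ₚ Tʲ ⟧           ≤⟨ ℕ.+-mono-≤ (norm-* U D) (norm-* e Tʲ) ⟩
    ⟦ U ⟧ * ⟦ D ⟧ + ⟦ e ⟧ * ⟦ Tʲ ⟧     ≤⟨ ℕ.+-mono-≤ (ℕ.*-monoˡ-≤ ⟦ D ⟧ U≤) (ℕ.≤-reflexive (cong (⟦ e ⟧ *_) (ℕ.+-identityʳ (t ^ j)))) ⟩
    (t + t) * ⟦ D ⟧ + ⟦ e ⟧ * t ^ j    ∎
  telescope : ∀ T e P D → (T +ₚ -ₚ e) *ₚ (P +ₚ -ₚ D) ≋ T *ₚ P +ₚ -ₚ ((T +ₚ -ₚ e) *ₚ D +ₚ e *ₚ P)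
  telescope = solve-∀ ℤ[z]-almostCommutativeRing
  regroup : ∀ C t D e p → C * ((t + t) * D + e * p) + t * p ≡ 2 * t * (C * D) + (C * e) * p + t * p
  regroup = ℕ-Solver.solve-∀
  collect : ∀ t x p → 2 * t * x + t * p + t * p ≡ 2 * t * (x + p)
  collect = ℕ-Solver.solve-∀
  interchange : ∀ t x p → 2 * t * (x * p) ≡ (2 * x) * (t * p)
  interchange = ℕ-Solver.solve-∀

-- Multiplying f(n + d z) by the j-th power of the approximate inverse of n + d z turns the
-- dominant term into a near constant, while the other terms stay bounded by the majorant.
dominant⇒unitOnDisc : ∀ A d f j → 0 < A →
  majorant (A + d + d) (zeroAt j f) < ∣ coeff f j ∣ * A ^ j → UnitOnDisc (comp f (linear (A + d) d))
dominant⇒unitOnDisc A d f j 0<A dominant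
  -- With K = |a_j| A^j, the j-th power costs a factor 2^j and the dominant term a factor K. The
  -- choice C = K 2^j therefore forces K `⟦ D ⟧` < t^j.
  with geometric-gap (suc (∣ coeff f j ∣ * A ^ j * 2 ^ j)) {d} {A + d} (ℕ.m<n+m d 0<A)
... | s , gap with power-of-near-constant (∣ coeff f j ∣ * A ^ j * 2 ^ j) ((A + d) ^ s) ((0ℤ ∷ - + d ∷ []) ^ₚ s)
                     (linear-approxInverse (A + d) d s)
                     (ℕ.≤-trans (ℕ.*-monoʳ-≤ (suc (∣ coeff f j ∣ * A ^ j * 2 ^ j))
                       (ℕ.≤-trans (norm-^ (0ℤ ∷ - + d ∷ []) s) (ℕ.≤-reflexive (cong (_^ s) (norm-[0,-d] d)))))
                       (ℕ.<⇒≤ gap)) j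
... | D , zy^j , D-small = record
  { cofactor = y ^ₚ j
  ; error    = const c *ₚ D +ₚ -ₚ (R *ₚ y ^ₚ j)
  ; constant = c ℤ.* + (t ^ j)
  ; multiple = S.begin
      comp f z *ₚ y ^ₚ j
        S.≈⟨ *ₚ-congʳ (y ^ₚ j) (comp-split z f j) ⟩
      (const c *ₚ z ^ₚ j +ₚ R) *ₚ y ^ₚ j
        S.≈⟨ expand (const c) (z ^ₚ j) R (y ^ₚ j) ⟩
      const c *ₚ (z ^ₚ j *ₚ y ^ₚ j) +ₚ R *ₚ y ^ₚ j
        S.≈⟨ +ₚ-congʳ (R *ₚ y ^ₚ j) (*ₚ-congˡ (const c) (≋-trans (≋-sym (^ₚ-distrib-* z y j)) zy^j)) ⟩
      const c *ₚ (const (+ (t ^ j)) +ₚ -ₚ D) +ₚ R *ₚ y ^ₚ j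
        S.≈⟨ collect (const c) (const (+ (t ^ j))) D (R *ₚ y ^ₚ j) ⟩
      const c *ₚ const (+ (t ^ j)) +ₚ -ₚ (const c *ₚ D +ₚ -ₚ (R *ₚ y ^ₚ j))
        S.≈⟨ +ₚ-congʳ (-ₚ (const c *ₚ D +ₚ -ₚ (R *ₚ y ^ₚ j))) (const-* c (+ (t ^ j))) ⟩
      const (c ℤ.* + (t ^ j)) +ₚ -ₚ (const c *ₚ D +ₚ -ₚ (R *ₚ y ^ₚ j)) S.∎
  -- Scaling by A^j is needed because the approximate inverse is bounded only as A `⟦ y ⟧` ≤ t.
  -- Integral dominance M + 1 ≤ K leaves a margin of t^j, which the error K `⟦ D ⟧` does not use up.
  ; small    = ℕ.*-cancelˡ-< (A ^ j) _ _ (begin-strict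
      A ^ j * ⟦ const c *ₚ D +ₚ -ₚ (R *ₚ y ^ₚ j) ⟧
        ≤⟨ ℕ.*-monoʳ-≤ (A ^ j) error≤ ⟩
      A ^ j * (∣ c ∣ * ⟦ D ⟧ + M * ⟦ y ⟧ ^ j)
        ≡⟨ regroup (A ^ j) ∣ c ∣ ⟦ D ⟧ M (⟦ y ⟧ ^ j) ⟩
      K * ⟦ D ⟧ + M * (A ^ j * ⟦ y ⟧ ^ j)
        ≤⟨ ℕ.+-monoʳ-≤ (K * ⟦ D ⟧) (ℕ.*-monoʳ-≤ M Ay≤) ⟩
      K * ⟦ D ⟧ + M * t ^ j
        <⟨ ℕ.+-monoˡ-< (M * t ^ j) KD< ⟩
      suc M * t ^ j
        ≤⟨ ℕ.*-monoˡ-≤ (t ^ j) dominant ⟩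
      K * t ^ j
        ≡⟨ rotate ∣ c ∣ (A ^ j) (t ^ j) ⟩
      A ^ j * (∣ c ∣ * t ^ j)
        ≡⟨ cong (A ^ j *_) (ℤ.abs-* c (+ (t ^ j))) ⟨
      A ^ j * ∣ c ℤ.* + (t ^ j) ∣ ∎)
  }
  where
  open ℕ.≤-Reasoning
  module S = ≋-Reasoning
  c : ℤ
  c = coeff f j
  z y R : ℤ[z]
  z = linear (A + d) d
  y = approxInverse (A + d) d s
  R = comp (zeroAt j f) z
  t K M : ℕ
  t = (A + d) ^ s
  K = ∣ c ∣ * A ^ j
  M = majorant (A + d + d) (zeroAt j f)
  t^j>0 : 0 < t ^ j
  t^j>0 = ℕ.m^n>0 t {{ℕ.>-nonZero (ℕ.m^n>0 (A + d) {{ℕ.>-nonZero (ℕ.≤-trans 0<A (ℕ.m≤m+n A d))}} s)}} j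
  error≤ : ⟦ const c *ₚ D +ₚ -ₚ (R *ₚ y ^ₚ j) ⟧ ≤ ∣ c ∣ * ⟦ D ⟧ + M * ⟦ y ⟧ ^ j
  error≤ = begin
    ⟦ const c *ₚ D +ₚ -ₚ (R *ₚ y ^ₚ j) ⟧
      ≤⟨ norm-+ (const c *ₚ D) (-ₚ (R *ₚ y ^ₚ j)) ⟩
    ⟦ const c *ₚ D ⟧ + ⟦ -ₚ (R *ₚ y ^ₚ j) ⟧
      ≡⟨ cong₂ _+_ (trans (norm-cong ([ c ]*ₚ D)) (norm-· c D)) (norm-neg (R *ₚ y ^ₚ j)) ⟩
    ∣ c ∣ * ⟦ D ⟧ + ⟦ R *ₚ y ^ₚ j ⟧
      ≤⟨ ℕ.+-monoʳ-≤ (∣ c ∣ * ⟦ D ⟧) (norm-* R (y ^ₚ j)) ⟩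
    ∣ c ∣ * ⟦ D ⟧ + ⟦ R ⟧ * ⟦ y ^ₚ j ⟧
      ≤⟨ ℕ.+-monoʳ-≤ (∣ c ∣ * ⟦ D ⟧) (ℕ.*-mono-≤ R≤ (norm-^ y j)) ⟩
    ∣ c ∣ * ⟦ D ⟧ + M * ⟦ y ⟧ ^ j ∎
    where
    R≤ : ⟦ R ⟧ ≤ M
    R≤ = ℕ.≤-trans (norm-comp z (zeroAt j f))
      (ℕ.≤-reflexive (cong (λ B → majorant (A + d + B) (zeroAt j f)) (ℕ.+-identityʳ d)))
  Ay≤ : A ^ j * ⟦ y ⟧ ^ j ≤ t ^ j
  Ay≤ = ℕ.≤-trans (ℕ.≤-reflexive (sym (^-distrib-* A ⟦ y ⟧ j))) (ℕ.^-monoˡ-≤ j (norm-approxInverse A d s))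
  KD< : K * ⟦ D ⟧ < t ^ j
  KD< = ℕ.*-cancelˡ-< (2 ^ j) _ _ (begin-strict
    2 ^ j * (K * ⟦ D ⟧)                      ≡⟨ rotate′ (2 ^ j) K ⟦ D ⟧ ⟩
    K * 2 ^ j * ⟦ D ⟧                        ≤⟨ ℕ.m≤n+m (K * 2 ^ j * ⟦ D ⟧) ⟦ D ⟧ ⟩
    suc (K * 2 ^ j) * ⟦ D ⟧                  <⟨ ℕ.m<m+n _ t^j>0 ⟩
    suc (K * 2 ^ j) * ⟦ D ⟧ + t ^ j          ≤⟨ D-small ⟩
    2 ^ j * t ^ j                            ∎)
    where
    rotate′ : ∀ x k d → x * (k * d) ≡ k * x * d
    rotate′ = ℕ-Solver.solve-∀
  expand : ∀ C p R q → (C *ₚ p +ₚ R) *ₚ q ≋ C *ₚ (p *ₚ q) +ₚ R *ₚ q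
  expand = solve-∀ ℤ[z]-almostCommutativeRing
  collect : ∀ C T D r → C *ₚ (T +ₚ -ₚ D) +ₚ r ≋ C *ₚ T +ₚ -ₚ (C *ₚ D +ₚ -ₚ r)
  collect = solve-∀ ℤ[z]-almostCommutativeRing
  regroup : ∀ a c x m y → a * (c * x + m * y) ≡ c * a * x + m * (a * y)
  regroup = ℕ-Solver.solve-∀
  rotate : ∀ c a x → c * a * x ≡ a * (c * x)
  rotate = ℕ-Solver.solve-∀

-- Values of factors at n

degree? : ∀ f → [] ≋ f ⊎ ∃ λ r → DegreeAtMost r f × ¬ coeff f r ≡ 0ℤ
degree? []      = inj₁ ≋-refl
degree? (a ∷ f) with degree? f
... | inj₂ (r , deg , top≢0) = inj₂ (suc r , (λ { (ℕ.s≤s r<i) → deg r<i }) , top≢0)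
... | inj₁ f≋[] with a ℤ.≟ 0ℤ
...   | yes a≡0 = inj₁ (≋-trans (≋-sym 0∷[]) (∷-cong (sym a≡0) f≋[]))
...   | no  a≢0 = inj₂ (0 , (λ { {suc i} _ → sym (at f≋[] i) }) , a≢0)

coeff-linear-* : ∀ n d P i →
  coeff (linear n d *ₚ P) (suc i) ≡ + n ℤ.* coeff P (suc i) ℤ.+ + d ℤ.* coeff P i
coeff-linear-* n d P i = trans (coeff-+ (+ n · P) (0ℤ ∷ const (+ d) *ₚ P) (suc i))
  (cong₂ ℤ._+_ (coeff-· (+ n) P (suc i)) (trans (at ([ + d ]*ₚ P) i) (coeff-· (+ d) P i)))

coeff-comp-linear-suc : ∀ n d a f i → let P = comp f (linear n d) in
  coeff (comp (a ∷ f) (linear n d)) (suc i) ≡ + n ℤ.* coeff P (suc i) ℤ.+ + d ℤ.* coeff P i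
coeff-comp-linear-suc n d a f i = begin
  coeff (const a +ₚ linear n d *ₚ P) (suc i)          ≡⟨ coeff-+ (const a) (linear n d *ₚ P) (suc i) ⟩
  0ℤ ℤ.+ coeff (linear n d *ₚ P) (suc i)              ≡⟨ ℤ.+-identityˡ _ ⟩
  coeff (linear n d *ₚ P) (suc i)                     ≡⟨ coeff-linear-* n d P i ⟩
  + n ℤ.* coeff P (suc i) ℤ.+ + d ℤ.* coeff P i       ∎
  where
  open ≡-Reasoning
  P : ℤ[z]
  P = comp f (linear n d)

constant-tail : ∀ a f → DegreeAtMost 0 (a ∷ f) → [] ≋ f
constant-tail a f deg .at i = sym (deg {suc i} (ℕ.s≤s ℕ.z≤n))

degree-comp-linear : ∀ n d r f → DegreeAtMost r f → DegreeAtMost r (comp f (linear n d))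
degree-comp-linear n d r       []      deg r<i = refl
degree-comp-linear n d zero    (a ∷ f) deg {suc i} _ = begin
  coeff (comp (a ∷ f) (linear n d)) (suc i)            ≡⟨ coeff-comp-linear-suc n d a f i ⟩
  + n ℤ.* coeff P (suc i) ℤ.+ + d ℤ.* coeff P i        ≡⟨ cong₂ (λ s t → + n ℤ.* s ℤ.+ + d ℤ.* t) (at P≋[] (suc i)) (at P≋[] i) ⟩
  + n ℤ.* 0ℤ ℤ.+ + d ℤ.* 0ℤ                            ≡⟨ cong₂ ℤ._+_ (ℤ.*-zeroʳ (+ n)) (ℤ.*-zeroʳ (+ d)) ⟩
  0ℤ                                                   ∎
  where
  open ≡-Reasoning
  P : ℤ[z]
  P = comp f (linear n d)
  P≋[] : P ≋ []
  P≋[] = comp-[] (linear n d) (constant-tail a f deg)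
degree-comp-linear n d (suc r) (a ∷ f) deg {suc i} (ℕ.s≤s r<i) = begin
  coeff (comp (a ∷ f) (linear n d)) (suc i)            ≡⟨ coeff-comp-linear-suc n d a f i ⟩
  + n ℤ.* coeff P (suc i) ℤ.+ + d ℤ.* coeff P i        ≡⟨ cong₂ (λ s t → + n ℤ.* s ℤ.+ + d ℤ.* t)
                                                            (deg-P (ℕ.m<n⇒m<1+n r<i)) (deg-P r<i) ⟩
  + n ℤ.* 0ℤ ℤ.+ + d ℤ.* 0ℤ                            ≡⟨ cong₂ ℤ._+_ (ℤ.*-zeroʳ (+ n)) (ℤ.*-zeroʳ (+ d)) ⟩
  0ℤ                                                   ∎
  where
  open ≡-Reasoning
  P : ℤ[z]
  P = comp f (linear n d)
  deg-P : DegreeAtMost r P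
  deg-P = degree-comp-linear n d r f (λ r<i → deg (ℕ.s≤s r<i))

-- The factor d^r produced here is what turns a comparison of coefficients into a lower bound by d.
leading-comp-linear : ∀ n d r f → DegreeAtMost r f →
  coeff (comp f (linear n d)) r ≡ + (d ^ r) ℤ.* coeff f r
leading-comp-linear n d r       []      deg = sym (ℤ.*-zeroʳ (+ (d ^ r)))
leading-comp-linear n d zero    (a ∷ f) deg = begin
  coeff (const a +ₚ linear n d *ₚ P) 0       ≡⟨ coeff-+ (const a) (linear n d *ₚ P) 0 ⟩
  a ℤ.+ coeff (linear n d *ₚ P) 0            ≡⟨ cong (λ t → a ℤ.+ t) (coeff-* (linear n d) P 0) ⟩
  a ℤ.+ + n ℤ.* coeff P 0                    ≡⟨ cong (λ t → a ℤ.+ + n ℤ.* t) (at P≋[] 0) ⟩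
  a ℤ.+ + n ℤ.* 0ℤ                           ≡⟨ cong (λ t → a ℤ.+ t) (ℤ.*-zeroʳ (+ n)) ⟩
  a ℤ.+ 0ℤ                                   ≡⟨ ℤ.+-identityʳ a ⟩
  a                                          ≡⟨ ℤ.*-identityˡ a ⟨
  1ℤ ℤ.* a                                   ∎
  where
  open ≡-Reasoning
  P : ℤ[z]
  P = comp f (linear n d)
  P≋[] : P ≋ []
  P≋[] = comp-[] (linear n d) (constant-tail a f deg)
leading-comp-linear n d (suc r) (a ∷ f) deg = begin
  coeff (comp (a ∷ f) (linear n d)) (suc r)            ≡⟨ coeff-comp-linear-suc n d a f r ⟩
  + n ℤ.* coeff P (suc r) ℤ.+ + d ℤ.* coeff P r        ≡⟨ cong₂ (λ s t → + n ℤ.* s ℤ.+ + d ℤ.* t)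
                                                            (degree-comp-linear n d r f deg-f ℕ.≤-refl)
                                                            (leading-comp-linear n d r f deg-f) ⟩
  + n ℤ.* 0ℤ ℤ.+ + d ℤ.* (+ (d ^ r) ℤ.* coeff f r)     ≡⟨ collect (+ n) (+ d) (+ (d ^ r)) (coeff f r) ⟩
  (+ d ℤ.* + (d ^ r)) ℤ.* coeff f r                    ≡⟨ cong (ℤ._* coeff f r) (ℤ.pos-* d (d ^ r)) ⟨
  + (d ^ suc r) ℤ.* coeff f r                          ∎
  where
  open ≡-Reasoning
  P : ℤ[z]
  P = comp f (linear n d)
  deg-f : DegreeAtMost r f
  deg-f r<i = deg (ℕ.s≤s r<i)
  collect : ∀ n d p c → n ℤ.* 0ℤ ℤ.+ d ℤ.* (p ℤ.* c) ≡ (d ℤ.* p) ℤ.* c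
  collect = ℤ-Solver.solve-∀

-- The value at n is the constant term of G, which strictly exceeds its leading coefficient, a
-- nonzero multiple of d^(r+1).
nonconstant-value : ∀ n d {g} r → 0 < d → UnitOnDisc (comp g (linear n d)) →
  DegreeAtMost (suc r) g → ¬ coeff g (suc r) ≡ 0ℤ → d < ∣ eval g (+ n) ∣
nonconstant-value n d {g} r 0<d unit deg top≢0 = begin-strict
  d                                                 ≡⟨ ℕ.*-identityʳ d ⟨
  d * 1                                             ≤⟨ ℕ.*-monoʳ-≤ d (ℕ.m^n>0 d {{ℕ.>-nonZero 0<d}} r) ⟩
  d ^ suc r                                         ≡⟨ ℕ.*-identityʳ (d ^ suc r) ⟨
  d ^ suc r * 1                                     ≤⟨ ℕ.*-monoʳ-≤ (d ^ suc r) (ℕ.n≢0⇒n>0 (λ e → top≢0 (ℤ.∣i∣≡0⇒i≡0 e))) ⟩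
  d ^ suc r * ∣ coeff g (suc r) ∣                   ≡⟨ ℤ.abs-* (+ (d ^ suc r)) (coeff g (suc r)) ⟨
  ∣ + (d ^ suc r) ℤ.* coeff g (suc r) ∣             ≡⟨ cong ∣_∣ (leading-comp-linear n d (suc r) g deg) ⟨
  ∣ coeff (comp g (linear n d)) (suc r) ∣           <⟨ leading<constant r unit (degree-comp-linear n d (suc r) g deg) ⟩
  ∣ coeff (comp g (linear n d)) 0 ∣                 ≡⟨ cong ∣_∣ (coeff₀-comp (+ n) (+ d) g) ⟩
  ∣ eval g (+ n) ∣                                  ∎
  where open ℕ.≤-Reasoning

-- Taylor coefficients

coeff-scaleFrom : ∀ k f i → coeff (scaleFrom k f) i ≡ + (k + i) ℤ.* coeff f i
coeff-scaleFrom k []      i       = sym (ℤ.*-zeroʳ (+ (k + i)))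
coeff-scaleFrom k (a ∷ f) zero    = cong (λ t → + t ℤ.* a) (sym (ℕ.+-identityʳ k))
coeff-scaleFrom k (a ∷ f) (suc i) =
  trans (coeff-scaleFrom (suc k) f i) (cong (λ t → + t ℤ.* coeff f i) (sym (ℕ.+-suc k i)))

coeff-derivative : ∀ f i → coeff (derivative f) i ≡ + suc i ℤ.* coeff f (suc i)
coeff-derivative []      i = sym (ℤ.*-zeroʳ (+ suc i))
coeff-derivative (a ∷ f) i = coeff-scaleFrom 1 f i

derivative-cong : ∀ {f g} → f ≋ g → derivative f ≋ derivative g
derivative-cong {f} {g} e .at i = trans (coeff-derivative f i)
  (trans (cong (+ suc i ℤ.*_) (at e (suc i))) (sym (coeff-derivative g i)))

derivative-+ : ∀ f g → derivative (f +ₚ g) ≋ derivative f +ₚ derivative g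
derivative-+ f g .at i
  rewrite coeff-derivative (f +ₚ g) i | coeff-+ f g (suc i)
        | coeff-+ (derivative f) (derivative g) i | coeff-derivative f i | coeff-derivative g i
  = ℤ.*-distribˡ-+ (+ suc i) (coeff f (suc i)) (coeff g (suc i))

derivative-· : ∀ c f → derivative (c · f) ≋ c · derivative f
derivative-· c f .at i
  rewrite coeff-derivative (c · f) i | coeff-· c f (suc i)
        | coeff-· c (derivative f) i | coeff-derivative f i
  = swap (+ suc i) c (coeff f (suc i))
  where
  swap : ∀ k c a → k ℤ.* (c ℤ.* a) ≡ c ℤ.* (k ℤ.* a)
  swap = ℤ-Solver.solve-∀

derivative-0∷ : ∀ f → derivative (0ℤ ∷ f) ≋ f +ₚ (0ℤ ∷ derivative f)
derivative-0∷ f .at zero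
  rewrite coeff-derivative (0ℤ ∷ f) 0 | coeff-+ f (0ℤ ∷ derivative f) 0
  = trans (ℤ.*-identityˡ (coeff f 0)) (sym (ℤ.+-identityʳ (coeff f 0)))
derivative-0∷ f .at (suc i)
  rewrite coeff-derivative (0ℤ ∷ f) (suc i) | coeff-+ f (0ℤ ∷ derivative f) (suc i) | coeff-derivative f i
  = ℤ.suc-* (+ suc i) (coeff f (suc i))

linear₁-* : ∀ n P → linear n 1 *ₚ P ≋ + n · P +ₚ (0ℤ ∷ P)
linear₁-* n P = +ₚ-congˡ (+ n · P) (∷-cong refl (*ₚ-identityˡ P))

derivative-comp : ∀ n f → derivative (comp f (linear n 1)) ≋ comp (derivative f) (linear n 1)
derivative-comp n []      = ≋-refl
derivative-comp n (a ∷ f) = begin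
  derivative (const a +ₚ z *ₚ P)                     ≈⟨ derivative-+ (const a) (z *ₚ P) ⟩
  derivative (z *ₚ P)                                ≈⟨ derivative-cong (linear₁-* n P) ⟩
  derivative (+ n · P +ₚ (0ℤ ∷ P))                   ≈⟨ derivative-+ (+ n · P) (0ℤ ∷ P) ⟩
  derivative (+ n · P) +ₚ derivative (0ℤ ∷ P)        ≈⟨ +ₚ-cong (derivative-· (+ n) P) (derivative-0∷ P) ⟩
  + n · P′ +ₚ (P +ₚ (0ℤ ∷ P′))                       ≈⟨ rearrange (+ n · P′) P (0ℤ ∷ P′) ⟩
  P +ₚ (+ n · P′ +ₚ (0ℤ ∷ P′))                       ≈⟨ +ₚ-congˡ P (linear₁-* n P′) ⟨
  P +ₚ z *ₚ P′                                       ≈⟨ +ₚ-congˡ P (*ₚ-congˡ z (derivative-comp n f)) ⟩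
  P +ₚ z *ₚ comp (derivative f) z                    ≈⟨ +ₚ-congˡ P (comp-0∷ z (derivative f)) ⟨
  P +ₚ comp (0ℤ ∷ derivative f) z                    ≈⟨ comp-+ z f (0ℤ ∷ derivative f) ⟨
  comp (f +ₚ (0ℤ ∷ derivative f)) z                  ≈⟨ comp-cong z (derivative-0∷ f) ⟨
  comp (derivative (a ∷ f)) z                        ∎
  where
  open ≋-Reasoning
  z P P′ : ℤ[z]
  z  = linear n 1
  P  = comp f z
  P′ = derivative P
  rearrange : ∀ A B C → A +ₚ (B +ₚ C) ≋ B +ₚ (A +ₚ C)
  rearrange = solve-∀ ℤ[z]-almostCommutativeRing

derivatives-comp : ∀ n f i → comp f (linear n 1) ⁽ i ⁾ ≋ comp (f ⁽ i ⁾) (linear n 1)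
derivatives-comp n f zero    = ≋-refl
derivatives-comp n f (suc i) =
  ≋-trans (derivative-cong (derivatives-comp n f i)) (derivative-comp n (f ⁽ i ⁾))

-- Keeping both factorials avoids dividing (i + k)! by k!; at k = 0 it becomes the Taylor formula.
coeff-derivatives : ∀ f i k → + (k !) ℤ.* coeff (f ⁽ i ⁾) k ≡ + ((i + k) !) ℤ.* coeff f (i + k)
coeff-derivatives f zero    k = refl
coeff-derivatives f (suc i) k = begin
  + (k !) ℤ.* coeff (derivative (f ⁽ i ⁾)) k                ≡⟨ cong (+ (k !) ℤ.*_) (coeff-derivative (f ⁽ i ⁾) k) ⟩
  + (k !) ℤ.* (+ suc k ℤ.* coeff (f ⁽ i ⁾) (suc k))         ≡⟨ swap (+ (k !)) (+ suc k) (coeff (f ⁽ i ⁾) (suc k)) ⟩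
  (+ suc k ℤ.* + (k !)) ℤ.* coeff (f ⁽ i ⁾) (suc k)         ≡⟨ cong (ℤ._* coeff (f ⁽ i ⁾) (suc k)) (ℤ.pos-* (suc k) (k !)) ⟨
  + (suc k !) ℤ.* coeff (f ⁽ i ⁾) (suc k)                   ≡⟨ coeff-derivatives f i (suc k) ⟩
  + ((i + suc k) !) ℤ.* coeff f (i + suc k)                 ≡⟨ cong (λ t → + (t !) ℤ.* coeff f t) (ℕ.+-suc i k) ⟩
  + ((suc i + k) !) ℤ.* coeff f (suc i + k)                 ∎
  where
  open ≡-Reasoning
  swap : ∀ a b c → a ℤ.* (b ℤ.* c) ≡ (b ℤ.* a) ℤ.* c
  swap = ℤ-Solver.solve-∀

-- The remainder is a multiple of m smaller than m, so it vanishes.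
*-/ℕ-cancel : ∀ m c .{{_ : ℕ.NonZero m}} → (+ m ℤ.* c) ℤ./ℕ m ≡ c
*-/ℕ-cancel m c = sym (ℤ.i-j≡0⇒i≡j c q (ℤ.∣i∣≡0⇒i≡0 (ℕ.n<1⇒n≡0 (ℕ.*-cancelˡ-< m _ _ (begin-strict
  m * ∣ c ℤ.- q ∣            ≡⟨ ℤ.abs-* (+ m) (c ℤ.- q) ⟨
  ∣ + m ℤ.* (c ℤ.- q) ∣      ≡⟨ cong ∣_∣ remainder ⟩
  r                          <⟨ ℤ.n%ℕd<d (+ m ℤ.* c) m ⟩
  m                          ≡⟨ ℕ.*-identityʳ m ⟨
  m * 1                      ∎)))))
  where
  open ℕ.≤-Reasoning
  q : ℤ
  q = (+ m ℤ.* c) ℤ./ℕ m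
  r : ℕ
  r = (+ m ℤ.* c) ℤ.%ℕ m
  expand : ∀ m c q → m ℤ.* (c ℤ.- q) ≡ m ℤ.* c ℤ.- q ℤ.* m
  expand = ℤ-Solver.solve-∀
  cancel : ∀ r s → r ℤ.+ s ℤ.- s ≡ r
  cancel = ℤ-Solver.solve-∀
  remainder : + m ℤ.* (c ℤ.- q) ≡ + r
  remainder = trans (expand (+ m) c q)
    (trans (cong (ℤ._- q ℤ.* + m) (ℤ.a≡a%ℕn+[a/ℕn]*n (+ m ℤ.* c) m)) (cancel (+ r) (q ℤ.* + m)))

-- Taylor's formula. It moves the divisibility hypotheses to the coefficients of f(n + z), where a
-- factorisation becomes a convolution.
taylorCoeff≡coeff : ∀ f i n → taylorCoeff f i (+ n) ≡ coeff (comp f (linear n 1)) i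
taylorCoeff≡coeff f i n = trans (cong (λ t → (t ℤ./ℕ (i !)) {{i ℕ.!≢0}}) value)
  (*-/ℕ-cancel (i !) (coeff F i) {{i ℕ.!≢0}})
  where
  open ≡-Reasoning
  F : ℤ[z]
  F = comp f (linear n 1)
  value : eval (f ⁽ i ⁾) (+ n) ≡ + (i !) ℤ.* coeff F i
  value = begin
    eval (f ⁽ i ⁾) (+ n)                          ≡⟨ coeff₀-comp (+ n) (+ 1) (f ⁽ i ⁾) ⟨
    coeff (comp (f ⁽ i ⁾) (linear n 1)) 0         ≡⟨ at (derivatives-comp n f i) 0 ⟨
    coeff (F ⁽ i ⁾) 0                             ≡⟨ ℤ.*-identityˡ (coeff (F ⁽ i ⁾) 0) ⟨
    + (0 !) ℤ.* coeff (F ⁽ i ⁾) 0                 ≡⟨ coeff-derivatives F i 0 ⟩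
    + ((i + 0) !) ℤ.* coeff F (i + 0)             ≡⟨ cong (λ t → + (t !) ℤ.* coeff F t) (ℕ.+-identityʳ i) ⟩
    + (i !) ℤ.* coeff F i                         ∎

-- Divisibility by powers of p

module _ {p : ℕ} (p-prime : Prime p) where

  private
    instance
      p≢0 : ℕ.NonZero p
      p≢0 = prime⇒nonZero p-prime

  -- Factors p are stripped from x one by one, so a is the exponent of p in x and b is what remains
  -- of E.
  split-exponent : ∀ E x y → p ^ suc E ∤ x * y →
    ∃₂ λ a b → a + b ≡ E × p ^ suc a ∤ x × p ^ suc b ∤ y
  split-exponent E x y ∤xy with p ∣? x
  ... | no p∤x = 0 , E , refl , (λ p∣x → p∤x (subst (_∣ x) (ℕ.*-identityʳ p) p∣x)) , λ ∣y → ∤xy (∣n⇒∣m*n x ∣y)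
  split-exponent zero    x y ∤xy | yes p∣x = contradiction (subst (_∣ x * y) (sym (ℕ.*-identityʳ p)) (∣m⇒∣m*n y p∣x)) ∤xy
  split-exponent (suc E) x y ∤xy | yes (divides x′ x≡)
    with split-exponent E x′ y (λ h → ∤xy (subst (p ^ suc (suc E) ∣_) (sym x*y≡) (*-monoʳ-∣ p h)))
    where
    regroup : ∀ x p y → x * p * y ≡ p * (x * y)
    regroup = ℕ-Solver.solve-∀
    x*y≡ : x * y ≡ p * (x′ * y)
    x*y≡ = trans (cong (_* y) x≡) (regroup x′ p y)
  ... | a , b , a+b≡E , ∤x′ , ∤y =
    suc a , b , cong suc a+b≡E ,
    (λ h → ∤x′ (*-cancelˡ-∣ p (subst (p * p ^ suc a ∣_) (trans x≡ (ℕ.*-comm x′ p)) h))) , ∤y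

  -- Additivity of the p-adic valuation: by Euclid's lemma, a further factor p of the product would
  -- divide one of the cofactors.
  exact-product : ∀ a b {x y} → p ^ a ∣ x → p ^ suc a ∤ x → p ^ b ∣ y → p ^ suc b ∤ y → p ^ suc (a + b) ∤ x * y
  exact-product a b {x} {y} (divides x′ x≡) ∤x (divides y′ y≡) ∤y ∣xy
    with euclidsLemma x′ y′ p-prime (*-cancelʳ-∣ (p ^ (a + b)) {{ℕ.m^n≢0 p (a + b)}} (subst (p ^ suc (a + b) ∣_) x*y≡ ∣xy))
    where
    regroup : ∀ x y s t → (x * s) * (y * t) ≡ x * y * (s * t)
    regroup = ℕ-Solver.solve-∀
    x*y≡ : x * y ≡ x′ * y′ * p ^ (a + b)
    x*y≡ = trans (cong₂ _*_ x≡ y≡)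
      (trans (regroup x′ y′ (p ^ a) (p ^ b)) (cong (x′ * y′ *_) (sym (ℕ.^-distribˡ-+-* p a b))))
  ... | inj₁ p∣x′ = ∤x (subst (p ^ suc a ∣_) (sym x≡) (*-monoˡ-∣ (p ^ a) p∣x′))
  ... | inj₂ p∣y′ = ∤y (subst (p ^ suc b ∣_) (sym y≡) (*-monoˡ-∣ (p ^ b) p∣y′))

  prime-to-p-divisor : ∀ k {x m} → p ∤ x → x ∣ p ^ k * m → x ∣ m
  prime-to-p-divisor zero    {x} {m} p∤x x∣ = subst (x ∣_) (ℕ.*-identityˡ m) x∣
  prime-to-p-divisor (suc k) {x} {m} p∤x (divides y eq)
    with euclidsLemma y x p-prime (subst (p ∣_) eq (∣m⇒∣m*n m (m∣m*n (p ^ k))))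
  ... | inj₂ p∣x = contradiction p∣x p∤x
  ... | inj₁ (divides y′ y≡) = prime-to-p-divisor k p∤x (divides y′ (ℕ.*-cancelˡ-≡ _ _ p (begin
      p * (p ^ k * m)      ≡⟨ ℕ.*-assoc p (p ^ k) m ⟨
      p ^ suc k * m        ≡⟨ eq ⟩
      y * x                ≡⟨ cong (_* x) y≡ ⟩
      y′ * p * x           ≡⟨ regroup y′ p x ⟩
      p * (y′ * x)         ∎)))
    where
    open ≡-Reasoning
    regroup : ∀ y p x → y * p * x ≡ p * (y * x)
    regroup = ℕ-Solver.solve-∀

  -- If an upper bound e for the exponent of p in x is not attained, a smaller bound also holds.
  lower-exponent : ∀ e x → p ^ e ∣ x ⊎ ∃ λ e′ → e′ < e × p ^ suc e′ ∤ x
  lower-exponent zero    x = inj₁ (1∣ x)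
  lower-exponent (suc e) x with p ^ suc e ∣? x
  ... | yes ∣x = inj₁ ∣x
  ... | no  ∤x = inj₂ (e , ℕ.≤-refl , ∤x)

-- Divisibility of convolutions

infix 4 _∣ℤ_

_∣ℤ_ : ℕ → ℤ → Set
q ∣ℤ x = q ∣ ∣ x ∣

∣ℤ-+ : ∀ {q} x y → q ∣ℤ x → q ∣ℤ y → q ∣ℤ x ℤ.+ y
∣ℤ-+ {q} x y q∣x q∣y =
  Signed.∣⇒∣ᵤ (Signed.∣m∣n⇒∣m+n (Signed.∣ᵤ⇒∣ {+ q} {x} q∣x) (Signed.∣ᵤ⇒∣ {+ q} {y} q∣y))

∣ℤ-+-cancelˡ : ∀ {q} x y → q ∣ℤ x ℤ.+ y → q ∣ℤ x → q ∣ℤ y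
∣ℤ-+-cancelˡ {q} x y q∣x+y q∣x =
  Signed.∣⇒∣ᵤ (Signed.∣m+n∣m⇒∣n {+ q} {x} (Signed.∣ᵤ⇒∣ {+ q} {x ℤ.+ y} q∣x+y) (Signed.∣ᵤ⇒∣ {+ q} {x} q∣x))

∣ℤ-+-cancelʳ : ∀ {q} x y → q ∣ℤ x ℤ.+ y → q ∣ℤ y → q ∣ℤ x
∣ℤ-+-cancelʳ {q} x y q∣x+y = ∣ℤ-+-cancelˡ y x (subst (q ∣ℤ_) (ℤ.+-comm x y) q∣x+y)

∣-convolution : ∀ {q} u v i → (∀ s t → s + t ≡ i → q ∣ℤ u s ℤ.* v t) → q ∣ℤ convolution u v i
∣-convolution u v zero    terms = terms 0 0 refl
∣-convolution u v (suc i) terms = ∣ℤ-+ (u 0 ℤ.* v (suc i)) _ (terms 0 (suc i) refl)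
  (∣-convolution (λ k → u (suc k)) v i (λ s t s+t≡i → terms (suc s) t (cong suc s+t≡i)))

∣-convolution-term : ∀ {q} u v s t → (∀ s′ t′ → s′ + t′ ≡ s + t → ¬ s′ ≡ s → q ∣ℤ u s′ ℤ.* v t′) →
  q ∣ℤ convolution u v (s + t) → q ∣ℤ u s ℤ.* v t
∣-convolution-term u v zero    zero    others ∣conv = ∣conv
∣-convolution-term u v zero    (suc t) others ∣conv =
  ∣ℤ-+-cancelʳ (u 0 ℤ.* v (suc t)) _ ∣conv
    (∣-convolution (λ k → u (suc k)) v t (λ s′ t′ s′+t′≡t → others (suc s′) t′ (cong suc s′+t′≡t) (λ ())))
∣-convolution-term u v (suc s) t       others ∣conv =
  ∣-convolution-term (λ k → u (suc k)) v s t
    (λ s′ t′ eq s′≢s → others (suc s′) t′ (cong suc eq) (λ e → s′≢s (ℕ.suc-injective e)))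
    (∣ℤ-+-cancelˡ (u 0 ℤ.* v (suc (s + t))) _ ∣conv (others 0 (suc (s + t)) refl (λ ())))

-- Newton polygon of a product: the monomial p^e z^i has weight ℓ e + k i.

module _ {p : ℕ} (p-prime : Prime p) (k ℓ : ℕ) (0<k : 0 < k) (0<ℓ : 0 < ℓ) where

  private
    instance
      k≢0 : ℕ.NonZero k
      k≢0 = ℕ.>-nonZero 0<k
      ℓ≢0 : ℕ.NonZero ℓ
      ℓ≢0 = ℕ.>-nonZero 0<ℓ

  weight : ℕ → ℕ → ℕ
  weight i e = ℓ * e + k * i

  weight-+ : ∀ i e i′ e′ → weight i e + weight i′ e′ ≡ ℓ * (e + e′) + k * (i + i′)
  weight-+ = λ i e i′ e′ → collect ℓ k i e i′ e′
    where
    collect : ∀ ℓ k i e i′ e′ → (ℓ * e + k * i) + (ℓ * e′ + k * i′) ≡ ℓ * (e + e′) + k * (i + i′)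
    collect = ℕ-Solver.solve-∀

  weight-monoʳ-< : ∀ i {e e′} → e < e′ → weight i e < weight i e′
  weight-monoʳ-< i e<e′ = ℕ.+-monoˡ-< (k * i) (ℕ.*-monoʳ-< ℓ e<e′)

  -- An upper bound e for the exponent of p in u i. Bounds in place of exact exponents spare a
  -- valuation of zero, since a zero coefficient satisfies none of them.
  Underdivisible : (ℕ → ℤ) → ℕ → ℕ → Set
  Underdivisible u i e = ¬ p ^ suc e ∣ℤ u i

  -- Among the underdivisible pairs of total weight below k ℓ, one minimal for the total weight and
  -- then for the total index would be the only term of its coefficient not divisible by p^(a+b+1).
  descent-step : ∀ (u v : ℕ → ℤ) → (∀ i → i < ℓ → p ^ k ∣ℤ convolution u v i) →
    ∀ s a t b → weight s a + weight t b < k * ℓ → Underdivisible u s a → Underdivisible v t b →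
    (∀ s′ a′ t′ b′ → weight s′ a′ + weight t′ b′ < weight s a + weight t b →
      Underdivisible u s′ a′ → Underdivisible v t′ b′ → ⊥) →
    (∀ s′ a′ t′ b′ → weight s′ a′ + weight t′ b′ ≤ weight s a + weight t b → s′ + t′ < s + t →
      Underdivisible u s′ a′ → Underdivisible v t′ b′ → ⊥) → ⊥
  descent-step u v low s a t b <kℓ ∤u ∤v lighter earlier
    with lower-exponent p-prime a ∣ u s ∣ | lower-exponent p-prime b ∣ v t ∣
  -- A bound that is not attained gives a lighter pair, so a and b may be taken to be the exact
  -- exponents.
  ... | inj₂ (a′ , a′<a , ∤u′) | _ =
    lighter s a′ t b (ℕ.+-monoˡ-< (weight t b) (weight-monoʳ-< s a′<a)) ∤u′ ∤v
  ... | inj₁ _ | inj₂ (b′ , b′<b , ∤v′) =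
    lighter s a t b′ (ℕ.+-monoʳ-< (weight s a) (weight-monoʳ-< t b′<b)) ∤u ∤v′
  ... | inj₁ ∣u | inj₁ ∣v =
    exact-product p-prime a b ∣u ∤u ∣v ∤v (subst (q ∣_) (ℤ.abs-* (u s) (v t))
      (∣-convolution-term u v s t others (∣-trans (m≤n⇒^∣^ E<k) (low (s + t) s+t<ℓ))))
    where
    q : ℕ
    q = p ^ suc (a + b)
    -- The point (s + t, a + b) lies strictly below the segment from (0, k) to (ℓ, 0). Hence s + t <
    -- ℓ, so `low` applies, and a + b < k, so q divides p^k.
    total< : ℓ * (a + b) + k * (s + t) < k * ℓ
    total< = subst (_< k * ℓ) (weight-+ s a t b) <kℓ
    E<k : a + b < k
    E<k = ℕ.*-cancelˡ-< ℓ _ _ (ℕ.≤-<-trans (ℕ.m≤m+n _ (k * (s + t))) (subst (ℓ * (a + b) + k * (s + t) <_) (ℕ.*-comm k ℓ) total<))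
    s+t<ℓ : s + t < ℓ
    s+t<ℓ = ℕ.*-cancelˡ-< k _ _ (ℕ.≤-<-trans (ℕ.m≤n+m _ (ℓ * (a + b))) total<)
    m≤n⇒^∣^ : ∀ {m n} → m ≤ n → p ^ m ∣ p ^ n
    m≤n⇒^∣^ {m} {n} m≤n = subst (λ x → p ^ m ∣ p ^ x) (ℕ.m+[n∸m]≡n m≤n)
      (subst (p ^ m ∣_) (sym (ℕ.^-distribˡ-+-* p m (n ℕ.∸ m))) (m∣m*n (p ^ (n ℕ.∸ m))))
    -- Another term not divisible by q yields bounds of the same total weight. Exchanging one member
    -- between the two pairs then gives either a lighter pair or one that is no heavier and has a
    -- smaller total index.
    others : ∀ s′ t′ → s′ + t′ ≡ s + t → ¬ s′ ≡ s → q ∣ℤ u s′ ℤ.* v t′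
    others s′ t′ eq s′≢s with q ∣? ∣ u s′ ℤ.* v t′ ∣
    ... | yes ∣uv = ∣uv
    ... | no  ∤uv with split-exponent p-prime (a + b) ∣ u s′ ∣ ∣ v t′ ∣ (subst (q ∤_) (ℤ.abs-* (u s′) (v t′)) ∤uv)
    ...   | a′ , b′ , a′+b′≡ , ∤u′ , ∤v′ = ⊥-elim (descend (ℕ.<-cmp s′ s))
      where
      same-weight : weight s′ a′ + weight t′ b′ ≡ weight s a + weight t b
      same-weight = begin
        weight s′ a′ + weight t′ b′              ≡⟨ weight-+ s′ a′ t′ b′ ⟩
        ℓ * (a′ + b′) + k * (s′ + t′)            ≡⟨ cong₂ (λ x y → ℓ * x + k * y) a′+b′≡ eq ⟩
        ℓ * (a + b) + k * (s + t)                ≡⟨ weight-+ s a t b ⟨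
        weight s a + weight t b                  ∎
        where open ≡-Reasoning
      lighter-second : weight s a < weight s′ a′ → weight t′ b′ < weight t b
      lighter-second h = ℕ.+-cancelˡ-< (weight s a) _ _
        (ℕ.<-≤-trans (ℕ.+-monoˡ-< (weight t′ b′) h) (ℕ.≤-reflexive same-weight))
      lighter-first : weight t b < weight t′ b′ → weight s′ a′ < weight s a
      lighter-first h = ℕ.+-cancelʳ-< (weight t b) _ _
        (ℕ.<-≤-trans (ℕ.+-monoʳ-< (weight s′ a′) h) (ℕ.≤-reflexive same-weight))
      descend : Tri (s′ < s) (s′ ≡ s) (s < s′) → ⊥
      descend (tri≈ _ s′≡s _) = s′≢s s′≡s
      descend (tri< s′<s _ _) with weight s′ a′ ℕ.≤? weight s a
      ... | yes ≤w = earlier s′ a′ t b (ℕ.+-monoˡ-≤ (weight t b) ≤w) (ℕ.+-monoˡ-< t s′<s) ∤u′ ∤v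
      ... | no  ≰w = lighter s a t′ b′ (ℕ.+-monoʳ-< (weight s a) (lighter-second (ℕ.≰⇒> ≰w))) ∤u ∤v′
      descend (tri> _ _ s<s′) with weight t′ b′ ℕ.≤? weight t b
      ... | yes ≤w = earlier s a t′ b′ (ℕ.+-monoʳ-≤ (weight s a) ≤w) (ℕ.+-monoʳ-< s t′<t) ∤u ∤v′
        where
        t′<t : t′ < t
        t′<t = ℕ.+-cancelˡ-< s t′ t (ℕ.<-≤-trans (ℕ.+-monoˡ-< t′ s<s′) (ℕ.≤-reflexive eq))
      ... | no  ≰w = lighter s′ a′ t b (ℕ.+-monoˡ-< (weight t b) (lighter-first (ℕ.≰⇒> ≰w))) ∤u′ ∤v

  -- Lexicographic induction: W and I strictly bound the total weight and the total index, and I is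
  -- reset whenever the weight drops.
  descent : ∀ (u v : ℕ → ℤ) → (∀ i → i < ℓ → p ^ k ∣ℤ convolution u v i) →
    ∀ W I s a t b → weight s a + weight t b < W → s + t < I → weight s a + weight t b < k * ℓ →
    Underdivisible u s a → Underdivisible v t b → ⊥
  descent u v low (suc W) (suc I) s a t b <W <I <kℓ ∤u ∤v = descent-step u v low s a t b <kℓ ∤u ∤v
    (λ s′ a′ t′ b′ lighter → descent u v low W (suc (s′ + t′)) s′ a′ t′ b′
      (ℕ.<-≤-trans lighter (ℕ.s≤s⁻¹ <W)) ℕ.≤-refl (ℕ.<-trans lighter <kℓ))
    (λ s′ a′ t′ b′ ≤w earlier → descent u v low (suc W) I s′ a′ t′ b′
      (ℕ.≤-<-trans ≤w <W) (ℕ.<-≤-trans earlier (ℕ.s≤s⁻¹ <I)) (ℕ.≤-<-trans ≤w <kℓ))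

  -- The least weights of two factors add up to at least the weight of the segment on or above which
  -- the low coefficients of the product lie.
  weights-bound : ∀ (u v : ℕ → ℤ) → (∀ i → i < ℓ → p ^ k ∣ℤ convolution u v i) →
    ∀ s a t b → Underdivisible u s a → Underdivisible v t b → k * ℓ ≤ weight s a + weight t b
  weights-bound u v low s a t b ∤u ∤v = ℕ.≮⇒≥ (λ <kℓ →
    descent u v low _ _ s a t b ℕ.≤-refl ℕ.≤-refl <kℓ ∤u ∤v)

  -- For k = 1 the product u 0 v 0 would be divisible by p². For k > 1, split k = a + b between u 0
  -- and v 0. A term u s v t with s + t = ℓ that is prime to p satisfies two weight bounds whose sum
  -- is an equality, so both are equalities and ℓ a + k t = k ℓ. Coprimality gives ℓ ∣ t, so the
  -- term sits at an end, where p divides u 0 or v 0. Thus p divides every term of coefficient ℓ,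
  -- contrary to `∤top`.
  not-both-divisible : ∀ (u v : ℕ → ℤ) → gcd k ℓ ≡ 1 → (∀ i → i < ℓ → p ^ k ∣ℤ convolution u v i) →
    ¬ p ^ suc k ∣ℤ u 0 ℤ.* v 0 → (1 < k → ¬ p ∣ℤ convolution u v ℓ) → p ∣ℤ u 0 → p ∣ℤ v 0 → ⊥
  not-both-divisible u v coprime low ∤u₀v₀ ∤top p∣u₀ p∣v₀ = case (ℕ.m≤n⇒m<n∨m≡n 0<k)
    where
    ∤∣u₀∣∣v₀∣ : p ^ suc k ∤ ∣ u 0 ∣ * ∣ v 0 ∣
    ∤∣u₀∣∣v₀∣ = subst (p ^ suc k ∤_) (ℤ.abs-* (u 0) (v 0)) ∤u₀v₀
    p^1∤ : ∀ {x} → p ∤ x → p ^ 1 ∤ x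
    p^1∤ {x} p∤x p^1∣x = p∤x (subst (_∣ x) (ℕ.*-identityʳ p) p^1∣x)
    case : 1 < k ⊎ 1 ≡ k → ⊥
    case (inj₂ refl) = ∤∣u₀∣∣v₀∣ (subst (_∣ ∣ u 0 ∣ * ∣ v 0 ∣) (cong (p *_) (sym (ℕ.*-identityʳ p))) (*-pres-∣ p∣u₀ p∣v₀))
    case (inj₁ 1<k) with split-exponent p-prime k ∣ u 0 ∣ ∣ v 0 ∣ ∤∣u₀∣∣v₀∣
    ... | a , b , a+b≡k , ∤u₀ , ∤v₀ = ∤top 1<k (∣-convolution u v ℓ term)
      where
      on-line : ∀ s t → s + t ≡ ℓ → p ∤ ∣ u s ∣ → p ∤ ∣ v t ∣ → ℓ * a + k * t ≡ k * ℓ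
      on-line s t s+t≡ℓ ∤us ∤vt = ℕ.≤-antisym (ℕ.+-cancelʳ-≤ (ℓ * b + k * s) _ _ (begin
          (ℓ * a + k * t) + (ℓ * b + k * s)     ≡⟨ regroup ℓ k a b s t ⟩
          ℓ * (a + b) + k * (s + t)             ≡⟨ cong₂ (λ x y → ℓ * x + k * y) a+b≡k s+t≡ℓ ⟩
          ℓ * k + k * ℓ                         ≡⟨ cong (_+ k * ℓ) (ℕ.*-comm ℓ k) ⟩
          k * ℓ + k * ℓ                         ≤⟨ ℕ.+-monoʳ-≤ (k * ℓ) (subst (k * ℓ ≤_) (second ℓ k b s) (weights-bound u v low s 0 0 b (p^1∤ ∤us) ∤v₀)) ⟩
          k * ℓ + (ℓ * b + k * s)               ∎))
        (subst (k * ℓ ≤_) (first ℓ k a t) (weights-bound u v low 0 a t 0 ∤u₀ (p^1∤ ∤vt)))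
        where
        open ℕ.≤-Reasoning
        regroup : ∀ ℓ k a b s t → (ℓ * a + k * t) + (ℓ * b + k * s) ≡ ℓ * (a + b) + k * (s + t)
        regroup = ℕ-Solver.solve-∀
        first : ∀ ℓ k a t → (ℓ * a + k * 0) + (ℓ * 0 + k * t) ≡ ℓ * a + k * t
        first = ℕ-Solver.solve-∀
        second : ∀ ℓ k b s → (ℓ * 0 + k * s) + (ℓ * b + k * 0) ≡ ℓ * b + k * s
        second = ℕ-Solver.solve-∀
      endpoint : ∀ s t → s + t ≡ ℓ → p ∤ ∣ u s ∣ → p ∤ ∣ v t ∣ → ⊥
      -- The two ends of the segment are excluded by p dividing u 0 and v 0; in between, 0 < t < ℓ
      -- contradicts ℓ ∣ t.
      endpoint s       zero    s+t≡ℓ ∤us ∤vt = ∤vt p∣v₀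
      endpoint zero    (suc t) s+t≡ℓ ∤us ∤vt = ∤us p∣u₀
      endpoint (suc s) (suc t) s+t≡ℓ ∤us ∤vt = ℕ.<⇒≱ t<ℓ (∣⇒≤ (coprime-divisor
          (Coprimality.sym (gcd≡1⇒coprime {k} {ℓ} coprime))
          (∣m+n∣m⇒∣n (divides k (on-line (suc s) (suc t) s+t≡ℓ ∤us ∤vt)) (m∣m*n a))))
        where
        t<ℓ : suc t < ℓ
        t<ℓ = subst (suc t <_) s+t≡ℓ (ℕ.s≤s (ℕ.m≤n+m (suc t) s))
      term : ∀ s t → s + t ≡ ℓ → p ∣ℤ u s ℤ.* v t
      term s t s+t≡ℓ with p ∣? ∣ u s ∣ | p ∣? ∣ v t ∣
      ... | yes ∣us | _       = subst (p ∣_) (sym (ℤ.abs-* (u s) (v t))) (∣m⇒∣m*n ∣ v t ∣ ∣us)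
      ... | no  _   | yes ∣vt = subst (p ∣_) (sym (ℤ.abs-* (u s) (v t))) (∣n⇒∣m*n ∣ u s ∣ ∣vt)
      ... | no  ∤us | no  ∤vt = ⊥-elim (endpoint s t s+t≡ℓ ∤us ∤vt)

-- From real to natural numbers

ℚ-almostCommutativeRing : AlmostCommutativeRing 0ℓ 0ℓ
ℚ-almostCommutativeRing = fromCommutativeRing ℚ.+-*-commutativeRing (λ q → dec⇒maybe (0ℚ ℚ.≟ q))

ι : ℕ → ℚ
ι n = + n ℚ./ 1

toℚᵘ-ι : ∀ n → ℚ.toℚᵘ (ι n) ℚᵘ.≃ ℚᵘ.mkℚᵘ (+ n) 0
toℚᵘ-ι n = ℚ.toℚᵘ-fromℚᵘ (ℚᵘ.mkℚᵘ (+ n) 0)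

0≤ι : ∀ n → 0ℚ ℚ.≤ ι n
0≤ι n = ℚ.nonNegative⁻¹ (ι n) {{ℚ.normalize-nonNeg n 1}}

0<ι : ∀ {n} → 0 < n → 0ℚ ℚ.< ι n
0<ι {n} 0<n = ℚ.positive⁻¹ (ι n) {{ℚ.normalize-pos n 1 {{_}} {{ℕ.>-nonZero 0<n}}}}

ι-+ : ∀ m n → ι (m + n) ≡ ι m ℚ.+ ι n
ι-+ m n = ℚ.toℚᵘ-injective (begin
  ℚ.toℚᵘ (ι (m + n))                              ≈⟨ toℚᵘ-ι (m + n) ⟩
  ℚᵘ.mkℚᵘ (+ (m + n)) 0                           ≈⟨ ℚᵘ.*≡* (cong (ℤ._* 1ℤ) numerators) ⟩
  ℚᵘ.mkℚᵘ (+ m) 0 ℚᵘ.+ ℚᵘ.mkℚᵘ (+ n) 0            ≈⟨ ℚᵘ.+-cong (toℚᵘ-ι m) (toℚᵘ-ι n) ⟨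
  ℚ.toℚᵘ (ι m) ℚᵘ.+ ℚ.toℚᵘ (ι n)                  ≈⟨ ℚ.toℚᵘ-homo-+ (ι m) (ι n) ⟨
  ℚ.toℚᵘ (ι m ℚ.+ ι n)                            ∎)
  where
  open import Relation.Binary.Reasoning.Setoid ℚᵘ.≃-setoid
  numerators : + (m + n) ≡ + m ℤ.* 1ℤ ℤ.+ + n ℤ.* 1ℤ
  numerators = trans (ℤ.pos-+ m n) (sym (cong₂ ℤ._+_ (ℤ.*-identityʳ (+ m)) (ℤ.*-identityʳ (+ n))))

ι-* : ∀ m n → ι (m * n) ≡ ι m ℚ.* ι n
ι-* m n = ℚ.toℚᵘ-injective (begin
  ℚ.toℚᵘ (ι (m * n))                              ≈⟨ toℚᵘ-ι (m * n) ⟩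
  ℚᵘ.mkℚᵘ (+ (m * n)) 0                           ≈⟨ ℚᵘ.*≡* (cong (ℤ._* 1ℤ) (ℤ.pos-* m n)) ⟩
  ℚᵘ.mkℚᵘ (+ m) 0 ℚᵘ.* ℚᵘ.mkℚᵘ (+ n) 0            ≈⟨ ℚᵘ.*-cong (toℚᵘ-ι m) (toℚᵘ-ι n) ⟨
  ℚ.toℚᵘ (ι m) ℚᵘ.* ℚ.toℚᵘ (ι n)                  ≈⟨ ℚ.toℚᵘ-homo-* (ι m) (ι n) ⟨
  ℚ.toℚᵘ (ι m ℚ.* ι n)                            ∎)
  where open import Relation.Binary.Reasoning.Setoid ℚᵘ.≃-setoid

ι-cancel-< : ∀ m n → ι m ℚ.< ι n → m < n
ι-cancel-< m n ιm<ιn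
  with ℚᵘ.<-respˡ-≃ (toℚᵘ-ι m) (ℚᵘ.<-respʳ-≃ (toℚᵘ-ι n) (ℚ.toℚᵘ-mono-< ιm<ιn))
... | ℚᵘ.*<* m<n =
  ℤ.drop‿+<+ (subst₂ ℤ._<_ (ℤ.*-identityʳ (+ m)) (ℤ.*-identityʳ (+ n)) m<n)

*-monoˡ-≤ : ∀ {r p q} → 0ℚ ℚ.≤ r → p ℚ.≤ q → r ℚ.* p ℚ.≤ r ℚ.* q
*-monoˡ-≤ {r} 0≤r = ℚ.*-monoˡ-≤-nonNeg r {{ℚ.nonNegative 0≤r}}

*-monoʳ-≤ : ∀ {r p q} → 0ℚ ℚ.≤ r → p ℚ.≤ q → p ℚ.* r ℚ.≤ q ℚ.* r
*-monoʳ-≤ {r} 0≤r = ℚ.*-monoʳ-≤-nonNeg r {{ℚ.nonNegative 0≤r}}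

*-nonNeg : ∀ {p q} → 0ℚ ℚ.≤ p → 0ℚ ℚ.≤ q → 0ℚ ℚ.≤ p ℚ.* q
*-nonNeg {p} 0≤p 0≤q = subst (ℚ._≤ p ℚ.* _) (ℚ.*-zeroʳ p) (*-monoˡ-≤ 0≤p 0≤q)

p≤p+q : ∀ p {q} → 0ℚ ℚ.≤ q → p ℚ.≤ p ℚ.+ q
p≤p+q p 0≤q = subst (ℚ._≤ p ℚ.+ _) (ℚ.+-identityʳ p) (ℚ.+-monoʳ-≤ p 0≤q)

+-cancelʳ-< : ∀ r {p q} → p ℚ.+ r ℚ.< q ℚ.+ r → p ℚ.< q
+-cancelʳ-< r {p} {q} h = subst₂ ℚ._<_ (cancel p r) (cancel q r) (ℚ.+-monoˡ-< (ℚ.- r) h)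
  where
  cancel : ∀ p r → p ℚ.+ r ℚ.+ ℚ.- r ≡ p
  cancel = solve-∀ ℚ-almostCommutativeRing

-- Lipschitz estimates for powers and weighted sums

infixr 8 _^ℚ_

_^ℚ_ : ℚ → ℕ → ℚ
q ^ℚ zero  = 1ℚ
q ^ℚ suc i = q ℚ.* q ^ℚ i

ι-^ : ∀ m i → ι (m ^ i) ≡ ι m ^ℚ i
ι-^ m zero    = refl
ι-^ m (suc i) = trans (ι-* m (m ^ i)) (cong (ι m ℚ.*_) (ι-^ m i))

seq-^ : ∀ x i t → seq (x ^ᵣ i) t ≡ seq x t ^ℚ i
seq-^ x zero    t = refl
seq-^ x (suc i) t = cong (seq x t ℚ.*_) (seq-^ x i t)

^ℚ-nonNeg : ∀ {q} → 0ℚ ℚ.≤ q → ∀ i → 0ℚ ℚ.≤ q ^ℚ i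
^ℚ-nonNeg 0≤q zero    = ℚ.nonNegative⁻¹ 1ℚ
^ℚ-nonNeg 0≤q (suc i) = *-nonNeg 0≤q (^ℚ-nonNeg 0≤q i)

^ℚ-mono-≤ : ∀ {p q} → 0ℚ ℚ.≤ p → p ℚ.≤ q → ∀ i → p ^ℚ i ℚ.≤ q ^ℚ i
^ℚ-mono-≤ 0≤p p≤q zero    = ℚ.≤-refl
^ℚ-mono-≤ 0≤p p≤q (suc i) = ℚ.≤-trans (*-monoˡ-≤ 0≤p (^ℚ-mono-≤ 0≤p p≤q i))
  (*-monoʳ-≤ (^ℚ-nonNeg (ℚ.≤-trans 0≤p p≤q) i) p≤q)

-- A Lipschitz constant for the i-th power on [0, M].
powerSlope : ℚ → ℕ → ℚ
powerSlope M zero    = 0ℚ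
powerSlope M (suc i) = M ^ℚ i ℚ.+ M ℚ.* powerSlope M i

powerSlope-nonNeg : ∀ {M} → 0ℚ ℚ.≤ M → ∀ i → 0ℚ ℚ.≤ powerSlope M i
powerSlope-nonNeg 0≤M zero    = ℚ.≤-refl
powerSlope-nonNeg 0≤M (suc i) = ℚ.≤-trans (^ℚ-nonNeg 0≤M i)
  (p≤p+q _ (*-nonNeg 0≤M (powerSlope-nonNeg 0≤M i)))

-- Only an upper estimate of x is assumed. If x ≤ y, monotonicity suffices; otherwise y ≤ x ≤ M, so
-- M bounds both bases and the product rule goes through by induction.
^ℚ-close : ∀ {x y M δ} → 0ℚ ℚ.≤ x → 0ℚ ℚ.≤ y → 0ℚ ℚ.≤ δ → x ℚ.≤ M → x ℚ.≤ y ℚ.+ δ →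
  ∀ i → x ^ℚ i ℚ.≤ y ^ℚ i ℚ.+ powerSlope M i ℚ.* δ
^ℚ-close {x} {y} {M} {δ} 0≤x 0≤y 0≤δ x≤M x≤y+δ i with ℚ.≤-total x y
... | inj₁ x≤y = ℚ.≤-trans (^ℚ-mono-≤ 0≤x x≤y i)
  (p≤p+q (y ^ℚ i) (*-nonNeg (powerSlope-nonNeg (ℚ.≤-trans 0≤x x≤M) i) 0≤δ))
... | inj₂ y≤x = go i
  where
  open ℚ.≤-Reasoning
  0≤M : 0ℚ ℚ.≤ M
  0≤M = ℚ.≤-trans 0≤x x≤M
  expand : ∀ x p s → x ℚ.* (p ℚ.+ s) ≡ x ℚ.* p ℚ.+ x ℚ.* s
  expand = solve-∀ ℚ-almostCommutativeRing
  regroup : ∀ y δ p M s → (y ℚ.+ δ) ℚ.* p ℚ.+ M ℚ.* (s ℚ.* δ) ≡ (y ℚ.* p ℚ.+ M ℚ.* s ℚ.* δ) ℚ.+ p ℚ.* δ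
  regroup = solve-∀ ℚ-almostCommutativeRing
  collect : ∀ p q s δ → (p ℚ.+ s ℚ.* δ) ℚ.+ q ℚ.* δ ≡ p ℚ.+ (q ℚ.+ s) ℚ.* δ
  collect = solve-∀ ℚ-almostCommutativeRing
  go : ∀ i → x ^ℚ i ℚ.≤ y ^ℚ i ℚ.+ powerSlope M i ℚ.* δ
  go zero    = p≤p+q 1ℚ (*-nonNeg (powerSlope-nonNeg 0≤M 0) 0≤δ)
  go (suc i) = begin
    x ℚ.* x ^ℚ i
      ≤⟨ *-monoˡ-≤ 0≤x (go i) ⟩
    x ℚ.* (y ^ℚ i ℚ.+ s ℚ.* δ)
      ≡⟨ expand x (y ^ℚ i) (s ℚ.* δ) ⟩
    x ℚ.* y ^ℚ i ℚ.+ x ℚ.* (s ℚ.* δ)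
      ≤⟨ ℚ.+-mono-≤ (*-monoʳ-≤ (^ℚ-nonNeg 0≤y i) x≤y+δ) (*-monoʳ-≤ (*-nonNeg (powerSlope-nonNeg 0≤M i) 0≤δ) x≤M) ⟩
    (y ℚ.+ δ) ℚ.* y ^ℚ i ℚ.+ M ℚ.* (s ℚ.* δ)
      ≡⟨ regroup y δ (y ^ℚ i) M s ⟩
    (y ℚ.* y ^ℚ i ℚ.+ M ℚ.* s ℚ.* δ) ℚ.+ y ^ℚ i ℚ.* δ
      ≤⟨ ℚ.+-monoʳ-≤ (y ℚ.* y ^ℚ i ℚ.+ M ℚ.* s ℚ.* δ) (*-monoʳ-≤ 0≤δ (^ℚ-mono-≤ 0≤y (ℚ.≤-trans y≤x x≤M) i)) ⟩
    (y ℚ.* y ^ℚ i ℚ.+ M ℚ.* s ℚ.* δ) ℚ.+ M ^ℚ i ℚ.* δ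
      ≡⟨ collect (y ℚ.* y ^ℚ i) (M ^ℚ i) (M ℚ.* s) δ ⟩
    y ℚ.* y ^ℚ i ℚ.+ (M ^ℚ i ℚ.+ M ℚ.* s) ℚ.* δ ∎
    where
    s : ℚ
    s = powerSlope M i

-- General weights let one sum serve both for the values Σ |aᵢ| yⁱ and for their Lipschitz
-- constants.
weightedSum : (ℕ → ℚ) → ℤ[z] → ℚ
weightedSum w []      = 0ℚ
weightedSum w (a ∷ f) = ι ∣ a ∣ ℚ.* w 0 ℚ.+ weightedSum (λ i → w (suc i)) f

weightedSum-nonNeg : ∀ {w} → (∀ i → 0ℚ ℚ.≤ w i) → ∀ f → 0ℚ ℚ.≤ weightedSum w f
weightedSum-nonNeg 0≤w []      = ℚ.≤-refl
weightedSum-nonNeg 0≤w (a ∷ f) = ℚ.+-mono-≤ (*-nonNeg (0≤ι ∣ a ∣) (0≤w 0)) (weightedSum-nonNeg (λ i → 0≤w (suc i)) f)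

weightedSum-close : ∀ {w w′ c δ} → (∀ i → w i ℚ.≤ w′ i ℚ.+ c i ℚ.* δ) →
  ∀ f → weightedSum w f ℚ.≤ weightedSum w′ f ℚ.+ weightedSum c f ℚ.* δ
weightedSum-close {δ = δ} close []      = ℚ.≤-reflexive (sym (trans (ℚ.+-identityˡ (0ℚ ℚ.* δ)) (ℚ.*-zeroˡ δ)))
weightedSum-close {w} {w′} {c} {δ} close (a ∷ f) = begin
  ι ∣ a ∣ ℚ.* w 0 ℚ.+ weightedSum (λ i → w (suc i)) f
    ≤⟨ ℚ.+-mono-≤ (*-monoˡ-≤ (0≤ι ∣ a ∣) (close 0)) (weightedSum-close (λ i → close (suc i)) f) ⟩
  ι ∣ a ∣ ℚ.* (w′ 0 ℚ.+ c 0 ℚ.* δ) ℚ.+ (S′ ℚ.+ S ℚ.* δ)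
    ≡⟨ collect (ι ∣ a ∣) (w′ 0) (c 0) δ S′ S ⟩
  (ι ∣ a ∣ ℚ.* w′ 0 ℚ.+ S′) ℚ.+ (ι ∣ a ∣ ℚ.* c 0 ℚ.+ S) ℚ.* δ ∎
  where
  open ℚ.≤-Reasoning
  S S′ : ℚ
  S  = weightedSum (λ i → c (suc i)) f
  S′ = weightedSum (λ i → w′ (suc i)) f
  collect : ∀ a w c δ s′ s → a ℚ.* (w ℚ.+ c ℚ.* δ) ℚ.+ (s′ ℚ.+ s ℚ.* δ)
    ≡ (a ℚ.* w ℚ.+ s′) ℚ.+ (a ℚ.* c ℚ.+ s) ℚ.* δ
  collect = solve-∀ ℚ-almostCommutativeRing

weightedSum-scale : ∀ c w f → weightedSum (λ i → c ℚ.* w i) f ≡ c ℚ.* weightedSum w f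
weightedSum-scale c w []      = sym (ℚ.*-zeroʳ c)
weightedSum-scale c w (a ∷ f) = trans (cong (ι ∣ a ∣ ℚ.* (c ℚ.* w 0) ℚ.+_) (weightedSum-scale c (λ i → w (suc i)) f))
  (factor (ι ∣ a ∣) c (w 0) (weightedSum (λ i → w (suc i)) f))
  where
  factor : ∀ a c w s → a ℚ.* (c ℚ.* w) ℚ.+ c ℚ.* s ≡ c ℚ.* (a ℚ.* w ℚ.+ s)
  factor = solve-∀ ℚ-almostCommutativeRing

ι-majorant : ∀ B f → ι (majorant B f) ≡ weightedSum (ι B ^ℚ_) f
ι-majorant B []      = refl
ι-majorant B (a ∷ f) = begin
  ι (∣ a ∣ + B * majorant B f)                          ≡⟨ ι-+ ∣ a ∣ (B * majorant B f) ⟩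
  ι ∣ a ∣ ℚ.+ ι (B * majorant B f)                      ≡⟨ cong₂ ℚ._+_ (sym (ℚ.*-identityʳ (ι ∣ a ∣))) (ι-* B (majorant B f)) ⟩
  ι ∣ a ∣ ℚ.* 1ℚ ℚ.+ ι B ℚ.* ι (majorant B f)           ≡⟨ cong (λ s → ι ∣ a ∣ ℚ.* 1ℚ ℚ.+ ι B ℚ.* s) (ι-majorant B f) ⟩
  ι ∣ a ∣ ℚ.* 1ℚ ℚ.+ ι B ℚ.* weightedSum (ι B ^ℚ_) f    ≡⟨ cong (ι ∣ a ∣ ℚ.* 1ℚ ℚ.+_) (weightedSum-scale (ι B) (ι B ^ℚ_) f) ⟨
  weightedSum (ι B ^ℚ_) (a ∷ f)                         ∎
  where open ≡-Reasoning

seq-sum : ∀ {n} (x : Vector ℝ n) (a : Vector ℤ n) w t → (∀ i → seq (x i) t ≡ ι ∣ a i ∣ ℚ.* w (toℕ i)) →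
  seq (sumᵣ x) t ≡ weightedSum w (toList a)
seq-sum {zero}  x a w t e = refl
seq-sum {suc n} x a w t e = cong₂ ℚ._+_ (e Fin.zero)
  (seq-sum (λ i → x (Fin.suc i)) (λ i → a (Fin.suc i)) (λ i → w (suc i)) t (λ i → e (Fin.suc i)))

-- Deleting a summand of the real sum corresponds to zeroing a coefficient: the weight at j is
-- multiplied by 0 and all other indices stay put.
seq-sum-removeAt : ∀ {n} (x : Vector ℝ (suc n)) (a : Vector ℤ (suc n)) w j t →
  (∀ i → seq (x i) t ≡ ι ∣ a i ∣ ℚ.* w (toℕ i)) →
  seq (sumᵣ (removeAt x j)) t ≡ weightedSum w (zeroAt (toℕ j) (toList a))
seq-sum-removeAt x a w Fin.zero t e = begin
  seq (sumᵣ (removeAt x Fin.zero)) t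
    ≡⟨ seq-sum (removeAt x Fin.zero) (λ i → a (Fin.suc i)) (λ i → w (suc i)) t (λ i → e (Fin.suc i)) ⟩
  S
    ≡⟨ ℚ.+-identityˡ S ⟨
  0ℚ ℚ.+ S
    ≡⟨ cong (ℚ._+ S) (ℚ.*-zeroˡ (w 0)) ⟨
  ι 0 ℚ.* w 0 ℚ.+ S ∎
  where
  open ≡-Reasoning
  S : ℚ
  S = weightedSum (λ i → w (suc i)) (toList (λ i → a (Fin.suc i)))
seq-sum-removeAt {suc n} x a w (Fin.suc j) t e = cong₂ ℚ._+_ (e Fin.zero)
  (seq-sum-removeAt (λ i → x (Fin.suc i)) (λ i → a (Fin.suc i)) (λ i → w (suc i)) j t (λ i → e (Fin.suc i)))

seq-scale : ∀ c x q t → seq x t ≡ q → seq (fromℕ c *ᵣ x) t ≡ ι c ℚ.* q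
seq-scale c x q t e = cong (ι c ℚ.*_) e

coeff-toList : ∀ {n} (a : Vector ℤ n) j → coeff (toList a) (toℕ j) ≡ a j
coeff-toList a Fin.zero    = refl
coeff-toList a (Fin.suc j) = coeff-toList (λ i → a (Fin.suc i)) j

small-multiple : ∀ c ε → 0ℚ ℚ.≤ c → 0ℚ ℚ.< ε → ∃ λ δ → 0ℚ ℚ.< δ × c ℚ.* δ ℚ.≤ ε
small-multiple c ε 0≤c 0<ε = δ , 0<δ , (begin
  c ℚ.* δ                     ≤⟨ *-monoʳ-≤ (ℚ.<⇒≤ 0<δ) c≤D ⟩
  D ℚ.* (D⁻¹ ℚ.* ε)           ≡⟨ ℚ.*-assoc D D⁻¹ ε ⟨
  (D ℚ.* D⁻¹) ℚ.* ε           ≡⟨ cong (ℚ._* ε) (ℚ.*-inverseʳ D {{D≢0}}) ⟩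
  1ℚ ℚ.* ε                    ≡⟨ ℚ.*-identityˡ ε ⟩
  ε                           ∎)
  where
  open ℚ.≤-Reasoning
  D : ℚ
  -- Dividing by 1 + c also covers c = 0.
  D = 1ℚ ℚ.+ c
  D>0 : ℚ.Positive D
  D>0 = ℚ.positive (ℚ.+-mono-<-≤ (ℚ.positive⁻¹ 1ℚ) 0≤c)
  D≢0 : ℚ.NonZero D
  D≢0 = ℚ.pos⇒nonZero D {{D>0}}
  D⁻¹ δ : ℚ
  D⁻¹ = ℚ.1/_ D {{D≢0}}
  δ   = D⁻¹ ℚ.* ε
  0<δ : 0ℚ ℚ.< δ
  0<δ = ℚ.positive⁻¹ δ {{ℚ.pos*pos⇒pos D⁻¹ {{ℚ.1/pos⇒pos D {{D>0}}}} ε {{ℚ.positive 0<ε}}}}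
  c≤D : c ℚ.≤ D
  c≤D = subst (ℚ._≤ D) (ℚ.+-identityˡ c) (ℚ.+-monoˡ-≤ c (ℚ.nonNegative⁻¹ 1ℚ))

-- The total cost per unit of δ of replacing β by B in the sum and α by A in the dominant term.
dominanceSlope : ℤ[z] → ℕ → ℕ → ℕ → ℕ → ℚ
dominanceSlope g c j A B = weightedSum (powerSlope (ι B)) g ℚ.+ ι c ℚ.* powerSlope (ι A ℚ.+ 1ℚ) j

dominanceSlope-nonNeg : ∀ g c j A B → 0ℚ ℚ.≤ dominanceSlope g c j A B
dominanceSlope-nonNeg g c j A B = ℚ.+-mono-≤ (weightedSum-nonNeg (powerSlope-nonNeg (0≤ι B)) g)
  (*-nonNeg (0≤ι c) (powerSlope-nonNeg (ℚ.+-mono-≤ (0≤ι A) (ℚ.nonNegative⁻¹ 1ℚ)) j))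

-- Both replacements together cost the slope times δ, which the slack ε absorbs while the inequality
-- stays strict. The bound by A + 1 is an a priori range for x, so that the Lipschitz constant does
-- not depend on δ.
approximate-dominance : ∀ g c j A B {x y δ ε} → 0ℚ ℚ.≤ x → 0ℚ ℚ.≤ y → 0ℚ ℚ.≤ δ →
  x ℚ.≤ ι A ℚ.+ 1ℚ → x ℚ.≤ ι A ℚ.+ δ → ι B ℚ.≤ y ℚ.+ δ → dominanceSlope g c j A B ℚ.* δ ℚ.≤ ε →
  weightedSum (y ^ℚ_) g ℚ.+ ε ℚ.< ι c ℚ.* x ^ℚ j → majorant B g < c * A ^ j
approximate-dominance g c j A B {x} {y} {δ} {ε} 0≤x 0≤y 0≤δ x≤A+1 x≤A+δ B≤y+δ slope≤ε dominates =
  ι-cancel-< (majorant B g) (c * A ^ j) (+-cancelʳ-< ε (begin-strict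
    ι (majorant B g) ℚ.+ ε
      ≡⟨ cong (ℚ._+ ε) (ι-majorant B g) ⟩
    weightedSum (ι B ^ℚ_) g ℚ.+ ε
      ≤⟨ ℚ.+-monoˡ-≤ ε (weightedSum-close (^ℚ-close (0≤ι B) 0≤y 0≤δ ℚ.≤-refl B≤y+δ) g) ⟩
    (weightedSum (y ^ℚ_) g ℚ.+ s ℚ.* δ) ℚ.+ ε
      ≡⟨ swap (weightedSum (y ^ℚ_) g) (s ℚ.* δ) ε ⟩
    (weightedSum (y ^ℚ_) g ℚ.+ ε) ℚ.+ s ℚ.* δ
      <⟨ ℚ.+-monoˡ-< (s ℚ.* δ) dominates ⟩
    ι c ℚ.* x ^ℚ j ℚ.+ s ℚ.* δ
      ≤⟨ ℚ.+-monoˡ-≤ (s ℚ.* δ) (*-monoˡ-≤ (0≤ι c) (^ℚ-close 0≤x (0≤ι A) 0≤δ x≤A+1 x≤A+δ j)) ⟩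
    ι c ℚ.* (ι A ^ℚ j ℚ.+ s′ ℚ.* δ) ℚ.+ s ℚ.* δ
      ≡⟨ collect (ι c) (ι A ^ℚ j) s′ δ s ⟩
    ι c ℚ.* ι A ^ℚ j ℚ.+ (s ℚ.+ ι c ℚ.* s′) ℚ.* δ
      ≤⟨ ℚ.+-monoʳ-≤ (ι c ℚ.* ι A ^ℚ j) slope≤ε ⟩
    ι c ℚ.* ι A ^ℚ j ℚ.+ ε
      ≡⟨ cong (ℚ._+ ε) (trans (ι-* c (A ^ j)) (cong (ι c ℚ.*_) (ι-^ A j))) ⟨
    ι (c * A ^ j) ℚ.+ ε ∎))
  where
  open ℚ.≤-Reasoning
  s s′ : ℚ
  s  = weightedSum (powerSlope (ι B)) g
  s′ = powerSlope (ι A ℚ.+ 1ℚ) j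
  swap : ∀ a b c → a ℚ.+ b ℚ.+ c ≡ a ℚ.+ c ℚ.+ b
  swap = solve-∀ ℚ-almostCommutativeRing
  collect : ∀ a p s δ c → a ℚ.* (p ℚ.+ s ℚ.* δ) ℚ.+ c ℚ.* δ ≡ a ℚ.* p ℚ.+ (c ℚ.+ a ℚ.* s) ℚ.* δ
  collect = solve-∀ ℚ-almostCommutativeRing

-- Passage to the limit along α and β

Eventually : (ℕ → Set) → Set
Eventually P = ∃ λ N → ∀ t → N ≤ t → P t

limit-dominance : ∀ g c j A B (x y : ℕ → ℚ) →
  Eventually (λ t → 0ℚ ℚ.≤ x t) → Eventually (λ t → 0ℚ ℚ.≤ y t) →
  (∀ δ → 0ℚ ℚ.< δ → Eventually (λ t → x t ℚ.≤ ι A ℚ.+ δ)) →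
  (∀ δ → 0ℚ ℚ.< δ → Eventually (λ t → ι B ℚ.≤ y t ℚ.+ δ)) →
  ∀ ε → 0ℚ ℚ.< ε → Eventually (λ t → weightedSum (y t ^ℚ_) g ℚ.+ ε ℚ.< ι c ℚ.* x t ^ℚ j) →
  majorant B g < c * A ^ j
limit-dominance g c j A B x y (N₁ , 0≤x) (N₂ , 0≤y) x≤A y≥B ε 0<ε (N₃ , dominates) =
  conclude (small-multiple (dominanceSlope g c j A B) ε (dominanceSlope-nonNeg g c j A B) 0<ε)
  where
  conclude : (∃ λ δ → 0ℚ ℚ.< δ × dominanceSlope g c j A B ℚ.* δ ℚ.≤ ε) → majorant B g < c * A ^ j
  -- The upper estimate of x is used twice: with tolerance 1 for the a priori range, and with δ for
  -- the approximation.
  conclude (δ , 0<δ , slope≤ε) = at-late-time (x≤A 1ℚ (ℚ.positive⁻¹ 1ℚ)) (x≤A δ 0<δ) (y≥B δ 0<δ)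
    where
    at-late-time : Eventually (λ t → x t ℚ.≤ ι A ℚ.+ 1ℚ) → Eventually (λ t → x t ℚ.≤ ι A ℚ.+ δ) →
      Eventually (λ t → ι B ℚ.≤ y t ℚ.+ δ) → majorant B g < c * A ^ j
    at-late-time (N₄ , x≤A+1) (N₅ , x≤A+δ) (N₆ , B≤y+δ) =
      approximate-dominance g c j A B {x t} {y t} {δ} {ε}
        (0≤x t (ℕ.m+n≤o⇒m≤o N₁ late₁)) (0≤y t (ℕ.m+n≤o⇒m≤o N₂ late₂)) (ℚ.<⇒≤ 0<δ)
        (x≤A+1 t (ℕ.m+n≤o⇒m≤o N₄ late₄)) (x≤A+δ t (ℕ.m+n≤o⇒m≤o N₅ late₅)) (B≤y+δ t (ℕ.m+n≤o⇒n≤o N₅ late₅))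
        slope≤ε (dominates t (ℕ.m+n≤o⇒m≤o N₃ late₃))
      where
      t : ℕ
      t = N₁ + (N₂ + (N₃ + (N₄ + (N₅ + N₆))))
      late₁ : N₁ + (N₂ + (N₃ + (N₄ + (N₅ + N₆)))) ≤ t
      late₁ = ℕ.≤-refl
      late₂ : N₂ + (N₃ + (N₄ + (N₅ + N₆))) ≤ t
      late₂ = ℕ.m+n≤o⇒n≤o N₁ late₁
      late₃ : N₃ + (N₄ + (N₅ + N₆)) ≤ t
      late₃ = ℕ.m+n≤o⇒n≤o N₂ late₂
      late₄ : N₄ + (N₅ + N₆) ≤ t
      late₄ = ℕ.m+n≤o⇒n≤o N₃ late₃
      late₅ : N₅ + N₆ ≤ t
      late₅ = ℕ.m+n≤o⇒n≤o N₄ late₄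

upper-bound : ∀ n d x η → d ≤ n → x ℚ.+ ι d ℚ.< ι n ℚ.+ η → x ℚ.≤ ι (n ℕ.∸ d) ℚ.+ η
upper-bound n d x η d≤n h = ℚ.<⇒≤ (+-cancelʳ-< (ι d) (subst (x ℚ.+ ι d ℚ.<_) (begin
  ι n ℚ.+ η                          ≡⟨ cong (λ m → ι m ℚ.+ η) (ℕ.m∸n+n≡m d≤n) ⟨
  ι (n ℕ.∸ d + d) ℚ.+ η              ≡⟨ cong (ℚ._+ η) (ι-+ (n ℕ.∸ d) d) ⟩
  ι (n ℕ.∸ d) ℚ.+ ι d ℚ.+ η          ≡⟨ swap (ι (n ℕ.∸ d)) (ι d) η ⟩
  ι (n ℕ.∸ d) ℚ.+ η ℚ.+ ι d          ∎) h))
  where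
  open ≡-Reasoning
  swap : ∀ a b c → a ℚ.+ b ℚ.+ c ≡ a ℚ.+ c ℚ.+ b
  swap = solve-∀ ℚ-almostCommutativeRing

lower-bound : ∀ n d y η → ι n ℚ.< y ℚ.+ ℚ.- ι d ℚ.+ η → ι (n + d) ℚ.< y ℚ.+ η
lower-bound n d y η h =
  subst₂ ℚ._<_ (sym (ι-+ n d)) (cancel y (ι d) η) (ℚ.+-monoˡ-< (ι d) h)
  where
  cancel : ∀ y d η → y ℚ.+ ℚ.- d ℚ.+ η ℚ.+ d ≡ y ℚ.+ η
  cancel = solve-∀ ℚ-almostCommutativeRing

nonNeg-lower-bound : ∀ n d y → ι n ℚ.< y ℚ.+ ℚ.- ι d ℚ.+ ι n → 0ℚ ℚ.≤ y
nonNeg-lower-bound n d y h = ℚ.≤-trans (0≤ι d) (ℚ.<⇒≤ (+-cancelʳ-< (ι n)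
  (subst (ℚ._< y ℚ.+ ι n) (trans (ι-+ n d) (ℚ.+-comm (ι n) (ι d))) (lower-bound n d y (ι n) h))))

eventually-nonNeg : ∀ x → fromℕ 0 <ᵣ x → Eventually (λ t → 0ℚ ℚ.≤ seq x t)
eventually-nonNeg x (η , 0<η , N , η<x) = N , λ t N≤t →
  ℚ.<⇒≤ (ℚ.<-trans 0<η (subst (ℚ._< seq x t) (ℚ.+-identityˡ η) (η<x t N≤t)))

-- As α is strictly positive, α + d ≤ n forces d < n; so A = n - d is positive and the truncated
-- subtraction is exact.
d<n : ∀ α n d → fromℕ 0 <ᵣ α → α +ᵣ fromℕ d ≤ᵣ fromℕ n → d < n
d<n α n d (ε , 0<ε , M , ε<α) α+d≤n =
  let N , α+d<n+ε = α+d≤n ε 0<ε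
      t = M ℕ.⊔ N
      open ℚ.≤-Reasoning
  in ι-cancel-< d n (+-cancelʳ-< ε (begin-strict
    ι d ℚ.+ ε                        ≡⟨ ℚ.+-comm (ι d) ε ⟩
    ε ℚ.+ ι d                        ≡⟨ cong (ℚ._+ ι d) (ℚ.+-identityˡ ε) ⟨
    0ℚ ℚ.+ ε ℚ.+ ι d                 <⟨ ℚ.+-monoˡ-< (ι d) (ε<α t (ℕ.m≤m⊔n M N)) ⟩
    seq α t ℚ.+ ι d                  <⟨ α+d<n+ε t (ℕ.m≤n⊔m M N) ⟩
    ι n ℚ.+ ε                        ∎))

eventually-upper : ∀ α n d → d ≤ n → α +ᵣ fromℕ d ≤ᵣ fromℕ n →
  ∀ δ → 0ℚ ℚ.< δ → Eventually (λ t → seq α t ℚ.≤ ι (n ℕ.∸ d) ℚ.+ δ)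
eventually-upper α n d d≤n α+d≤n δ 0<δ =
  proj₁ (α+d≤n δ 0<δ) , λ t N≤t → upper-bound n d (seq α t) δ d≤n (proj₂ (α+d≤n δ 0<δ) t N≤t)

eventually-lower : ∀ β n d → fromℕ n ≤ᵣ β -ᵣ fromℕ d →
  ∀ δ → 0ℚ ℚ.< δ → Eventually (λ t → ι (n + d) ℚ.≤ seq β t ℚ.+ δ)
eventually-lower β n d n≤β-d δ 0<δ =
  proj₁ (n≤β-d δ 0<δ) , λ t N≤t → ℚ.<⇒≤ (lower-bound n d (seq β t) δ (proj₂ (n≤β-d δ 0<δ) t N≤t))

-- The weak inequality n ≤ β - d with tolerance n says that the terms of β eventually exceed d.
eventually-nonNeg-lower : ∀ β n d → 0 < n → fromℕ n ≤ᵣ β -ᵣ fromℕ d → Eventually (λ t → 0ℚ ℚ.≤ seq β t)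
eventually-nonNeg-lower β n d 0<n n≤β-d = let N , h = n≤β-d (ι n) (0<ι 0<n) in
  N , λ t N≤t → nonNeg-lower-bound n d (seq β t) (h t N≤t)

seq-term : ∀ c x i t → seq (fromℕ c *ᵣ x ^ᵣ i) t ≡ ι c ℚ.* seq x t ^ℚ i
seq-term c x i t = seq-scale c (x ^ᵣ i) (seq x t ^ℚ i) t (seq-^ x i t)

-- Record types are injective, so unification finds the real numbers x and y without unfolding
-- them; unfolded, their Cauchy proofs are too large to compare.
record Holds {A B : Set} (P : A → B → Set) (x : A) (y : B) : Set where
  constructor holds
  field proof : P x y

DominanceClaim : ∀ {m} → Vector ℤ (suc m) → Fin (suc m) → ℕ → ℕ → Vector ℝ (suc m) → ℝ → Set
DominanceClaim a j A B x y = sumᵣ (removeAt x j) <ᵣ y →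
  majorant B (zeroAt (toℕ j) (toList a)) < ∣ a j ∣ * A ^ toℕ j

-- The two sides x and y enter only through the terms of their sequences, so no Cauchy proof is ever
-- unfolded.
dominanceClaim : ∀ {m} (a : Vector ℤ (suc m)) α β j n d → fromℕ 0 <ᵣ α →
  fromℕ n ≤ᵣ β -ᵣ fromℕ d → α +ᵣ fromℕ d ≤ᵣ fromℕ n → ∀ {x y} →
  (∀ i t → seq (x i) t ≡ ι ∣ a i ∣ ℚ.* seq β t ^ℚ toℕ i) →
  (∀ t → seq y t ≡ ι ∣ a j ∣ ℚ.* seq α t ^ℚ toℕ j) →
  Holds (DominanceClaim a j (n ℕ.∸ d) (n + d)) x y
dominanceClaim a α β j n d 0<α n≤β-d α+d≤n {x} seq-x seq-y = holds λ { (ε , 0<ε , N , dominates) →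
  limit-dominance (zeroAt (toℕ j) (toList a)) ∣ a j ∣ (toℕ j) (n ℕ.∸ d) (n + d) (seq α) (seq β)
    (eventually-nonNeg α 0<α)
    (eventually-nonNeg-lower β n d (ℕ.≤-<-trans ℕ.z≤n d<n′) n≤β-d)
    (eventually-upper α n d (ℕ.<⇒≤ d<n′) α+d≤n)
    (eventually-lower β n d n≤β-d)
    ε 0<ε
    (N , λ t N≤t → subst₂ (λ p q → p ℚ.+ ε ℚ.< q)
      (seq-sum-removeAt x a (seq β t ^ℚ_) j t (λ i → seq-x i t)) (seq-y t) (dominates t N≤t)) }
  where
  d<n′ : d < n
  d<n′ = d<n α n d 0<α α+d≤n

powers-dominanceClaim : ∀ {m} (a : Vector ℤ (suc m)) (α β : ℝ) (j : Fin (suc m)) (n d : ℕ) → fromℕ 0 <ᵣ α →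
  fromℕ n ≤ᵣ β -ᵣ fromℕ d → α +ᵣ fromℕ d ≤ᵣ fromℕ n →
  Holds (DominanceClaim a j (n ℕ.∸ d) (n + d)) (λ i → fromℕ ∣ a i ∣ *ᵣ β ^ᵣ toℕ i) (fromℕ ∣ a j ∣ *ᵣ α ^ᵣ toℕ j)
powers-dominanceClaim a α β j n d 0<α n≤β-d α+d≤n = dominanceClaim a α β j n d 0<α n≤β-d α+d≤n
    (λ i t → seq-term ∣ a i ∣ β (toℕ i) t) (λ t → seq-term ∣ a j ∣ α (toℕ j) t)

integral-dominance : ∀ {m} (a : Vector ℤ (suc m)) (α β : ℝ) (j : Fin (suc m)) (n d : ℕ) → fromℕ 0 <ᵣ α →
  fromℕ n ≤ᵣ β -ᵣ fromℕ d → α +ᵣ fromℕ d ≤ᵣ fromℕ n →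
  sumᵣ (removeAt (λ i → fromℕ ∣ a i ∣ *ᵣ β ^ᵣ toℕ i) j) <ᵣ fromℕ ∣ a j ∣ *ᵣ α ^ᵣ toℕ j →
  majorant (n + d) (zeroAt (toℕ j) (toList a)) < ∣ a j ∣ * (n ℕ.∸ d) ^ toℕ j
integral-dominance a α β j n d 0<α n≤β-d α+d≤n =
  Holds.proof (powers-dominanceClaim a α β j n d 0<α n≤β-d α+d≤n)

-- Irreducibility

eval-cong : ∀ {f g} n → f ≋ g → eval f (+ n) ≡ eval g (+ n)
eval-cong {f} {g} n f≋g = trans (sym (coeff₀-comp (+ n) 1ℤ f))
  (trans (at (comp-cong (linear n 1) f≋g) 0) (coeff₀-comp (+ n) 1ℤ g))

eval-* : ∀ n f g → eval (f *ₚ g) (+ n) ≡ eval f (+ n) ℤ.* eval g (+ n)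
eval-* n f g = begin
  eval (f *ₚ g) (+ n)                                          ≡⟨ coeff₀-comp (+ n) 1ℤ (f *ₚ g) ⟨
  coeff (comp (f *ₚ g) z) 0                                    ≡⟨ at (comp-* z f g) 0 ⟩
  coeff (comp f z *ₚ comp g z) 0                               ≡⟨ coeff-* (comp f z) (comp g z) 0 ⟩
  coeff (comp f z) 0 ℤ.* coeff (comp g z) 0                    ≡⟨ cong₂ ℤ._*_ (coeff₀-comp (+ n) 1ℤ f) (coeff₀-comp (+ n) 1ℤ g) ⟩
  eval f (+ n) ℤ.* eval g (+ n)                                ∎
  where
  open ≡-Reasoning
  z : ℤ[z]
  z = linear n 1

∣-content : ∀ c f → (∀ i → c ℤ.∣ coeff f i) → c ℤ.∣ foldr ℤ.gcd 0ℤ f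
∣-content c []      c∣ = ∣ c ∣ ∣0
∣-content c (a ∷ f) c∣ = ℤ.gcd-greatest {a} {foldr ℤ.gcd 0ℤ f} {c} (c∣ 0) (∣-content c f (λ i → c∣ (suc i)))

_∣ₚ_ : ℤ[z] → ℤ[z] → Set
_∣ₚ_ = RawSemiringDefinitions._∣_ ℤ[z]-rawSemiring

-- The constant divides all coefficients of f, hence its content 1; so it is 1 or -1 and its own
-- inverse.
constant-factor-unit : ∀ {f g h} → Primitive f → f ≋ g *ₚ h → DegreeAtMost 0 g → g ∣ₚ const 1ℤ
constant-factor-unit {f} {g} {h} prim f≋gh deg = const c RawMagmaDefinitions., at (begin
  const c *ₚ g            ≈⟨ *ₚ-congˡ (const c) (upTo-≋ 0 g deg) ⟩
  const c *ₚ const c      ≈⟨ const-* c c ⟩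
  const (c ℤ.* c)         ≈⟨ ∷-cong (trans (square-abs c) (cong (λ t → + (t * t)) ∣c∣≡1)) ≋-refl ⟩
  const 1ℤ                ∎)
  where
  open ≋-Reasoning
  c : ℤ
  c = coeff g 0
  f≋ch : f ≋ c · h
  f≋ch = ≋-trans f≋gh (≋-trans (*ₚ-congʳ h (upTo-≋ 0 g deg)) ([ c ]*ₚ h))
  c∣f : ∀ i → c ℤ.∣ coeff f i
  c∣f i = divides ∣ coeff h i ∣ (trans (cong ∣_∣ (trans (at f≋ch i) (coeff-· c h i)))
    (trans (ℤ.abs-* c (coeff h i)) (ℕ.*-comm ∣ c ∣ ∣ coeff h i ∣)))
  ∣c∣≡1 : ∣ c ∣ ≡ 1
  ∣c∣≡1 = ∣1⇒≡1 (subst (c ℤ.∣_) prim (∣-content c f c∣f))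

-- A factor whose value at n is prime to p takes a value dividing d, which is too small
-- for a nonconstant factor.
prime-to-p-factor-unit : ∀ {f g h p k d} n → Prime p → 0 < d → Primitive f →
  UnitOnDisc (comp f (linear n d)) → ∣ eval f (+ n) ∣ ≡ p ^ k * d → f ≋ g *ₚ h →
  ¬ p ∣ℤ eval g (+ n) → g ∣ₚ const 1ℤ
prime-to-p-factor-unit {f} {g} {h} {p} {k} {d} n p-prime 0<d prim unit value f≋gh p∤g with degree? g
... | inj₁ []≋g = contradiction (subst (p ∣ℤ_) (eval-cong n []≋g) (p ∣0)) p∤g
... | inj₂ (zero  , deg , _)     = constant-factor-unit prim f≋gh deg
... | inj₂ (suc r , deg , top≢0) = contradiction
  (∣⇒≤ {{ℕ.>-nonZero 0<d}} (prime-to-p-divisor p-prime k p∤g (divides ∣ eval h (+ n) ∣ p^kd≡)))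
  (ℕ.<⇒≱ (nonconstant-value n d {g} r 0<d (factor-unitOnDisc {H = comp h (linear n d)} comp≋ unit) deg top≢0))
  where
  comp≋ : comp f (linear n d) ≋ comp g (linear n d) *ₚ comp h (linear n d)
  comp≋ = ≋-trans (comp-cong (linear n d) f≋gh) (comp-* (linear n d) g h)
  p^kd≡ : p ^ k * d ≡ ∣ eval h (+ n) ∣ * ∣ eval g (+ n) ∣
  p^kd≡ = trans (sym value) (trans (cong ∣_∣ (trans (eval-cong n f≋gh) (eval-* n g h)))
    (trans (ℤ.abs-* (eval g (+ n)) (eval h (+ n))) (ℕ.*-comm ∣ eval g (+ n) ∣ ∣ eval h (+ n) ∣)))

-- The Newton polygon argument for g(n + z) and h(n + z): their coefficient sequences convolve to
-- the Taylor coefficients of f at n.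
values-not-both-divisible : ∀ {f g h p k d} n ℓ → Prime p → p ∤ d → 0 < k → 0 < ℓ →
  ∣ eval f (+ n) ∣ ≡ p ^ k * d → gcd k ℓ ≡ 1 →
  (∀ i → i < ℓ → + (p ^ k) ℤ.∣ taylorCoeff f i (+ n)) →
  (1 < k → ¬ (+ p ℤ.∣ taylorCoeff f ℓ (+ n))) →
  f ≋ g *ₚ h → p ∣ℤ eval g (+ n) → p ∣ℤ eval h (+ n) → ⊥
values-not-both-divisible {f} {g} {h} {p} {k} {d} n ℓ p-prime p∤d 0<k 0<ℓ value coprime low top f≋gh p∣g p∣h =
  not-both-divisible p-prime k ℓ 0<k 0<ℓ (coeff G) (coeff H) coprime
    (λ i i<ℓ → subst (p ^ k ∣ℤ_) (taylor≡ i) (low i i<ℓ))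
    -- Since |f(n)| = p^k d, one more factor p would have to divide d.
    (λ ∣GH → p∤d (*-cancelˡ-∣ (p ^ k) {{ℕ.m^n≢0 p k {{prime⇒nonZero p-prime}}}}
      (subst₂ _∣_ (ℕ.*-comm p (p ^ k)) (trans (cong ∣_∣ (sym value₀)) value) ∣GH)))
    (λ 1<k p∣ → top 1<k (subst (p ∣ℤ_) (sym (taylor≡ ℓ)) p∣))
    (subst (p ∣ℤ_) (sym (coeff₀-comp (+ n) 1ℤ g)) p∣g)
    (subst (p ∣ℤ_) (sym (coeff₀-comp (+ n) 1ℤ h)) p∣h)
  where
  z G H : ℤ[z]
  z = linear n 1
  G = comp g z
  H = comp h z
  F≋GH : comp f z ≋ G *ₚ H
  F≋GH = ≋-trans (comp-cong z f≋gh) (comp-* z g h)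
  taylor≡ : ∀ i → taylorCoeff f i (+ n) ≡ convolution (coeff G) (coeff H) i
  taylor≡ i = trans (taylorCoeff≡coeff f i n) (trans (at F≋GH i) (coeff-* G H i))
  value₀ : eval f (+ n) ≡ coeff G 0 ℤ.* coeff H 0
  value₀ = trans (sym (coeff₀-comp (+ n) 1ℤ f)) (trans (at F≋GH 0) (coeff-* G H 0))

dominance⇒unitOnDisc : ∀ {n d} f j → d < n →
  majorant (n + d) (zeroAt j f) < ∣ coeff f j ∣ * (n ℕ.∸ d) ^ j → UnitOnDisc (comp f (linear n d))
dominance⇒unitOnDisc {n} {d} f j d<n dominant = subst (λ x → UnitOnDisc (comp f (linear x d))) n≡
  (dominant⇒unitOnDisc (n ℕ.∸ d) d f j (ℕ.m<n⇒0<n∸m d<n)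
    (subst (λ x → majorant (x + d) (zeroAt j f) < ∣ coeff f j ∣ * (n ℕ.∸ d) ^ j) (sym n≡) dominant))
  where
  n≡ : n ℕ.∸ d + d ≡ n
  n≡ = ℕ.m∸n+n≡m (ℕ.<⇒≤ d<n)

irreducible : ∀ {f n d k ℓ p} → Primitive f → UnitOnDisc (comp f (linear n d)) → 0 < d → 0 < k → 0 < ℓ →
  Prime p → p ∤ d → ∣ eval f (+ n) ∣ ≡ p ^ k * d → gcd k ℓ ≡ 1 →
  (∀ i → i < ℓ → + (p ^ k) ℤ.∣ taylorCoeff f i (+ n)) →
  (1 < k → ¬ (+ p ℤ.∣ taylorCoeff f ℓ (+ n))) → Irreducible f
irreducible {f} {n} {d} {k} {ℓ} {p} prim unit 0<d 0<k 0<ℓ p-prime p∤d value coprime low top =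
  RawSemiringDefinitions.mkIrred not-unit split
  where
  p∣value : p ∣ ∣ eval f (+ n) ∣
  p∣value = subst (p ∣_) (sym value) (∣m⇒∣m*n d (p∣p^ 0<k))
    where
    p∣p^ : ∀ {k} → 0 < k → p ∣ p ^ k
    p∣p^ {suc k} _ = m∣m*n (p ^ k)
  not-unit : ¬ f ∣ₚ const 1ℤ
  -- Since k > 0, p divides f(n); an inverse q would make p divide 1.
  not-unit (q RawMagmaDefinitions., qf≈1) = ℕ.nonTrivial⇒≢1 {{prime⇒nonTrivial p-prime}} (∣1⇒≡1 (subst (p ∣_) (begin
    ∣ eval q (+ n) ∣ * ∣ eval f (+ n) ∣      ≡⟨ ℤ.abs-* (eval q (+ n)) (eval f (+ n)) ⟨
    ∣ eval q (+ n) ℤ.* eval f (+ n) ∣        ≡⟨ cong ∣_∣ (eval-* n q f) ⟨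
    ∣ eval (q *ₚ f) (+ n) ∣                  ≡⟨ cong ∣_∣ (eval-cong n (pointwise {q *ₚ f} {const 1ℤ} qf≈1)) ⟩
    ∣ 1ℤ ℤ.+ + n ℤ.* 0ℤ ∣                    ≡⟨ cong (λ t → ∣ 1ℤ ℤ.+ t ∣) (ℤ.*-zeroʳ (+ n)) ⟩
    1                                        ∎) (∣n⇒∣m*n ∣ eval q (+ n) ∣ p∣value)))
    where open ≡-Reasoning
  split : ∀ {g h} → f ≈ₚ g *ₚ h → g ∣ₚ const 1ℤ ⊎ h ∣ₚ const 1ℤ
  split {g} {h} f≈gh with p ∣? ∣ eval g (+ n) ∣ | p ∣? ∣ eval h (+ n) ∣
  ... | no  p∤g | _       = inj₁ (prime-to-p-factor-unit {k = k} n p-prime 0<d prim unit value f≋gh p∤g)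
    where
    f≋gh : f ≋ g *ₚ h
    f≋gh = pointwise f≈gh
  ... | yes _   | no  p∤h = inj₂ (prime-to-p-factor-unit {k = k} n p-prime 0<d prim unit value
    (≋-trans (pointwise {f} {g *ₚ h} f≈gh) (*ₚ-comm g h)) p∤h)
  ... | yes p∣g | yes p∣h = ⊥-elim (values-not-both-divisible {f} {g} {h} n ℓ p-prime p∤d 0<k 0<ℓ
    value coprime low top (pointwise f≈gh) p∣g p∣h)

theorem2 : ∀ (m : ℕ) (a : Vector ℤ (suc m)) → let f = toList a in
    Primitive f →
    ∀ (α β : ℝ) → fromℕ 0 <ᵣ α → α <ᵣ β →
    ∀ (j : Fin (suc m)) →
    sumᵣ (removeAt (λ i → fromℕ ∣ a i ∣ *ᵣ β ^ᵣ toℕ i) j) <ᵣ fromℕ ∣ a j ∣ *ᵣ α ^ᵣ toℕ j →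
    ∀ (n d k ℓ p : ℕ) → 0 < n → 0 < d → 0 < k → 0 < ℓ → ℓ ≤ m →
    Prime p → p ∤ d →
    fromℕ n ≤ᵣ β -ᵣ fromℕ d → α +ᵣ fromℕ d ≤ᵣ fromℕ n →
    eval f (+ n) ≡ + (p ^ k * d) ⊎ eval f (+ n) ≡ - (+ (p ^ k * d)) →
    gcd k ℓ ≡ 1 →
    (∀ i → i < ℓ → + (p ^ k) ℤ.∣ taylorCoeff f i (+ n)) →
    (1 < k → ¬ (+ p ℤ.∣ taylorCoeff f ℓ (+ n))) →
    Irreducible f
theorem2 m a prim α β 0<α _ j dominates n d k ℓ p _ 0<d 0<k 0<ℓ _ p-prime p∤d n≤β-d α+d≤n ±value coprime low top =
  irreducible prim
    (dominance⇒unitOnDisc (toList a) (toℕ j) (d<n α n d 0<α α+d≤n)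
      (subst (λ c → majorant (n + d) (zeroAt (toℕ j) (toList a)) < ∣ c ∣ * (n ℕ.∸ d) ^ toℕ j)
        (sym (coeff-toList a j)) (integral-dominance a α β j n d 0<α n≤β-d α+d≤n dominates)))
    0<d 0<k 0<ℓ p-prime p∤d
    ([ cong ∣_∣ , (λ e → trans (cong ∣_∣ e) (ℤ.∣-i∣≡∣i∣ (+ (p ^ k * d)))) ]′ ±value)
    coprime low top
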